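{- Let $p\equiv 1\pmod 3$ be a prime, let $\eta_3$ be a primitive cubic character in $\widehat{\mathbb{F}_p^\times}$ (a character of exact order $3$), and let $\varepsilon$ denote the trivial character. If $\lambda\in\mathbb{F}_p$ satisfies $1+2\lambda\neq 0$, then $${}_2\mathbb{F}_1\left[\begin{matrix}\eta_3 & \eta_3^2\\ & \varepsilon\end{matrix};\,1-\lambda^3\right]={}_2\mathbb{F}_1\left[\begin{matrix}\eta_3 & \eta_3^2\\ & \varepsilon\end{matrix};\,\left(\frac{1-\lambda}{1+2\lambda}\right)^3\right].$$
   Context: For a finite field $\mathbb{F}_q$, $\widehat{\mathbb{F}_q^\times}$ is the group of complex-valued multiplicative characters of $\mathbb{F}_q^\times$; every character $\chi$, including the trivial character $\varepsilon$, is extended to $\mathbb{F}_q$ by $\chi(0)=0$, and $\overline{\chi}=\chi^{ -1}$. The Jacobi sum is $J(A,B)=\sum_{x\in\mathbb{F}_q}A(x)B(1-x)$. For $A,B,C\in\widehat{\mathbb{F}_q^\times}$ and $\lambda\in\mathbb{F}_q$, $${}_2\mathbb{P}_1\left[\begin{matrix}A & B\\ & C\end{matrix};\lambda\right]=\sum_{y\in\mathbb{F}_q}B(y)\,C\overline{B}(1-y)\,\overline{A}(1-\lambda y),\qquad {}_2\mathbb{F}_1\left[\begin{matrix}A & B\\ & C\end{matrix};\lambda\right]=\frac{1}{J(B,C\overline{B})}\,{}_2\mathbb{P}_1\left[\begin{matrix}A & B\\ & C\end{matrix};\lambda\right].$$ -}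

module Defs where

open import Algebra.Bundles using (CommutativeRing)
open import Algebra.Definitions using (Invertible)
import Algebra.Definitions.RawMonoid as RawMonoid
import Algebra.Solver.Ring
open import Algebra.Solver.Ring.AlmostCommutativeRing using (fromCommutativeRing; _-Raw-AlmostCommutative⟶_)
open import Data.Fin.Base using (Fin; toℕ)
import Data.Fin.Properties as Fin
open import Data.Integer.Base as ℤ using (ℤ; +_; -[1+_])
import Data.Integer.Properties as ℤ
open import Data.Maybe.Base as Maybe using (Maybe)
open import Data.Nat.Base as ℕ using (ℕ; zero; suc; NonZero)
open import Data.Nat.Coprimality using (prime⇒coprime; coprime-Bézout)
open import Data.Nat.DivMod
  using (_%_; _mod_; m<n⇒m%n≡m; n%n≡0; m*n%n≡0; [m+kn]%n≡m%n; %-distribˡ-+; %-distribˡ-*)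
open import Data.Nat.GCD using (module Bézout)
open import Data.Nat.Primality using (Prime; prime⇒nonZero; prime⇒nonTrivial)
import Data.Nat.Properties as ℕ
open import Data.Product.Base using (∃; _×_; _,_; proj₁; proj₂)
open import Data.Rational.Base as ℚ using (ℚ; 0ℚ; 1ℚ; ½)
import Data.Rational.Properties as ℚ
open import Level using (0ℓ)
open import Relation.Binary.PropositionalEquality as ≡
  using (_≡_; _≢_; cong; cong₂; subst)
open import Relation.Binary.Structures using (IsEquivalence)
open import Relation.Nullary using (¬_; Dec; yes; no; contradiction; dec⇒maybe)

------------------------------------------------------------------------
-- Ring solver with integer coefficients, over any commutative ring

module IntegerSolver (R : CommutativeRing 0ℓ 0ℓ) where
  open CommutativeRing R
  open import Algebra.Properties.Ring ring
  open import Algebra.Properties.AbelianGroup +-abelianGroup using (⁻¹-∙-comm)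
  open import Algebra.Properties.Semiring.Mult.TCOptimised semiring renaming (_×_ to _×′_)
  open import Relation.Binary.Reasoning.Setoid setoid
  open import Algebra.Properties.CommutativeSemigroup +-commutativeSemigroup using (interchange)

  fromℤ : ℤ → Carrier
  fromℤ (+ n)      = n ×′ 1#
  fromℤ (-[1+ n ]) = - (suc n ×′ 1#)

  fromℤ-⊖ : ∀ m n → fromℤ (m ℤ.⊖ n) ≈ m ×′ 1# + - (n ×′ 1#)
  fromℤ-⊖ zero zero = sym (-‿inverseʳ 0#)
  fromℤ-⊖ zero (suc n) = sym (+-identityˡ _)
  fromℤ-⊖ (suc m) zero = sym (trans (+-congˡ -0#≈0#) (+-identityʳ _))
  fromℤ-⊖ (suc m) (suc n) = begin
    fromℤ (suc m ℤ.⊖ suc n)                  ≡⟨ cong fromℤ (ℤ.[1+m]⊖[1+n]≡m⊖n m n) ⟩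
    fromℤ (m ℤ.⊖ n)                          ≈⟨ fromℤ-⊖ m n ⟩
    m ×′ 1# + - (n ×′ 1#)                      ≈⟨ +-identityˡ _ ⟨
    0# + (m ×′ 1# + - (n ×′ 1#))               ≈⟨ +-congʳ (-‿inverseʳ 1#) ⟨
    (1# + - 1#) + (m ×′ 1# + - (n ×′ 1#))      ≈⟨ interchange _ _ _ _ ⟩
    (1# + m ×′ 1#) + (- 1# + - (n ×′ 1#))      ≈⟨ +-congˡ (⁻¹-∙-comm _ _) ⟩
    (1# + m ×′ 1#) + - (1# + n ×′ 1#)          ≈⟨ +-cong (1+× m 1#) (-‿cong (1+× n 1#)) ⟨
    suc m ×′ 1# + - (suc n ×′ 1#)              ∎

  fromℤ-+ : ∀ i j → fromℤ (i ℤ.+ j) ≈ fromℤ i + fromℤ j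
  fromℤ-+ (+ m)    (+ n)    = ×-homo-+ 1# m n
  fromℤ-+ (+ m)    -[1+ n ] = fromℤ-⊖ m (suc n)
  fromℤ-+ -[1+ m ] (+ n)    = trans (fromℤ-⊖ n (suc m)) (+-comm _ _)
  fromℤ-+ -[1+ m ] -[1+ n ] = begin
    - (suc (suc (m ℕ.+ n)) ×′ 1#)             ≡⟨ cong (λ k → - (suc k ×′ 1#)) (ℕ.+-suc m n) ⟨
    - ((suc m ℕ.+ suc n) ×′ 1#)               ≈⟨ -‿cong (×-homo-+ 1# (suc m) (suc n)) ⟩
    - (suc m ×′ 1# + suc n ×′ 1#)              ≈⟨ ⁻¹-∙-comm _ _ ⟨
    - (suc m ×′ 1#) + - (suc n ×′ 1#)          ∎

  fromℤ-neg : ∀ i → fromℤ (ℤ.- i) ≈ - fromℤ i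
  fromℤ-neg (+ zero)  = sym -0#≈0#
  fromℤ-neg (+ suc n) = refl
  fromℤ-neg -[1+ n ]  = sym (-‿involutive _)

  fromℤ-*-+ : ∀ m j → fromℤ (+ m ℤ.* j) ≈ m ×′ 1# * fromℤ j
  fromℤ-*-+ m (+ n) = trans (reflexive (cong fromℤ (≡.sym (ℤ.pos-* m n)))) (×1-homo-* m n)
  fromℤ-*-+ m -[1+ n ] = begin
    fromℤ (+ m ℤ.* -[1+ n ])        ≡⟨ cong fromℤ (ℤ.neg-distribʳ-* (+ m) (+ suc n)) ⟨
    fromℤ (ℤ.- (+ m ℤ.* + suc n))   ≈⟨ fromℤ-neg (+ m ℤ.* + suc n) ⟩
    - fromℤ (+ m ℤ.* + suc n)       ≈⟨ -‿cong (fromℤ-*-+ m (+ suc n)) ⟩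
    - (m ×′ 1# * suc n ×′ 1#)         ≈⟨ -‿distribʳ-* _ _ ⟩
    m ×′ 1# * - (suc n ×′ 1#)         ∎

  fromℤ-* : ∀ i j → fromℤ (i ℤ.* j) ≈ fromℤ i * fromℤ j
  fromℤ-* (+ m)    j = fromℤ-*-+ m j
  fromℤ-* -[1+ m ] j = begin
    fromℤ (-[1+ m ] ℤ.* j)          ≡⟨ cong fromℤ (ℤ.neg-distribˡ-* (+ suc m) j) ⟨
    fromℤ (ℤ.- (+ suc m ℤ.* j))     ≈⟨ fromℤ-neg (+ suc m ℤ.* j) ⟩
    - fromℤ (+ suc m ℤ.* j)         ≈⟨ -‿cong (fromℤ-*-+ (suc m) j) ⟩
    - (suc m ×′ 1# * fromℤ j)        ≈⟨ -‿distribˡ-* _ _ ⟩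
    - (suc m ×′ 1#) * fromℤ j        ∎

  fromℤ-morphism : ℤ.+-*-rawRing -Raw-AlmostCommutative⟶ fromCommutativeRing R
  fromℤ-morphism = record
    { ⟦_⟧    = fromℤ
    ; +-homo = fromℤ-+
    ; *-homo = fromℤ-*
    ; -‿homo = fromℤ-neg
    ; 0-homo = refl
    ; 1-homo = refl
    }

  _≟-coeff_ : ∀ i j → Maybe (fromℤ i ≈ fromℤ j)
  i ≟-coeff j = Maybe.map (λ eq → reflexive (cong fromℤ eq)) (dec⇒maybe (i ℤ.≟ j))

  open Algebra.Solver.Ring ℤ.+-*-rawRing (fromCommutativeRing R) fromℤ-morphism _≟-coeff_
    public

module RingIdentities (R : CommutativeRing 0ℓ 0ℓ) where
  open CommutativeRing R
  open IntegerSolver R using (solve; _:=_; _:+_; _:*_; :-_)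

  *-swap : ∀ a b c → a * (b * c) ≈ b * (a * c)
  *-swap = solve 3 (λ a b c → a :* (b :* c) := b :* (a :* c)) refl

  neg-flip : ∀ a b → - (a + - b) ≈ b + - a
  neg-flip = solve 2 (λ a b → :- (a :+ :- b) := b :+ :- a) refl

  neg-distrib : ∀ a b → - (a + - b) ≈ - a + - (- b)
  neg-distrib = solve 2 (λ a b → :- (a :+ :- b) := :- a :+ :- (:- b)) refl

  telescope : ∀ a b c → (a + - b) + (b + - c) ≈ a + - c
  telescope = solve 3 (λ a b c → (a :+ :- b) :+ (b :+ :- c) := a :+ :- c) refl

  split : ∀ a b → a ≈ (a + - b) + b
  split = solve 2 (λ a b → a := (a :+ :- b) :+ b) refl

  +-rearrange : ∀ a b c d → (a + - b) + (c + - d) ≈ (a + c) + - (b + d)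
  +-rearrange = solve 4 (λ a b c d →
    (a :+ :- b) :+ (c :+ :- d) := (a :+ c) :+ :- (b :+ d)) refl

  *-rearrange : ∀ a b c d → a * (c + - d) + d * (a + - b) ≈ a * c + - (b * d)
  *-rearrange = solve 4 (λ a b c d →
    a :* (c :+ :- d) :+ d :* (a :+ :- b) := a :* c :+ :- (b :* d)) refl

------------------------------------------------------------------------
-- Real and complex numbers

module Sequences where
  open import Data.Rational.Base using (_<_; _≤_; _+_; _*_; _-_; -_; ∣_∣; 1/_)
  open RingIdentities ℚ.+-*-commutativeRing

  -- A sequence x is Cauchy exactly when x ~ x, and for Cauchy sequences
  -- x ~ y says that x n - y n tends to 0.
  infix 4 _~_

  _~_ : (x y : ℕ → ℚ) → Set
  x ~ y = ∀ ε → 0ℚ < ε →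
    ∃ λ N → ∀ m n → N ℕ.≤ m → N ℕ.≤ n → ∣ x m - y n ∣ < ε

  private
    half>0 : ∀ {ε} → 0ℚ < ε → 0ℚ < ε * ½
    half>0 {ε} ε>0 = subst (_< ε * ½) (ℚ.*-zeroˡ ½) (ℚ.*-monoˡ-<-pos ½ ε>0)

    half+half : ∀ ε → ε * ½ + ε * ½ ≡ ε
    half+half ε = ≡.trans (≡.sym (ℚ.*-distribˡ-+ ε ½ ½)) (ℚ.*-identityʳ ε)

    small+small : ∀ {ε} a b → ∣ a ∣ < ε * ½ → ∣ b ∣ < ε * ½ → ∣ a + b ∣ < ε
    small+small {ε} a b p q = subst (∣ a + b ∣ <_) (half+half ε)
      (ℚ.≤-<-trans (ℚ.∣p+q∣≤∣p∣+∣q∣ a b) (ℚ.+-mono-< p q))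

    divide : ∀ {B} → 0ℚ < B → ℚ → ℚ
    divide {B} B>0 ε = ε * 1/ B
      where instance _ = ℚ.pos⇒nonZero B {{ℚ.positive B>0}}

    divide>0 : ∀ {B ε} (B>0 : 0ℚ < B) → 0ℚ < ε → 0ℚ < divide B>0 ε
    divide>0 {B} {ε} B>0 ε>0 = subst (_< ε * 1/ B) (ℚ.*-zeroˡ (1/ B))
      (ℚ.*-monoˡ-<-pos (1/ B) ε>0)
      where
      instance
        _ = ℚ.positive B>0
        _ = ℚ.pos⇒nonZero B
        _ = ℚ.1/pos⇒pos B

    bounded*small : ∀ {B ε} (B>0 : 0ℚ < B) a b →
                    ∣ a ∣ ≤ B → ∣ b ∣ < divide B>0 ε → ∣ a * b ∣ < ε
    bounded*small {B} {ε} B>0 a b a≤B b<ε/B = begin-strict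
      ∣ a * b ∣        ≡⟨ ℚ.∣p*q∣≡∣p∣*∣q∣ a b ⟩
      ∣ a ∣ * ∣ b ∣    ≤⟨ ℚ.*-monoʳ-≤-nonNeg ∣ b ∣ {{ℚ.∣-∣-nonNeg b}} a≤B ⟩
      B * ∣ b ∣        <⟨ ℚ.*-monoʳ-<-pos B b<ε/B ⟩
      B * (ε * 1/ B)   ≡⟨ *-swap B ε (1/ B) ⟩
      ε * (B * 1/ B)   ≡⟨ cong (ε *_) (ℚ.*-inverseʳ B) ⟩
      ε * 1ℚ           ≡⟨ ℚ.*-identityʳ ε ⟩
      ε                ∎
      where
      open ℚ.≤-Reasoning
      instance
        _ = ℚ.positive B>0
        _ = ℚ.pos⇒nonZero B

  ~-sym : ∀ {x y} → x ~ y → y ~ x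
  ~-sym {x} {y} x~y ε ε>0 with x~y ε ε>0
  ... | N , h = N , λ m n N≤m N≤n → subst (_< ε)
    (≡.trans (≡.sym (ℚ.∣-p∣≡∣p∣ (x n - y m))) (cong ∣_∣ (neg-flip (x n) (y m))))
    (h n m N≤n N≤m)

  ~-trans : ∀ {x y z} → x ~ y → y ~ z → x ~ z
  ~-trans {x} {y} {z} x~y y~z ε ε>0
    with x~y (ε * ½) (half>0 ε>0) | y~z (ε * ½) (half>0 ε>0)
  ... | N , h | M , k = N ℕ.⊔ M , λ m n N≤m N≤n →
    subst (λ e → ∣ e ∣ < ε) (telescope (x m) (y m) (z n))
      (small+small (x m - y m) (y m - z n)
        (h m m (ℕ.m⊔n≤o⇒m≤o N M N≤m) (ℕ.m⊔n≤o⇒m≤o N M N≤m))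
        (k m n (ℕ.m⊔n≤o⇒n≤o N M N≤m) (ℕ.m⊔n≤o⇒n≤o N M N≤n)))

  const-cauchy : ∀ q → (λ _ → q) ~ (λ _ → q)
  const-cauchy q ε ε>0 = 0 , λ _ _ _ _ →
    subst (λ e → ∣ e ∣ < ε) (≡.sym (ℚ.+-inverseʳ q)) ε>0

  ≗⇒~ : ∀ {x y} → x ~ x → (∀ n → x n ≡ y n) → x ~ y
  ≗⇒~ {x} {y} x~x x≗y ε ε>0 with x~x ε ε>0
  ... | N , h = N , λ m n N≤m N≤n →
    subst (λ e → ∣ x m - e ∣ < ε) (x≗y n) (h m n N≤m N≤n)

  +-~ : ∀ {x y u v} → x ~ y → u ~ v → (λ n → x n + u n) ~ (λ n → y n + v n)
  +-~ {x} {y} {u} {v} x~y u~v ε ε>0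
    with x~y (ε * ½) (half>0 ε>0) | u~v (ε * ½) (half>0 ε>0)
  ... | N , h | M , k = N ℕ.⊔ M , λ m n N≤m N≤n →
    subst (λ e → ∣ e ∣ < ε) (+-rearrange (x m) (y n) (u m) (v n))
      (small+small (x m - y n) (u m - v n)
        (h m n (ℕ.m⊔n≤o⇒m≤o N M N≤m) (ℕ.m⊔n≤o⇒m≤o N M N≤n))
        (k m n (ℕ.m⊔n≤o⇒n≤o N M N≤m) (ℕ.m⊔n≤o⇒n≤o N M N≤n)))

  neg-~ : ∀ {x y} → x ~ y → (λ n → - x n) ~ (λ n → - y n)
  neg-~ {x} {y} x~y ε ε>0 with x~y ε ε>0
  ... | N , h = N , λ m n N≤m N≤n → subst (_< ε)
    (≡.trans (≡.sym (ℚ.∣-p∣≡∣p∣ (x m - y n))) (cong ∣_∣ (neg-distrib (x m) (y n))))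
    (h m n N≤m N≤n)

  eventually-bounded : ∀ {x} → x ~ x →
    ∃ λ B → 0ℚ < B × ∃ λ N → ∀ n → N ℕ.≤ n → ∣ x n ∣ ≤ B
  eventually-bounded {x} x~x with x~x 1ℚ (ℚ.positive⁻¹ 1ℚ)
  ... | N , h = 1ℚ + ∣ x N ∣
              , ℚ.+-mono-<-≤ (ℚ.positive⁻¹ 1ℚ) (ℚ.0≤∣p∣ (x N))
              , N , λ n N≤n → begin
      ∣ x n ∣                   ≡⟨ cong ∣_∣ (split (x n) (x N)) ⟩
      ∣ (x n - x N) + x N ∣     ≤⟨ ℚ.∣p+q∣≤∣p∣+∣q∣ (x n - x N) (x N) ⟩
      ∣ x n - x N ∣ + ∣ x N ∣   ≤⟨ ℚ.+-monoˡ-≤ ∣ x N ∣ (ℚ.<⇒≤ (h n N N≤n ℕ.≤-refl)) ⟩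
      1ℚ + ∣ x N ∣              ∎
    where
    open ℚ.≤-Reasoning

  *-~ : ∀ {x y u v} → x ~ y → u ~ v → (λ n → x n * u n) ~ (λ n → y n * v n)
  *-~ {x} {y} {u} {v} x~y u~v ε ε>0 =
    combine (eventually-bounded {x} (~-trans {x} {y} {x} x~y (~-sym {x} {y} x~y)))
            (eventually-bounded {v} (~-trans {v} {u} {v} (~-sym {u} {v} u~v) u~v))
    where
    Bounded : (ℕ → ℚ) → Set
    Bounded w = ∃ λ B → 0ℚ < B × ∃ λ N → ∀ n → N ℕ.≤ n → ∣ w n ∣ ≤ B

    combine : Bounded x → Bounded v →
      ∃ λ N → ∀ m n → N ℕ.≤ m → N ℕ.≤ n → ∣ x m * u m - y n * v n ∣ < ε
    combine (B , B>0 , K , x≤B) (C , C>0 , L , v≤C) =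
      (K ℕ.⊔ L) ℕ.⊔ (N ℕ.⊔ M) , λ m n ≤m ≤n →
        let K≤m = ℕ.m⊔n≤o⇒m≤o K L (ℕ.m⊔n≤o⇒m≤o (K ℕ.⊔ L) (N ℕ.⊔ M) ≤m)
            L≤n = ℕ.m⊔n≤o⇒n≤o K L (ℕ.m⊔n≤o⇒m≤o (K ℕ.⊔ L) (N ℕ.⊔ M) ≤n)
            NM≤m = ℕ.m⊔n≤o⇒n≤o (K ℕ.⊔ L) (N ℕ.⊔ M) ≤m
            NM≤n = ℕ.m⊔n≤o⇒n≤o (K ℕ.⊔ L) (N ℕ.⊔ M) ≤n
        in subst (λ e → ∣ e ∣ < ε) (*-rearrange (x m) (y n) (u m) (v n))
             (small+small {ε} (x m * (u m - v n)) (v n * (x m - y n))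
               (bounded*small {B} {ε * ½} B>0 (x m) (u m - v n) (x≤B m K≤m)
                 (proj₂ u~v′ m n (ℕ.m⊔n≤o⇒n≤o N M NM≤m) (ℕ.m⊔n≤o⇒n≤o N M NM≤n)))
               (bounded*small {C} {ε * ½} C>0 (v n) (x m - y n) (v≤C n L≤n)
                 (proj₂ x~y′ m n (ℕ.m⊔n≤o⇒m≤o N M NM≤m) (ℕ.m⊔n≤o⇒m≤o N M NM≤n))))
      where
      x~y′ = x~y (divide C>0 (ε * ½)) (divide>0 C>0 (half>0 ε>0))
      u~v′ = u~v (divide B>0 (ε * ½)) (divide>0 B>0 (half>0 ε>0))
      N = proj₁ x~y′
      M = proj₁ u~v′

open Sequences using (_~_)

record ℝ : Set where
  constructor _⟨_⟩
  field
    seq    : ℕ → ℚ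
    cauchy : seq ~ seq

open ℝ using (seq; cauchy)

module RealOperations where
  infix  4 _≈_
  infixl 6 _+_
  infixl 7 _*_
  infix  8 -_

  _≈_ : ℝ → ℝ → Set
  x ≈ y = seq x ~ seq y

  fromℚ : ℚ → ℝ
  fromℚ q = (λ _ → q) ⟨ Sequences.const-cauchy q ⟩

  _+_ _*_ : ℝ → ℝ → ℝ
  (x ⟨ p ⟩) + (y ⟨ q ⟩) = (λ n → x n ℚ.+ y n) ⟨ Sequences.+-~ {x} {x} {y} {y} p q ⟩
  (x ⟨ p ⟩) * (y ⟨ q ⟩) = (λ n → x n ℚ.* y n) ⟨ Sequences.*-~ {x} {x} {y} {y} p q ⟩

  -_ : ℝ → ℝ
  - (x ⟨ p ⟩) = (λ n → ℚ.- x n) ⟨ Sequences.neg-~ {x} {x} p ⟩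

ℝ-commutativeRing : CommutativeRing 0ℓ 0ℓ
ℝ-commutativeRing = record
  { Carrier = ℝ
  ; _≈_     = _≈_
  ; _+_     = _+_
  ; _*_     = _*_
  ; -_      = -_
  ; 0#      = fromℚ 0ℚ
  ; 1#      = fromℚ 1ℚ
  ; isCommutativeRing = record
    { isRing = record
      { +-isAbelianGroup = record
        { isGroup = record
          { isMonoid = record
            { isSemigroup = record
              { isMagma = record
                { isEquivalence = ≈-isEquivalence
                ; ∙-cong = λ {x} {y} {u} {v} →
                    Sequences.+-~ {seq x} {seq y} {seq u} {seq v}
                }
              ; assoc = λ x y z → pointwise ((x + y) + z) (x + (y + z))
                  λ n → ℚ.+-assoc (seq x n) (seq y n) (seq z n)
              }
            ; identity = (λ x → pointwise (fromℚ 0ℚ + x) x λ n → ℚ.+-identityˡ (seq x n))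
                       , (λ x → pointwise (x + fromℚ 0ℚ) x λ n → ℚ.+-identityʳ (seq x n))
            }
          ; inverse = (λ x → pointwise (- x + x) (fromℚ 0ℚ) λ n → ℚ.+-inverseˡ (seq x n))
                    , (λ x → pointwise (x + - x) (fromℚ 0ℚ) λ n → ℚ.+-inverseʳ (seq x n))
          ; ⁻¹-cong = λ {x} {y} → Sequences.neg-~ {seq x} {seq y}
          }
        ; comm = λ x y → pointwise (x + y) (y + x) λ n → ℚ.+-comm (seq x n) (seq y n)
        }
      ; *-cong = λ {x} {y} {u} {v} →
          Sequences.*-~ {seq x} {seq y} {seq u} {seq v}
      ; *-assoc = λ x y z → pointwise ((x * y) * z) (x * (y * z))
          λ n → ℚ.*-assoc (seq x n) (seq y n) (seq z n)
      ; *-identity = (λ x → pointwise (fromℚ 1ℚ * x) x λ n → ℚ.*-identityˡ (seq x n))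
                   , (λ x → pointwise (x * fromℚ 1ℚ) x λ n → ℚ.*-identityʳ (seq x n))
      ; distrib =
          (λ x y z → pointwise (x * (y + z)) (x * y + x * z)
            λ n → ℚ.*-distribˡ-+ (seq x n) (seq y n) (seq z n))
        , (λ x y z → pointwise ((y + z) * x) (y * x + z * x)
            λ n → ℚ.*-distribʳ-+ (seq x n) (seq y n) (seq z n))
      }
    ; *-comm = λ x y → pointwise (x * y) (y * x) λ n → ℚ.*-comm (seq x n) (seq y n)
    }
  }
  where
  open RealOperations

  ≈-isEquivalence : IsEquivalence _≈_
  ≈-isEquivalence = record
    { refl  = λ {x} → cauchy x
    ; sym   = λ {x} {y} → Sequences.~-sym {seq x} {seq y}
    ; trans = λ {x} {y} {z} → Sequences.~-trans {seq x} {seq y} {seq z}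
    }

  pointwise : ∀ x y → (∀ n → seq x n ≡ seq y n) → x ≈ y
  pointwise x y = Sequences.≗⇒~ (cauchy x)

-- The ring R[i] with i² = -1; the pair (a , b) is a + b i.
adjoin-i : CommutativeRing 0ℓ 0ℓ → CommutativeRing 0ℓ 0ℓ
adjoin-i R = record
  { Carrier = Carrier × Carrier
  ; _≈_     = λ { (a , b) (c , d) → a ≈ c × b ≈ d }
  ; _+_     = λ { (a , b) (c , d) → a + c , b + d }
  ; _*_     = λ { (a , b) (c , d) → a * c + - (b * d) , a * d + b * c }
  ; -_      = λ { (a , b) → - a , - b }
  ; 0#      = 0# , 0#
  ; 1#      = 1# , 0#
  ; isCommutativeRing = record
    { isRing = record
      { +-isAbelianGroup = record
        { isGroup = record
          { isMonoid = record
            { isSemigroup = record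
              { isMagma = record
                { isEquivalence = record
                  { refl  = λ {x} → refl {proj₁ x} , refl {proj₂ x}
                  ; sym   = λ {x} {y} (p , q) →
                      sym {proj₁ x} {proj₁ y} p , sym {proj₂ x} {proj₂ y} q
                  ; trans = λ {x} {y} {z} (p , q) (p′ , q′) →
                      trans {proj₁ x} {proj₁ y} {proj₁ z} p p′
                    , trans {proj₂ x} {proj₂ y} {proj₂ z} q q′
                  }
                ; ∙-cong = λ {x} {y} {u} {v} (p , q) (p′ , q′) →
                    +-cong {proj₁ x} {proj₁ y} {proj₁ u} {proj₁ v} p p′
                  , +-cong {proj₂ x} {proj₂ y} {proj₂ u} {proj₂ v} q q′
                }
              ; assoc = λ { (a , b) (c , d) (e , f) → +-assoc a c e , +-assoc b d f }
              }
            ; identity = (λ { (a , b) → +-identityˡ a , +-identityˡ b })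
                       , (λ { (a , b) → +-identityʳ a , +-identityʳ b })
            }
          ; inverse = (λ { (a , b) → -‿inverseˡ a , -‿inverseˡ b })
                    , (λ { (a , b) → -‿inverseʳ a , -‿inverseʳ b })
          ; ⁻¹-cong = λ {x} {y} (p , q) →
              -‿cong {proj₁ x} {proj₁ y} p , -‿cong {proj₂ x} {proj₂ y} q
          }
        ; comm = λ { (a , b) (c , d) → +-comm a c , +-comm b d }
        }
      ; *-cong = λ {x} {y} {u} {v} → *-cong-i x y u v
      ; *-assoc = λ { (a , b) (c , d) (e , f) → assoc₁ a b c d e f , assoc₂ a b c d e f }
      ; *-identity = (λ { (a , b) → identityˡ₁ a b , identityˡ₂ a b })
                   , (λ { (a , b) → identityʳ₁ a b , identityʳ₂ a b })
      ; distrib =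
          (λ { (a , b) (c , d) (e , f) → distribˡ₁ a b c d e f , distribˡ₂ a b c d e f })
        , (λ { (a , b) (c , d) (e , f) → distribʳ₁ a b c d e f , distribʳ₂ a b c d e f })
      }
    ; *-comm = λ { (a , b) (c , d) → comm₁ a b c d , comm₂ a b c d }
    }
  }
  where
  open CommutativeRing R
  open IntegerSolver R using (solve; con; _:=_; _:+_; _:*_; :-_)

  *-cong-i : ∀ (x y u v : Carrier × Carrier) →
    proj₁ x ≈ proj₁ y × proj₂ x ≈ proj₂ y →
    proj₁ u ≈ proj₁ v × proj₂ u ≈ proj₂ v →
    (proj₁ x * proj₁ u + - (proj₂ x * proj₂ u)
      ≈ proj₁ y * proj₁ v + - (proj₂ y * proj₂ v)) ×
    (proj₁ x * proj₂ u + proj₂ x * proj₁ u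
      ≈ proj₁ y * proj₂ v + proj₂ y * proj₁ v)
  *-cong-i (a , b) (a′ , b′) (c , d) (c′ , d′) (p , q) (r , s) =
      +-cong {a * c} {a′ * c′} { - (b * d)} { - (b′ * d′)}
        (*-cong {a} {a′} {c} {c′} p r)
        (-‿cong {b * d} {b′ * d′} (*-cong {b} {b′} {d} {d′} q s))
    , +-cong {a * d} {a′ * d′} {b * c} {b′ * c′}
        (*-cong {a} {a′} {d} {d′} p s) (*-cong {b} {b′} {c} {c′} q r)

  assoc₁ : ∀ a b c d e f →
    (a * c + - (b * d)) * e + - ((a * d + b * c) * f) ≈
    a * (c * e + - (d * f)) + - (b * (c * f + d * e))
  assoc₁ = solve 6 (λ a b c d e f →
    (a :* c :+ :- (b :* d)) :* e :+ :- ((a :* d :+ b :* c) :* f) :=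
    a :* (c :* e :+ :- (d :* f)) :+ :- (b :* (c :* f :+ d :* e))) refl

  assoc₂ : ∀ a b c d e f →
    (a * c + - (b * d)) * f + (a * d + b * c) * e ≈
    a * (c * f + d * e) + b * (c * e + - (d * f))
  assoc₂ = solve 6 (λ a b c d e f →
    (a :* c :+ :- (b :* d)) :* f :+ (a :* d :+ b :* c) :* e :=
    a :* (c :* f :+ d :* e) :+ b :* (c :* e :+ :- (d :* f))) refl

  identityˡ₁ : ∀ a b →
    1# * a + - (0# * b) ≈
    a
  identityˡ₁ = solve 2 (λ a b →
    con (+ 1) :* a :+ :- (con (+ 0) :* b) :=
    a) refl

  identityˡ₂ : ∀ a b →
    1# * b + 0# * a ≈
    b
  identityˡ₂ = solve 2 (λ a b →
    con (+ 1) :* b :+ con (+ 0) :* a :=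
    b) refl

  identityʳ₁ : ∀ a b →
    a * 1# + - (b * 0#) ≈
    a
  identityʳ₁ = solve 2 (λ a b →
    a :* con (+ 1) :+ :- (b :* con (+ 0)) :=
    a) refl

  identityʳ₂ : ∀ a b →
    a * 0# + b * 1# ≈
    b
  identityʳ₂ = solve 2 (λ a b →
    a :* con (+ 0) :+ b :* con (+ 1) :=
    b) refl

  distribˡ₁ : ∀ a b c d e f →
    a * (c + e) + - (b * (d + f)) ≈
    (a * c + - (b * d)) + (a * e + - (b * f))
  distribˡ₁ = solve 6 (λ a b c d e f →
    a :* (c :+ e) :+ :- (b :* (d :+ f)) :=
    (a :* c :+ :- (b :* d)) :+ (a :* e :+ :- (b :* f))) refl

  distribˡ₂ : ∀ a b c d e f →
    a * (d + f) + b * (c + e) ≈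
    (a * d + b * c) + (a * f + b * e)
  distribˡ₂ = solve 6 (λ a b c d e f →
    a :* (d :+ f) :+ b :* (c :+ e) :=
    (a :* d :+ b :* c) :+ (a :* f :+ b :* e)) refl

  distribʳ₁ : ∀ a b c d e f →
    (c + e) * a + - ((d + f) * b) ≈
    (c * a + - (d * b)) + (e * a + - (f * b))
  distribʳ₁ = solve 6 (λ a b c d e f →
    (c :+ e) :* a :+ :- ((d :+ f) :* b) :=
    (c :* a :+ :- (d :* b)) :+ (e :* a :+ :- (f :* b))) refl

  distribʳ₂ : ∀ a b c d e f →
    (c + e) * b + (d + f) * a ≈
    (c * b + d * a) + (e * b + f * a)
  distribʳ₂ = solve 6 (λ a b c d e f →
    (c :+ e) :* b :+ (d :+ f) :* a :=
    (c :* b :+ d :* a) :+ (e :* b :+ f :* a)) refl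

  comm₁ : ∀ a b c d →
    a * c + - (b * d) ≈
    c * a + - (d * b)
  comm₁ = solve 4 (λ a b c d →
    a :* c :+ :- (b :* d) :=
    c :* a :+ :- (d :* b)) refl

  comm₂ : ∀ a b c d →
    a * d + b * c ≈
    c * b + d * a
  comm₂ = solve 4 (λ a b c d →
    a :* d :+ b :* c :=
    c :* b :+ d :* a) refl

-- Opaque only so that type checking does not unfold Cauchy sequences.
opaque
  ℂ-commutativeRing : CommutativeRing 0ℓ 0ℓ
  ℂ-commutativeRing = adjoin-i ℝ-commutativeRing

module ℂ = CommutativeRing ℂ-commutativeRing

ℂ : Set
ℂ = ℂ.Carrier

------------------------------------------------------------------------
-- The prime field 𝔽ₚ = ℤ/pℤ

module PrimeField (p : ℕ) (p-prime : Prime p) where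

  private instance
    p≢0 : NonZero p
    p≢0 = prime⇒nonZero p-prime

  private
    toℕ-mod : ∀ m → toℕ (m mod p) ≡ m % p
    toℕ-mod m = Fin.toℕ-fromℕ< _

    mod-cong : ∀ {m n} → m % p ≡ n % p → m mod p ≡ n mod p
    mod-cong {m} {n} eq =
      Fin.toℕ-injective (≡.trans (toℕ-mod m) (≡.trans eq (≡.sym (toℕ-mod n))))

    mod-toℕ : ∀ x → toℕ x mod p ≡ x
    mod-toℕ x =
      Fin.toℕ-injective (≡.trans (toℕ-mod (toℕ x)) (m<n⇒m%n≡m (Fin.toℕ<n x)))

    add mul : Fin p → Fin p → Fin p
    add x y = (toℕ x ℕ.+ toℕ y) mod p
    mul x y = (toℕ x ℕ.* toℕ y) mod p

    neg : Fin p → Fin p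
    neg x = (p ℕ.∸ toℕ x) mod p

    add-mod : ∀ m n → add (m mod p) (n mod p) ≡ (m ℕ.+ n) mod p
    add-mod m n = mod-cong (≡.trans
      (cong₂ (λ a b → (a ℕ.+ b) % p) (toℕ-mod m) (toℕ-mod n))
      (≡.sym (%-distribˡ-+ m n p)))

    mul-mod : ∀ m n → mul (m mod p) (n mod p) ≡ (m ℕ.* n) mod p
    mul-mod m n = mod-cong (≡.trans
      (cong₂ (λ a b → (a ℕ.* b) % p) (toℕ-mod m) (toℕ-mod n))
      (≡.sym (%-distribˡ-* m n p)))

    add-modˡ : ∀ m x → add (m mod p) x ≡ (m ℕ.+ toℕ x) mod p
    add-modˡ m x = ≡.trans (cong (add (m mod p)) (≡.sym (mod-toℕ x))) (add-mod m (toℕ x))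

    mul-modˡ : ∀ m x → mul (m mod p) x ≡ (m ℕ.* toℕ x) mod p
    mul-modˡ m x = ≡.trans (cong (mul (m mod p)) (≡.sym (mod-toℕ x))) (mul-mod m (toℕ x))

    add-comm : ∀ x y → add x y ≡ add y x
    add-comm x y = cong (_mod p) (ℕ.+-comm (toℕ x) (toℕ y))

    mul-comm : ∀ x y → mul x y ≡ mul y x
    mul-comm x y = cong (_mod p) (ℕ.*-comm (toℕ x) (toℕ y))

    add-assoc : ∀ x y z → add (add x y) z ≡ add x (add y z)
    add-assoc x y z = begin
      add (add x y) z                        ≡⟨ add-modˡ _ z ⟩
      (toℕ x ℕ.+ toℕ y ℕ.+ toℕ z) mod p      ≡⟨ cong (_mod p) (ℕ.+-assoc (toℕ x) _ _) ⟩
      (toℕ x ℕ.+ (toℕ y ℕ.+ toℕ z)) mod p    ≡⟨ cong (_mod p) (ℕ.+-comm (toℕ x) _) ⟩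
      (toℕ y ℕ.+ toℕ z ℕ.+ toℕ x) mod p      ≡⟨ add-modˡ _ x ⟨
      add (add y z) x                        ≡⟨ add-comm _ x ⟩
      add x (add y z)                        ∎
      where open ≡.≡-Reasoning

    mul-assoc : ∀ x y z → mul (mul x y) z ≡ mul x (mul y z)
    mul-assoc x y z = begin
      mul (mul x y) z                        ≡⟨ mul-modˡ _ z ⟩
      (toℕ x ℕ.* toℕ y ℕ.* toℕ z) mod p      ≡⟨ cong (_mod p) (ℕ.*-assoc (toℕ x) _ _) ⟩
      (toℕ x ℕ.* (toℕ y ℕ.* toℕ z)) mod p    ≡⟨ cong (_mod p) (ℕ.*-comm (toℕ x) _) ⟩
      (toℕ y ℕ.* toℕ z ℕ.* toℕ x) mod p      ≡⟨ mul-modˡ _ x ⟨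
      mul (mul y z) x                        ≡⟨ mul-comm _ x ⟩
      mul x (mul y z)                        ∎
      where open ≡.≡-Reasoning

    add-identityˡ : ∀ x → add (0 mod p) x ≡ x
    add-identityˡ x = ≡.trans (add-modˡ 0 x) (mod-toℕ x)

    mul-identityˡ : ∀ x → mul (1 mod p) x ≡ x
    mul-identityˡ x = ≡.trans (mul-modˡ 1 x)
      (≡.trans (cong (_mod p) (ℕ.+-identityʳ (toℕ x))) (mod-toℕ x))

    neg-inverseˡ : ∀ x → add (neg x) x ≡ 0 mod p
    neg-inverseˡ x = ≡.trans (add-modˡ (p ℕ.∸ toℕ x) x) (≡.trans
      (cong (_mod p) (ℕ.m∸n+n≡m (ℕ.<⇒≤ (Fin.toℕ<n x))))
      (mod-cong (≡.trans (n%n≡0 p) (≡.sym (m*n%n≡0 0 p)))))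

    distribʳ : ∀ x y z → mul (add y z) x ≡ add (mul y x) (mul z x)
    distribʳ x y z = ≡.trans (mul-modˡ (toℕ y ℕ.+ toℕ z) x) (≡.trans
      (cong (_mod p) (ℕ.*-distribʳ-+ (toℕ x) (toℕ y) (toℕ z)))
      (≡.sym (add-mod (toℕ y ℕ.* toℕ x) (toℕ z ℕ.* toℕ x))))

    distribˡ : ∀ x y z → mul x (add y z) ≡ add (mul x y) (mul x z)
    distribˡ x y z = ≡.trans (mul-comm x (add y z)) (≡.trans (distribʳ x y z)
      (cong₂ add (mul-comm y x) (mul-comm z x)))

  𝔽ₚ : CommutativeRing 0ℓ 0ℓ
  𝔽ₚ = record
    { Carrier = Fin p
    ; _≈_     = _≡_
    ; _+_     = add
    ; _*_     = mul
    ; -_      = neg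
    ; 0#      = 0 mod p
    ; 1#      = 1 mod p
    ; isCommutativeRing = record
      { isRing = record
        { +-isAbelianGroup = record
          { isGroup = record
            { isMonoid = record
              { isSemigroup = record
                { isMagma = record
                  { isEquivalence = ≡.isEquivalence ; ∙-cong = cong₂ add }
                ; assoc = add-assoc
                }
              ; identity = add-identityˡ
                         , λ x → ≡.trans (add-comm x _) (add-identityˡ x)
              }
            ; inverse = neg-inverseˡ , λ x → ≡.trans (add-comm x _) (neg-inverseˡ x)
            ; ⁻¹-cong = cong neg
            }
          ; comm = add-comm
          }
        ; *-cong = cong₂ mul
        ; *-assoc = mul-assoc
        ; *-identity = mul-identityˡ
                     , λ x → ≡.trans (mul-comm x _) (mul-identityˡ x)
        ; distrib = distribˡ , distribʳ
        }
      ; *-comm = mul-comm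
      }
    }

  open CommutativeRing 𝔽ₚ public using (_+_; _*_; -_; _-_; 0#; 1#)
  open CommutativeRing 𝔽ₚ
    using (*-assoc; *-comm; *-identityˡ; *-identityʳ; zeroˡ; +-group)

  𝔽 : Set
  𝔽 = Fin p

  infixr 8 _^_

  _^_ : 𝔽 → ℕ → 𝔽
  x ^ n = RawMonoid._×_ (CommutativeRing.*-rawMonoid 𝔽ₚ) n x

  inverse : ∀ x → x ≢ 0# → ∃ λ y → x * y ≡ 1#
  inverse x x≢0 with coprime-Bézout (prime⇒coprime p-prime {{toℕ≢0}} (Fin.toℕ<n x))
    where
    toℕ≢0 : NonZero (toℕ x)
    toℕ≢0 = ℕ.≢-nonZero λ eq → x≢0 (≡.trans (≡.sym (mod-toℕ x)) (cong (_mod p) eq))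
  ... | Bézout.-+ u v 1+up≡va = v mod p , (begin
    x * (v mod p)                ≡⟨ *-comm x (v mod p) ⟩
    (v mod p) * x                ≡⟨ mul-modˡ v x ⟩
    (v ℕ.* toℕ x) mod p          ≡⟨ cong (_mod p) 1+up≡va ⟨
    (1 ℕ.+ u ℕ.* p) mod p        ≡⟨ mod-cong ([m+kn]%n≡m%n 1 u p) ⟩
    1#                           ∎)
    where open ≡.≡-Reasoning
  ... | Bézout.+- u v 1+va≡up = - (v mod p) , (begin
    x * - (v mod p)              ≡⟨ -‿distribʳ-* x (v mod p) ⟨
    - (x * (v mod p))            ≡⟨ inverseˡ-unique 1# (x * (v mod p)) 1+xv≡0 ⟨
    1#                           ∎)
    where
    open ≡.≡-Reasoning
    open import Algebra.Properties.Group +-group using (inverseˡ-unique)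
    open import Algebra.Properties.Ring (CommutativeRing.ring 𝔽ₚ) using (-‿distribʳ-*)
    1+xv≡0 : 1# + x * (v mod p) ≡ 0#
    1+xv≡0 = begin
      1# + x * (v mod p)           ≡⟨ cong (λ z → 1# + z) (*-comm x (v mod p)) ⟩
      1# + (v mod p) * x           ≡⟨ cong (λ z → 1# + z) (mul-modˡ v x) ⟩
      1# + (v ℕ.* toℕ x) mod p     ≡⟨ add-mod 1 (v ℕ.* toℕ x) ⟩
      (1 ℕ.+ v ℕ.* toℕ x) mod p    ≡⟨ cong (_mod p) 1+va≡up ⟩
      (u ℕ.* p) mod p              ≡⟨ mod-cong (≡.trans (m*n%n≡0 u p) (≡.sym (m*n%n≡0 0 p))) ⟩
      0#                           ∎

  inv : ∀ x → x ≢ 0# → 𝔽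
  inv x x≢0 = proj₁ (inverse x x≢0)

  *-inverseʳ : ∀ x (x≢0 : x ≢ 0#) → x * inv x x≢0 ≡ 1#
  *-inverseʳ x x≢0 = proj₂ (inverse x x≢0)

  inverse-unique : ∀ {x y} (x≢0 : x ≢ 0#) → x * y ≡ 1# → y ≡ inv x x≢0
  inverse-unique {x} {y} x≢0 xy≡1 = begin
    y                      ≡⟨ *-identityʳ y ⟨
    y * 1#                 ≡⟨ cong (y *_) (*-inverseʳ x x≢0) ⟨
    y * (x * inv x x≢0)    ≡⟨ *-assoc y x _ ⟨
    (y * x) * inv x x≢0    ≡⟨ cong (_* inv x x≢0) (≡.trans (*-comm y x) xy≡1) ⟩
    1# * inv x x≢0         ≡⟨ *-identityˡ _ ⟩
    inv x x≢0              ∎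
    where open ≡.≡-Reasoning

  1≢0 : 1# ≢ 0#
  1≢0 eq = contradiction
    (≡.trans (≡.sym (m<n⇒m%n≡m (ℕ.nonTrivial⇒n>1 p {{prime⇒nonTrivial p-prime}})))
      (≡.trans (≡.sym (toℕ-mod 1))
        (≡.trans (cong toℕ eq) (≡.trans (toℕ-mod 0) (m*n%n≡0 0 p)))))
    λ ()

  x*y≢0 : ∀ {x y} → x ≢ 0# → y ≢ 0# → x * y ≢ 0#
  x*y≢0 {x} {y} x≢0 y≢0 xy≡0 = y≢0 (begin
    y                      ≡⟨ *-identityˡ y ⟨
    1# * y                 ≡⟨ cong (_* y) (≡.trans (*-comm (inv x x≢0) x) (*-inverseʳ x x≢0)) ⟨
    (inv x x≢0 * x) * y    ≡⟨ *-assoc (inv x x≢0) x y ⟩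
    inv x x≢0 * (x * y)    ≡⟨ cong (inv x x≢0 *_) xy≡0 ⟩
    inv x x≢0 * 0#         ≡⟨ CommutativeRing.zeroʳ 𝔽ₚ (inv x x≢0) ⟩
    0#                     ∎)
    where open ≡.≡-Reasoning

  x*0≡0 : ∀ x {y} → y ≡ 0# → x * y ≡ 0#
  x*0≡0 x ≡.refl = CommutativeRing.zeroʳ 𝔽ₚ x

  0*y≡0 : ∀ {x} y → x ≡ 0# → x * y ≡ 0#
  0*y≡0 y ≡.refl = zeroˡ y

------------------------------------------------------------------------
-- Multiplicative characters of 𝔽ₚ with values in a commutative ring K

module Characters (K : CommutativeRing 0ℓ 0ℓ) (p : ℕ) (p-prime : Prime p) where

  private module K = CommutativeRing K

  open PrimeField p p-prime
  open CommutativeRing 𝔽ₚ using (*-identityˡ)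

  -- A homomorphism 𝔽ₚ^× → K^×, extended to 𝔽ₚ by 0 ↦ 0. Values at
  -- nonzero x are units because fun x * fun (x⁻¹) ≈ fun 1# ≈ 1.
  record Character : Set where
    field
      fun   : 𝔽 → K.Carrier
      fun-0 : fun 0# K.≈ K.0#
      fun-1 : fun 1# K.≈ K.1#
      fun-* : ∀ x y → fun (x * y) K.≈ fun x K.* fun y

  open Character public

  infix  4 _≈_
  infixl 7 _·_

  _≈_ : Character → Character → Set
  χ ≈ ψ = ∀ x → fun χ x K.≈ fun ψ x

  private
    fun-≡ : ∀ χ {x y} → x ≡ y → fun χ x K.≈ fun χ y
    fun-≡ χ {x} ≡.refl = K.refl {fun χ x}

  _·_ : Character → Character → Character
  χ · ψ = record
    { fun   = λ x → fun χ x K.* fun ψ x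
    ; fun-0 = K.trans (K.*-congʳ (fun-0 χ)) (K.zeroˡ (fun ψ 0#))
    ; fun-1 = K.trans (K.*-cong (fun-1 χ) (fun-1 ψ)) (K.*-identityˡ K.1#)
    ; fun-* = λ x y → K.trans (K.*-cong (fun-* χ x y) (fun-* ψ x y))
                              (interchange (fun χ x) (fun χ y) (fun ψ x) (fun ψ y))
    }
    where
    open import Algebra.Properties.CommutativeSemigroup K.*-commutativeSemigroup
      using (interchange)

  ε : Character
  ε = record
    { fun   = λ x → value (x Fin.≟ 0#)
    ; fun-0 = value-0 (0# Fin.≟ 0#) ≡.refl
    ; fun-1 = value-1 (1# Fin.≟ 0#) 1≢0
    ; fun-* = λ x y → value-* x y (x Fin.≟ 0#) (y Fin.≟ 0#) (x * y Fin.≟ 0#)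
    }
    where
    value : ∀ {x : 𝔽} → Dec (x ≡ 0#) → K.Carrier
    value (yes _) = K.0#
    value (no  _) = K.1#

    value-0 : ∀ {x} (d : Dec (x ≡ 0#)) → x ≡ 0# → value d K.≈ K.0#
    value-0 (yes _)   _   = K.refl {K.0#}
    value-0 (no  x≢0) x≡0 = contradiction x≡0 x≢0

    value-1 : ∀ {x} (d : Dec (x ≡ 0#)) → x ≢ 0# → value d K.≈ K.1#
    value-1 (yes x≡0) x≢0 = contradiction x≡0 x≢0
    value-1 (no  _)   _   = K.refl {K.1#}

    value-* : ∀ x y (d : Dec (x ≡ 0#)) (e : Dec (y ≡ 0#)) (f : Dec (x * y ≡ 0#)) →
              value f K.≈ value d K.* value e
    value-* x y (yes x≡0) e f =
      K.trans (value-0 f (0*y≡0 y x≡0)) (K.sym (K.zeroˡ (value e)))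
    value-* x y (no _) (yes y≡0) f =
      K.trans (value-0 f (x*0≡0 x y≡0)) (K.sym (K.zeroʳ K.1#))
    value-* x y (no x≢0) (no y≢0) f =
      K.trans (value-1 f (x*y≢0 x≢0 y≢0)) (K.sym (K.*-identityˡ K.1#))

  infix 8 _⁻¹

  -- The inverse character: x ↦ χ (x⁻¹) for x ≢ 0#, and 0# ↦ 0.
  _⁻¹ : Character → Character
  χ ⁻¹ = record
    { fun   = λ x → value x (x Fin.≟ 0#)
    ; fun-0 = value-0 0# (0# Fin.≟ 0#) ≡.refl
    ; fun-1 = K.trans (value-1 1# (1# Fin.≟ 0#) 1≢0)
                (K.trans (fun-≡ χ (≡.sym (inverse-unique 1≢0 (*-identityˡ 1#)))) (fun-1 χ))
    ; fun-* = λ x y → value-* x y (x Fin.≟ 0#) (y Fin.≟ 0#) (x * y Fin.≟ 0#)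
    }
    where
    value : ∀ x → Dec (x ≡ 0#) → K.Carrier
    value x (yes _)   = K.0#
    value x (no  x≢0) = fun χ (inv x x≢0)

    value-0 : ∀ x (d : Dec (x ≡ 0#)) → x ≡ 0# → value x d K.≈ K.0#
    value-0 x (yes _)   _   = K.refl {K.0#}
    value-0 x (no  x≢0) x≡0 = contradiction x≡0 x≢0

    value-1 : ∀ x (d : Dec (x ≡ 0#)) (x≢0 : x ≢ 0#) → value x d K.≈ fun χ (inv x x≢0)
    value-1 x (yes x≡0) x≢0 = contradiction x≡0 x≢0
    value-1 x (no  ≢0)  x≢0 = fun-≡ χ (inverse-unique x≢0 (*-inverseʳ x ≢0))

    inv-* : ∀ x y (x≢0 : x ≢ 0#) (y≢0 : y ≢ 0#) (xy≢0 : x * y ≢ 0#) →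
            inv x x≢0 * inv y y≢0 ≡ inv (x * y) xy≢0
    inv-* x y x≢0 y≢0 xy≢0 = inverse-unique xy≢0 (begin
      (x * y) * (inv x x≢0 * inv y y≢0)    ≡⟨ interchange x y _ _ ⟩
      (x * inv x x≢0) * (y * inv y y≢0)    ≡⟨ cong₂ _*_ (*-inverseʳ x x≢0) (*-inverseʳ y y≢0) ⟩
      1# * 1#                              ≡⟨ *-identityˡ 1# ⟩
      1#                                   ∎)
      where
      open ≡.≡-Reasoning
      open import Algebra.Properties.CommutativeSemigroup
        (CommutativeRing.*-commutativeSemigroup 𝔽ₚ) using (interchange)

    value-* : ∀ x y (d : Dec (x ≡ 0#)) (e : Dec (y ≡ 0#)) (f : Dec (x * y ≡ 0#)) →
              value (x * y) f K.≈ value x d K.* value y e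
    value-* x y (yes x≡0) e f =
      K.trans (value-0 (x * y) f (0*y≡0 y x≡0)) (K.sym (K.zeroˡ (value y e)))
    value-* x y (no x≢0) (yes y≡0) f =
      K.trans (value-0 (x * y) f (x*0≡0 x y≡0)) (K.sym (K.zeroʳ (value x (no x≢0))))
    value-* x y (no x≢0) (no y≢0) f =
      let xy≢0 = x*y≢0 x≢0 y≢0 in
      K.trans (value-1 (x * y) f xy≢0)
        (K.trans (fun-≡ χ (≡.sym (inv-* x y x≢0 y≢0 xy≢0)))
          (fun-* χ (inv x x≢0) (inv y y≢0)))

  infixr 8 _^χ_

  _^χ_ : Character → ℕ → Character
  χ ^χ n = RawMonoid._×_ (record { _≈_ = _≈_ ; _∙_ = _·_ ; ε = ε }) n χ

  HasOrder : Character → ℕ → Set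
  HasOrder χ n = χ ^χ n ≈ ε × (∀ m → 0 ℕ.< m → m ℕ.< n → ¬ (χ ^χ m ≈ ε))

  ----------------------------------------------------------------------
  -- Jacobi sums and hypergeometric functions

  Σ𝔽 : (𝔽 → K.Carrier) → K.Carrier
  Σ𝔽 = RawMonoid.sum K.+-rawMonoid

  J : Character → Character → K.Carrier
  J A B = Σ𝔽 λ x → fun A x K.* fun B (1# - x)

  ₂ℙ₁ : Character → Character → Character → 𝔽 → K.Carrier
  ₂ℙ₁ A B C t = Σ𝔽 λ y →
    fun B y K.* fun (C · B ⁻¹) (1# - y) K.* fun (A ⁻¹) (1# - t * y)

  IsUnit : K.Carrier → Set
  IsUnit = Invertible K._≈_ K.1# K._*_

  -- The factor 1 / J(B, C B⁻¹) needs evidence that the Jacobi sum is a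
  -- unit; the inverse is unique up to K._≈_.
  ₂𝔽₁ : (A B C : Character) → IsUnit (J B (C · B ⁻¹)) → 𝔽 → K.Carrier
  ₂𝔽₁ A B C (J⁻¹ , _) t = J⁻¹ K.* ₂ℙ₁ A B C t

module ComplexCharacters = Characters ℂ-commutativeRing

-- Substituting y = 1/v, the sum P(t) = ₂ℙ₁(t) becomes Σ η(v) η(v − 1) η̄(v − t), which
-- is visibly invariant under t ↦ 1 − t, and the Jacobi sum is −1. Grouping the v by
-- g = v (v − 1) / (v − t) and using that g ≠ 0 has 1 + η(g) + η̄(g) cube roots, P(t) is
-- expressed by the numbers of v over g and over g = w³. Through X = w + w⁻¹ and the
-- Dickson polynomial D(X) = X³ − 3X, which permutes the X that are not of this form,
-- these numbers are compared with the number of points of the plane cubic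
-- a + b + c = 3, a b c = t: it differs from P(t) by a constant. For t = 1 − μ³ this cubic
-- is the Hesse cubic μ (x³ + y³ + z³) = 3 x y z, and the Fourier transform of order 3
-- turns the parameter μ into (1 − μ) / (1 + 2μ).

module Submission where

open import Defs
open import Algebra.Bundles using (CommutativeRing; CommutativeSemiring)
import Algebra.Properties.Group as Group
import Algebra.Properties.Semiring.Mult as Mult
import Algebra.Properties.Semiring.Sum
open import Algebra.Structures using (IsCommutativeRing)
open import Data.Bool.Base using (if_then_else_)
open import Data.Fin.Base using (Fin; zero; suc)
open import Data.Fin.Permutation using (permutation)
open import Data.Fin.Properties using (_≟_; any?; sequence)
import Data.Integer.Base as ℤ
open import Data.Nat using (ℕ; _%_)
open import Data.Nat.Base as ℕ using (zero; suc; z≤n; _∸_)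
open import Data.Nat.Primality using (Prime)
import Data.Nat.Properties as ℕ
open import Data.Product using (∃; _×_; _,_; proj₁; proj₂; Σ-syntax)
open import Data.Rational.Base as ℚ using (ℚ; 0ℚ; 1ℚ; ∣_∣)
import Data.Rational.Properties as ℚ
open import Data.Sum.Base using (_⊎_; inj₁; inj₂; [_,_]′)
open import Effect.Monad using (RawMonad)
open import Function.Base using (_∘_)
open import Level using (0ℓ)
open import Relation.Binary.PropositionalEquality using (_≡_; _≢_; refl; sym; trans; cong; cong₂; subst; module ≡-Reasoning)
open import Relation.Nullary using (¬_; Dec; yes; no; does; contradiction; ¬?; _×-dec_; decidable-stable; from-no)
open import Relation.Nullary.Decidable using (¬¬-excluded-middle)
open import Relation.Nullary.Negation using (¬¬-Monad)

-- Finite sums and indicators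

-- For `X` other than 1 the fibre of the plane cubic over `X` has as many points as a conic attached
-- to `D X`, and the conics attached to all s together have a number of points independent of t. Off
-- the elements w + w⁻¹ the permutation D matches the two totals. At X = w + w⁻¹ the fibre of the
-- cubic is the set of v over w³, while the conic at s = g + g⁻¹ is the set of v over g. What
-- remains is the sum over g of the number of v over g times η(g) + η̄(g), and this is 2 P(t)
-- because g ↦ g⁻¹ preserves those numbers. Since w and w⁻¹ give the same X, all counts are doubled,
-- and 2 has to be cancelled in ℂ. The other obstacle is constructive: equality of Cauchy sequences
-- is undecidable, so η(x) = 1 cannot be tested. There are only p such tests, however; assuming them
-- all decided is not contradictory, and the final equation is stable under double negation. That
-- the kernel of η consists of cubes is obtained by counting rather than from a primitive root.

module Sums (S : CommutativeSemiring 0ℓ 0ℓ) where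
  open CommutativeSemiring S renaming (refl to ≈-refl; sym to ≈-sym; trans to ≈-trans; zero to *-zero)
  private module Stdlib = Algebra.Properties.Semiring.Sum semiring
  open import Relation.Binary.Reasoning.Setoid setoid

  opaque
    -- Opaque so that the summand of a sum can be inferred by unification.
    sum : ∀ {n} → (Fin n → Carrier) → Carrier
    sum = Stdlib.sum

    sum-def : ∀ {n} (f : Fin n → Carrier) → sum f ≡ Stdlib.sum f
    sum-def f = refl

    sum-nil : ∀ (f : Fin 0 → Carrier) → sum f ≡ 0#
    sum-nil f = refl

    sum-cons : ∀ {n} (f : Fin (suc n) → Carrier) → sum f ≡ f zero + sum (f ∘ suc)
    sum-cons f = refl

    sum-cong : ∀ {n} {f g : Fin n → Carrier} → (∀ x → f x ≈ g x) → sum f ≈ sum g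
    sum-cong = Stdlib.sum-cong-≋

    sum-+ : ∀ {n} (f g : Fin n → Carrier) → sum (λ x → f x + g x) ≈ sum f + sum g
    sum-+ = Stdlib.∑-distrib-+

    sum-comm : ∀ {m n} (f : Fin m → Fin n → Carrier) →
               sum (λ x → sum (f x)) ≈ sum (λ y → sum (λ x → f x y))
    sum-comm = Stdlib.∑-comm

    *-distribˡ-sum : ∀ {n} a (f : Fin n → Carrier) → a * sum f ≈ sum (λ x → a * f x)
    *-distribˡ-sum = Stdlib.*-distribˡ-sum

    *-distribʳ-sum : ∀ {n} a (f : Fin n → Carrier) → sum f * a ≈ sum (λ x → f x * a)
    *-distribʳ-sum = Stdlib.*-distribʳ-sum

    sum-zero : ∀ {n} (f : Fin n → Carrier) → (∀ x → f x ≈ 0#) → sum f ≈ 0#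
    sum-zero {n} f f≈0 = ≈-trans (sum-cong f≈0) (Stdlib.sum-replicate-zero n)

    sum-reindex : ∀ {n} (f : Fin n → Carrier) (φ ψ : Fin n → Fin n) →
                  (∀ x → φ (ψ x) ≡ x) → (∀ x → ψ (φ x) ≡ x) → sum f ≈ sum (f ∘ φ)
    sum-reindex f φ ψ φψ ψφ = Stdlib.sum-permute f (permutation φ ψ φψ ψφ)

  ⟦_⟧ : ∀ {P : Set} → Dec P → Carrier
  ⟦ d ⟧ = if does d then 1# else 0#

  ⟦⟧-yes : ∀ {P : Set} (d : Dec P) → P → ⟦ d ⟧ ≡ 1#
  ⟦⟧-yes (yes _) _ = refl
  ⟦⟧-yes (no ¬p) p = contradiction p ¬p

  ⟦⟧-no : ∀ {P : Set} (d : Dec P) → ¬ P → ⟦ d ⟧ ≡ 0#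
  ⟦⟧-no (yes p) ¬p = contradiction p ¬p
  ⟦⟧-no (no _)  _  = refl

  ⟦⟧-cong : ∀ {P Q : Set} (d : Dec P) (e : Dec Q) → (P → Q) → (Q → P) → ⟦ d ⟧ ≡ ⟦ e ⟧
  ⟦⟧-cong (yes p) e p⇒q q⇒p = sym (⟦⟧-yes e (p⇒q p))
  ⟦⟧-cong (no ¬p) e p⇒q q⇒p = sym (⟦⟧-no e (¬p ∘ q⇒p))

  ⟦⟧-congˡ : ∀ {P : Set} (d : Dec P) {x y} → (P → x ≈ y) → ⟦ d ⟧ * x ≈ ⟦ d ⟧ * y
  ⟦⟧-congˡ (yes p) {x} {y} h = *-congˡ {1#} {x} {y} (h p)
  ⟦⟧-congˡ (no ¬p) {x} {y} h = ≈-trans (zeroˡ x) (≈-sym (zeroˡ y))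

  sum-δ : ∀ {n} (a : Fin n) (f : Fin n → Carrier) → sum (λ x → ⟦ x ≟ a ⟧ * f x) ≈ f a
  sum-δ zero f = begin
    sum (λ x → ⟦ x ≟ zero ⟧ * f x)                          ≡⟨ sum-cons _ ⟩
    1# * f zero + sum (λ x → ⟦ suc x ≟ zero ⟧ * f (suc x))  ≈⟨ +-cong (*-identityˡ _) (sum-zero _ (λ x → zeroˡ _)) ⟩
    f zero + 0#                                            ≈⟨ +-identityʳ _ ⟩
    f zero                                                 ∎
  sum-δ (suc a) f = begin
    sum (λ x → ⟦ x ≟ suc a ⟧ * f x)                         ≡⟨ sum-cons _ ⟩
    0# * f zero + sum (λ x → ⟦ suc x ≟ suc a ⟧ * f (suc x)) ≈⟨ +-cong (zeroˡ _) (sum-cong λ x → *-congʳ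
                                                                 (reflexive (⟦⟧-cong (suc x ≟ suc a) (x ≟ a) (λ { refl →
                                                                     refl }) (cong suc)))) ⟩
    0# + sum (λ x → ⟦ x ≟ a ⟧ * f (suc x))                  ≈⟨ +-identityˡ _ ⟩
    sum (λ x → ⟦ x ≟ a ⟧ * f (suc x))                       ≈⟨ sum-δ a (f ∘ suc) ⟩
    f (suc a)                                              ∎

  sum-unique : ∀ {n} {P : Fin n → Set} (P? : ∀ x → Dec (P x)) (f : Fin n → Carrier) a →
               P a → (∀ x → P x → x ≡ a) → sum (λ x → ⟦ P? x ⟧ * f x) ≈ f a
  sum-unique P? f a Pa unique = ≈-trans
    (sum-cong λ x → *-congʳ (reflexive (⟦⟧-cong (P? x) (x ≟ a) (unique x) λ { refl → Pa })))
    (sum-δ a f)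

  sum-none : ∀ {n} {P : Fin n → Set} (P? : ∀ x → Dec (P x)) (f : Fin n → Carrier) →
             (∀ x → ¬ P x) → sum (λ x → ⟦ P? x ⟧ * f x) ≈ 0#
  sum-none P? f none = sum-zero _ λ x → ≈-trans (*-congʳ (reflexive (⟦⟧-no (P? x) (none x)))) (zeroˡ (f x))

  -- Double counting of the pairs satisfying `P`, each weighted by `f x`. Every regrouping of points
  -- by a parameter goes through this exchange.
  sum-sift : ∀ {n} {P : Fin n → Fin n → Set} (P? : ∀ x y → Dec (P x y)) (f : Fin n → Carrier) →
             sum (λ x → sum (λ y → ⟦ P? x y ⟧) * f x) ≈ sum (λ y → sum (λ x → ⟦ P? x y ⟧ * f x))
  sum-sift P? f = ≈-trans (sum-cong λ x → *-distribʳ-sum (f x) (λ y → ⟦ P? x y ⟧))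
    (sum-comm λ x y → ⟦ P? x y ⟧ * f x)

module ℕΣ where
  open Sums ℕ.+-*-commutativeSemiring public

  sum-mono : ∀ {n} {f g : Fin n → ℕ} → (∀ x → f x ℕ.≤ g x) → sum f ℕ.≤ sum g
  sum-mono {zero}  {f} {g} f≤g rewrite sum-nil f | sum-nil g = z≤n
  sum-mono {suc n} {f} {g} f≤g rewrite sum-cons f | sum-cons g =
    ℕ.+-mono-≤ (f≤g zero) (sum-mono (f≤g ∘ suc))

  -- This turns upper bounds into exact counts: a single strict term would make the total of `f`
  -- strictly smaller than that of `g`.
  sum-squeeze : ∀ {n} {f g : Fin n → ℕ} → (∀ x → f x ℕ.≤ g x) → sum g ℕ.≤ sum f → ∀ x → f x ≡ g x
  sum-squeeze {suc n} {f} {g} f≤g Σg≤Σf rewrite sum-cons f | sum-cons g = λ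
    { zero    → ℕ.≤-antisym (f≤g zero)
        (ℕ.+-cancelʳ-≤ (sum (f ∘ suc)) _ _ (ℕ.≤-trans (ℕ.+-monoʳ-≤ (g zero) tail-mono) Σg≤Σf))
    ; (suc x) → sum-squeeze (f≤g ∘ suc)
        (ℕ.+-cancelˡ-≤ (f zero) _ _ (ℕ.≤-trans (ℕ.+-monoˡ-≤ (sum (g ∘ suc)) (f≤g zero)) Σg≤Σf)) x }
    where
    tail-mono : sum (f ∘ suc) ℕ.≤ sum (g ∘ suc)
    tail-mono = sum-mono (f≤g ∘ suc)

  -- An injection hits every point exactly once, because the fibre sizes are at
  -- most 1 and add up to n.
  sum-injective : ∀ {n} (φ : Fin n → Fin n) → (∀ {x y} → φ x ≡ φ y → x ≡ y) →
                  (f : Fin n → ℕ) → sum f ≡ sum (f ∘ φ)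
  sum-injective {n} φ φ-inj f = begin
    sum f                                                 ≡⟨ sum-cong (λ s → trans (cong (ℕ._* f s) (fibre s)) (ℕ.*-identityˡ (f s))) ⟨
    sum (λ s → sum (λ x → ⟦ s ≟ φ x ⟧) ℕ.* f s)           ≡⟨ sum-sift (λ s x → s ≟ φ x) f ⟩
    sum (λ x → sum (λ s → ⟦ s ≟ φ x ⟧ ℕ.* f s))           ≡⟨ sum-cong (λ x → sum-δ (φ x) f) ⟩
    sum (f ∘ φ)                                           ∎
    where
    open ≡-Reasoning
    one : Fin n → ℕ
    one _ = 1

    fibre≤1 : ∀ s → sum (λ x → ⟦ s ≟ φ x ⟧) ℕ.≤ 1
    fibre≤1 s with any? (λ x → s ≟ φ x)
    ... | yes (x , s≡φx) = ℕ.≤-reflexive (trans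
            (sum-cong λ y → sym (ℕ.*-identityʳ ⟦ s ≟ φ y ⟧))
            (sum-unique (λ y → s ≟ φ y) one x s≡φx λ y s≡φy → φ-inj (trans (sym s≡φy) s≡φx)))
    ... | no none = ℕ.≤-trans (ℕ.≤-reflexive (sum-zero _ λ x → ⟦⟧-no (s ≟ φ x) (λ eq → none (x , eq)))) z≤n

    total : sum one ≡ sum (λ s → sum (λ x → ⟦ s ≟ φ x ⟧))
    total = sym (begin
      sum (λ s → sum (λ x → ⟦ s ≟ φ x ⟧))                 ≡⟨ sum-cong (λ s → sym (ℕ.*-identityʳ _)) ⟩
      sum (λ s → sum (λ x → ⟦ s ≟ φ x ⟧) ℕ.* 1)           ≡⟨ sum-sift (λ s x → s ≟ φ x) one ⟩
      sum (λ x → sum (λ s → ⟦ s ≟ φ x ⟧ ℕ.* 1))           ≡⟨ sum-cong (λ x → sum-δ (φ x) one) ⟩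
      sum one                                             ∎)

    fibre : ∀ s → sum (λ x → ⟦ s ≟ φ x ⟧) ≡ 1
    fibre = sum-squeeze fibre≤1 (ℕ.≤-reflexive total)

  sum-⟦≟⟧ : ∀ {n} (a : Fin n) → sum (λ x → ⟦ x ≟ a ⟧) ≡ 1
  sum-⟦≟⟧ a = trans (sum-cong λ x → sym (ℕ.*-identityʳ ⟦ x ≟ a ⟧)) (sum-δ a (λ _ → 1))

  atMostOne : ∀ {P Q R : Set} (p? : Dec P) (q? : Dec Q) (r? : Dec R) →
              ¬ (P × Q) → ¬ (Q × R) → ¬ (P × R) → ⟦ p? ⟧ ℕ.+ ⟦ q? ⟧ ℕ.+ ⟦ r? ⟧ ℕ.≤ 1
  atMostOne (yes p) (yes q) _       ¬pq ¬qr ¬pr = contradiction (p , q) ¬pq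
  atMostOne (yes p) (no _)  (yes r) ¬pq ¬qr ¬pr = contradiction (p , r) ¬pr
  atMostOne (yes _) (no _)  (no _)  ¬pq ¬qr ¬pr = ℕ.≤-refl
  atMostOne (no _)  (yes q) (yes r) ¬pq ¬qr ¬pr = contradiction (q , r) ¬qr
  atMostOne (no _)  (yes _) (no _)  ¬pq ¬qr ¬pr = ℕ.≤-refl
  atMostOne (no _)  (no _)  (yes _) ¬pq ¬qr ¬pr = ℕ.≤-refl
  atMostOne (no _)  (no _)  (no _)  ¬pq ¬qr ¬pr = z≤n

  -- The points `a`, `b`, `c` may coincide; their indicators add up to 3 in any case.
  count≤3 : ∀ {n} {P : Fin n → Set} (P? : ∀ x → Dec (P x)) a b c →
            (∀ x → P x → x ≡ a ⊎ x ≡ b ⊎ x ≡ c) → sum (λ x → ⟦ P? x ⟧) ℕ.≤ 3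
  count≤3 P? a b c P⊆ = ℕ.≤-trans (sum-mono below) (ℕ.≤-reflexive total)
    where
    below : ∀ x → ⟦ P? x ⟧ ℕ.≤ ⟦ x ≟ a ⟧ ℕ.+ (⟦ x ≟ b ⟧ ℕ.+ ⟦ x ≟ c ⟧)
    below x with P? x
    ... | no _ = z≤n
    ... | yes Px with P⊆ x Px
    ...   | inj₁ x≡a        = ℕ.m≤n⇒m≤n+o _ (ℕ.≤-reflexive (sym (⟦⟧-yes (x ≟ a) x≡a)))
    ...   | inj₂ (inj₁ x≡b) = ℕ.m≤n⇒m≤o+n ⟦ x ≟ a ⟧ (ℕ.m≤n⇒m≤n+o _ (ℕ.≤-reflexive (sym (⟦⟧-yes (x ≟ b) x≡b))))
    ...   | inj₂ (inj₂ x≡c) = ℕ.m≤n⇒m≤o+n ⟦ x ≟ a ⟧ (ℕ.m≤n⇒m≤o+n ⟦ x ≟ b ⟧ (ℕ.≤-reflexive (sym (⟦⟧-yes (x ≟ c) x≡c))))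

    total : sum (λ x → ⟦ x ≟ a ⟧ ℕ.+ (⟦ x ≟ b ⟧ ℕ.+ ⟦ x ≟ c ⟧)) ≡ 3
    total = trans (sum-+ (λ x → ⟦ x ≟ a ⟧) _) (cong₂ ℕ._+_ (sum-⟦≟⟧ a)
      (trans (sum-+ (λ x → ⟦ x ≟ b ⟧) (λ x → ⟦ x ≟ c ⟧)) (cong₂ ℕ._+_ (sum-⟦≟⟧ b) (sum-⟦≟⟧ c))))

-- Finite fields

record FiniteField (n : ℕ) : Set where
  infixl 6 _+_
  infixl 7 _*_
  infix  8 -_
  field
    _+_ _*_           : Fin n → Fin n → Fin n
    -_                : Fin n → Fin n
    0# 1#             : Fin n
    isCommutativeRing : IsCommutativeRing _≡_ _+_ _*_ -_ 0# 1#
    inverse           : ∀ x → x ≢ 0# → ∃ λ y → x * y ≡ 1#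
    1≢0               : 1# ≢ 0#

  commutativeRing : CommutativeRing 0ℓ 0ℓ
  commutativeRing = record { isCommutativeRing = isCommutativeRing }

module FieldProperties {n} (F : FiniteField n) where
  open FiniteField F public
  open CommutativeRing commutativeRing public
    using (_-_; *-comm; *-assoc; *-identityˡ; *-identityʳ; zeroˡ; zeroʳ; -‿inverseʳ; +-identityˡ; +-identityʳ)
  open IntegerSolver commutativeRing public
    using (solve; con; _:=_; _:+_; _:*_; :-_; Polynomial)
  open ≡-Reasoning

  𝔽 : Set
  𝔽 = Fin n

  nought one : ∀ {k} → Polynomial k
  nought = con (ℤ.+ 0)
  one    = con (ℤ.+ 1)

  inv : ∀ x → x ≢ 0# → 𝔽
  inv x x≢0 = proj₁ (inverse x x≢0)

  inv-inverse : ∀ x (x≢0 : x ≢ 0#) → x * inv x x≢0 ≡ 1#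
  inv-inverse x x≢0 = proj₂ (inverse x x≢0)

  *-cancelˡ : ∀ {a x y} → a ≢ 0# → a * x ≡ a * y → x ≡ y
  *-cancelˡ {a} {x} {y} a≢0 ax≡ay = begin
    x             ≡⟨ undo x ⟨
    i * (a * x)   ≡⟨ cong (i *_) ax≡ay ⟩
    i * (a * y)   ≡⟨ undo y ⟩
    y             ∎
    where
    i = inv a a≢0
    undo : ∀ z → i * (a * z) ≡ z
    undo z = begin
      i * (a * z)   ≡⟨ solve 3 (λ i a z → i :* (a :* z) := (a :* i) :* z) refl i a z ⟩
      a * i * z     ≡⟨ cong (_* z) (inv-inverse a a≢0) ⟩
      1# * z        ≡⟨ *-identityˡ z ⟩
      z             ∎

  *-≢0 : ∀ {x y} → x ≢ 0# → y ≢ 0# → x * y ≢ 0#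
  *-≢0 {x} x≢0 y≢0 xy≡0 = y≢0 (*-cancelˡ x≢0 (trans xy≡0 (sym (zeroʳ x))))

  x*y≡0 : ∀ {x y} → x * y ≡ 0# → x ≡ 0# ⊎ y ≡ 0#
  x*y≡0 {x} {y} xy≡0 with x ≟ 0#
  ... | yes x≡0 = inj₁ x≡0
  ... | no  x≢0 = inj₂ (*-cancelˡ x≢0 (trans xy≡0 (sym (zeroʳ x))))

  x-y≡0 : ∀ {x y} → x - y ≡ 0# → x ≡ y
  x-y≡0 {x} {y} eq = begin
    x             ≡⟨ solve 2 (λ x y → x := (x :+ :- y) :+ y) refl x y ⟩
    x - y + y     ≡⟨ cong (_+ y) eq ⟩
    0# + y        ≡⟨ +-identityˡ y ⟩
    y             ∎

  x≡y⇒x-y≡0 : ∀ {x y} → x ≡ y → x - y ≡ 0#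
  x≡y⇒x-y≡0 {x} refl = -‿inverseʳ x

  unit-≢0 : ∀ {x y} → x * y ≡ 1# → x ≢ 0#
  unit-≢0 {y = y} xy≡1 refl = 1≢0 (trans (sym xy≡1) (zeroˡ y))

  -1# : 𝔽
  -1# = - 1#

  -1≢0 : -1# ≢ 0#
  -1≢0 eq = 1≢0 (begin
    1#             ≡⟨ solve 0 (one := :- one :* :- one) refl ⟩
    -1# * -1#      ≡⟨ cong (_* -1#) eq ⟩
    0# * -1#       ≡⟨ zeroˡ -1# ⟩
    0#             ∎)

  -- The total inverse, with 0 ⁻¹ = 0.
  infix 9 _⁻¹
  _⁻¹ : 𝔽 → 𝔽
  x ⁻¹ with x ≟ 0#
  ... | yes _   = 0#
  ... | no  x≢0 = inv x x≢0

  0⁻¹ : 0# ⁻¹ ≡ 0#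
  0⁻¹ with 0# ≟ 0#
  ... | yes _   = refl
  ... | no  0≢0 = contradiction refl 0≢0

  ⁻¹-inverse : ∀ {x} → x ≢ 0# → x * x ⁻¹ ≡ 1#
  ⁻¹-inverse {x} x≢0 with x ≟ 0#
  ... | yes x≡0 = contradiction x≡0 x≢0
  ... | no  x≢0 = inv-inverse x x≢0

  ⁻¹-≢0 : ∀ {x} → x ≢ 0# → x ⁻¹ ≢ 0#
  ⁻¹-≢0 {x} x≢0 = unit-≢0 (trans (*-comm (x ⁻¹) x) (⁻¹-inverse x≢0))

  ⁻¹-involutive : ∀ x → x ⁻¹ ⁻¹ ≡ x
  ⁻¹-involutive x = by-cases (x ≟ 0#)
    where
    by-cases : Dec (x ≡ 0#) → x ⁻¹ ⁻¹ ≡ x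
    by-cases (yes refl) = trans (cong _⁻¹ 0⁻¹) 0⁻¹
    by-cases (no  x≢0)  = *-cancelˡ (⁻¹-≢0 x≢0) (begin
      x ⁻¹ * x ⁻¹ ⁻¹  ≡⟨ ⁻¹-inverse (⁻¹-≢0 x≢0) ⟩
      1#              ≡⟨ ⁻¹-inverse x≢0 ⟨
      x * x ⁻¹        ≡⟨ *-comm x (x ⁻¹) ⟩
      x ⁻¹ * x        ∎)

  module Reindexing (S : CommutativeSemiring 0ℓ 0ℓ) where
    open CommutativeSemiring S using (Carrier; _≈_)
    open Sums S

    sum-affine : ∀ k d → k ≢ 0# → (f : 𝔽 → Carrier) → sum f ≈ sum (λ x → f (k * x + d))
    sum-affine k d k≢0 f = sum-reindex f (λ x → k * x + d) (λ y → i * (y - d))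
      (λ y → begin
        k * (i * (y - d)) + d   ≡⟨ solve 4 (λ k i y d → k :* (i :* (y :+ :- d)) :+ d := (k :* i) :* (y :+ :- d) :+ d) refl k i y d ⟩
        k * i * (y - d) + d     ≡⟨ cong (λ u → u * (y - d) + d) ki≡1 ⟩
        1# * (y - d) + d        ≡⟨ solve 2 (λ y d → one :* (y :+ :- d) :+ d := y) refl y d ⟩
        y                       ∎)
      (λ x → begin
        i * (k * x + d - d)     ≡⟨ solve 4 (λ i k x d → i :* (k :* x :+ d :+ :- d) := (k :* i) :* x) refl i k x d ⟩
        k * i * x               ≡⟨ cong (_* x) ki≡1 ⟩
        1# * x                  ≡⟨ *-identityˡ x ⟩
        x                       ∎)
      where
      i = inv k k≢0
      ki≡1 = inv-inverse k k≢0

    -- With 0 ⁻¹ = 0 inversion is an involution of the whole field, so no index has to be left out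
    -- of the sum.
    sum-⁻¹ : (f : 𝔽 → Carrier) → sum f ≈ sum (λ x → f (x ⁻¹))
    sum-⁻¹ f = sum-reindex f _⁻¹ _⁻¹ ⁻¹-involutive ⁻¹-involutive

    sum-scale : ∀ {k} → k ≢ 0# → (f : 𝔽 → Carrier) → sum f ≈ sum (λ x → f (k * x))
    sum-scale {k} k≢0 f = CommutativeSemiring.trans S (sum-affine k 0# k≢0 f)
      (sum-cong λ x → CommutativeSemiring.reflexive S (cong f (+-identityʳ (k * x))))

-- Dickson polynomials

module Dickson {n} (F : FiniteField n) where
  open FieldProperties F
  open ℕΣ
  open Reindexing ℕ.+-*-commutativeSemiring
  open ≡-Reasoning

  2# 3# : 𝔽
  2# = 1# + 1#
  3# = 1# + 1# + 1#

  two three : ∀ {k} → Polynomial k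
  two   = one :+ one
  three = one :+ one :+ one

  module _ {ω : 𝔽} (ω-root : ω * ω + ω + 1# ≡ 0#) where

    -- The ring solver does not know the relation for ω, so the multiple of ω² + ω + 1 by
    -- which two polynomials in ω differ has to be supplied.
    mod-ω : ∀ {a b} c → a ≡ b + (ω * ω + ω + 1#) * c → a ≡ b
    mod-ω {a} {b} c eq = begin
      a                              ≡⟨ eq ⟩
      b + (ω * ω + ω + 1#) * c       ≡⟨ cong (λ r → b + r * c) ω-root ⟩
      b + 0# * c                     ≡⟨ cong (b +_) (zeroˡ c) ⟩
      b + 0#                         ≡⟨ +-identityʳ b ⟩
      b                              ∎

    -- The difference of the two primitive cube roots of unity, a square root of -3. It is the
    -- coefficient to divide by when `w` is recovered from w + w⁻¹ and ω w + ω² w⁻¹.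
    δ : 𝔽
    δ = ω - ω * ω

    δ² : δ * δ ≡ - 3#
    δ² = mod-ω (ω * ω - 3# * ω + 3#) (solve 1
      (λ w → (w :+ :- (w :* w)) :* (w :+ :- (w :* w)) := :- three :+ (w :* w :+ w :+ one) :* (w :* w :+ :- (three :* w) :+ three)) refl ω)

    δ≢0 : 3# ≢ 0# → δ ≢ 0#
    δ≢0 3≢0 δ≡0 = 3≢0 (begin
      3#            ≡⟨ solve 1 (λ x → x := :- (:- x)) refl 3# ⟩
      - (- 3#)      ≡⟨ cong -_ δ² ⟨
      - (δ * δ)     ≡⟨ cong (λ d → - (d * δ)) δ≡0 ⟩
      - (0# * δ)    ≡⟨ solve 1 (λ d → :- (nought :* d) := nought) refl δ ⟩
      0#            ∎)

  divide : ∀ {d} a → d ≢ 0# → ∃ λ w → d * w ≡ a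
  divide {d} a d≢0 = inv d d≢0 * a , (begin
    d * (inv d d≢0 * a)    ≡⟨ *-assoc d (inv d d≢0) a ⟨
    d * inv d d≢0 * a      ≡⟨ cong (_* a) (inv-inverse d d≢0) ⟩
    1# * a                 ≡⟨ *-identityˡ a ⟩
    a                      ∎)

  -- w + w⁻¹ = X, without the division.
  IsRoot : 𝔽 → 𝔽 → Set
  IsRoot X w = w * w + 1# ≡ X * w

  root? : ∀ X w → Dec (IsRoot X w)
  root? X w = w * w + 1# ≟ X * w

  roots : 𝔽 → ℕ
  roots X = sum λ w → ⟦ root? X w ⟧

  -- The Dickson polynomial: D (w + w⁻¹) = w³ + w⁻³.
  D : 𝔽 → 𝔽
  D X = X * X * X - (X + X + X)

  -- By Vieta the other root is `X - w`, so comparing it with `w` detects a double root without a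
  -- discriminant.
  data RootPattern (X : 𝔽) : Set where
    noRoots     : (∀ w → ¬ IsRoot X w) → RootPattern X
    doubleRoot  : ∀ w → IsRoot X w → X - w ≡ w → RootPattern X
    splitRoots  : ∀ w → IsRoot X w → X - w ≢ w → RootPattern X

  rootPattern : ∀ X → RootPattern X
  rootPattern X with any? (root? X)
  ... | no  ∄w = noRoots λ w root → ∄w (w , root)
  ... | yes (w , root) with X - w ≟ w
  ...   | yes eq = doubleRoot w root eq
  ...   | no neq = splitRoots w root neq

  private
    other-root : ∀ {X w} → IsRoot X w → IsRoot X (X - w)
    other-root {X} {w} root = begin
      (X - w) * (X - w) + 1#           ≡⟨ solve 2 (λ X w → (X :+ :- w) :* (X :+ :- w) :+ one :=
          X :* (X :+ :- w) :+ ((w :* w :+ one) :+ :- (X :* w))) refl X w ⟩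
      X * (X - w) + (w * w + 1# - X * w)  ≡⟨ cong (X * (X - w) +_) (x≡y⇒x-y≡0 root) ⟩
      X * (X - w) + 0#                 ≡⟨ +-identityʳ _ ⟩
      X * (X - w)                      ∎

    two-roots : ∀ {X w u} → IsRoot X w → IsRoot X u → u ≡ w ⊎ u ≡ X - w
    two-roots {X} {w} {u} w-root u-root = [ inj₁ ∘ x-y≡0 , inj₂ ∘ x-y≡0 ]′ (x*y≡0 (begin
      (u - w) * (u - (X - w))                          ≡⟨ solve 3 (λ X w u → (u :+ :- w) :* (u :+ :- (X :+ :- w)) :=
                                                            ((u :* u :+ one) :+ :- (X :* u)) :+ :- ((w :* w :+ one)
                                                                :+ :- (X :* w))) refl X w u ⟩
      (u * u + 1# - X * u) - (w * w + 1# - X * w)      ≡⟨ cong₂ _-_ (x≡y⇒x-y≡0 u-root) (x≡y⇒x-y≡0 w-root) ⟩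
      0# - 0#                                          ≡⟨ -‿inverseʳ 0# ⟩
      0#                                               ∎))

  roots-none : ∀ {X} → (∀ w → ¬ IsRoot X w) → roots X ≡ 0
  roots-none ∄w = sum-zero _ λ w → ⟦⟧-no (root? _ w) (∄w w)

  roots-double : ∀ {X} w → IsRoot X w → X - w ≡ w → roots X ≡ 1
  roots-double {X} w root eq = trans
    (sum-cong λ u → ⟦⟧-cong (root? X u) (u ≟ w) (λ u-root → [ (λ e → e) , (λ e → trans e eq) ]′ (two-roots root u-root)) λ { refl → root })
    (sum-⟦≟⟧ w)

  roots-split : ∀ {X} w → IsRoot X w → X - w ≢ w → roots X ≡ 2
  roots-split {X} w root neq = begin
    roots X                                          ≡⟨ sum-cong pointwise ⟩
    sum (λ u → ⟦ u ≟ w ⟧ ℕ.+ ⟦ u ≟ X - w ⟧)           ≡⟨ sum-+ (λ u → ⟦ u ≟ w ⟧) (λ u → ⟦ u ≟ X - w ⟧) ⟩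
    sum (λ u → ⟦ u ≟ w ⟧) ℕ.+ sum (λ u → ⟦ u ≟ X - w ⟧)   ≡⟨ cong₂ ℕ._+_ (sum-⟦≟⟧ w) (sum-⟦≟⟧ (X - w)) ⟩
    2                                                ∎
    where
    pointwise : ∀ u → ⟦ root? X u ⟧ ≡ ⟦ u ≟ w ⟧ ℕ.+ ⟦ u ≟ X - w ⟧
    pointwise u with u ≟ w | u ≟ X - w
    ... | yes u≡w | yes u≡X-w = contradiction (trans (sym u≡X-w) u≡w) neq
    ... | yes refl | no _     = ⟦⟧-yes (root? X u) root
    ... | no _ | yes refl     = ⟦⟧-yes (root? X u) (other-root root)
    ... | no u≢w | no u≢X-w   = ⟦⟧-no (root? X u) λ u-root → [ u≢w , u≢X-w ]′ (two-roots root u-root)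

  roots≤2 : ∀ X → roots X ℕ.≤ 2
  roots≤2 X with rootPattern X
  ... | noRoots ∄w           rewrite roots-none ∄w           = z≤n
  ... | doubleRoot w root e  rewrite roots-double w root e   = ℕ.s≤s z≤n
  ... | splitRoots w root e  rewrite roots-split w root e    = ℕ.≤-refl

  -- A double root means w = w⁻¹, hence X = 2 w and X² = 4, and X³ - 3 X collapses to X.
  D-double : ∀ {X w} → IsRoot X w → X - w ≡ w → D X ≡ X
  D-double {X} {w} root X-w≡w = begin
    X * X * X - (X + X + X)          ≡⟨ cong (λ u → u * X - (X + X + X)) X²≡4 ⟩
    (2# + 2#) * X - (X + X + X)      ≡⟨ solve 1 (λ X → (two :+ two) :* X :+ :- (X :+ X :+ X) := X) refl X ⟩
    X                                ∎
    where
    X≡2w : X ≡ w + w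
    X≡2w = begin
      X             ≡⟨ solve 2 (λ X w → X := (X :+ :- w) :+ w) refl X w ⟩
      X - w + w     ≡⟨ cong (_+ w) X-w≡w ⟩
      w + w         ∎
    X²≡4 : X * X ≡ 2# + 2#
    X²≡4 = begin
      X * X                                      ≡⟨ cong (λ u → u * u) X≡2w ⟩
      (w + w) * (w + w)                          ≡⟨ solve 1 (λ w → (w :+ w) :* (w :+ w) :=
          two :+ two :+ (two :+ two) :* ((w :+ w) :* w :+ :- (w :* w :+ one))) refl w ⟩
      2# + 2# + (2# + 2#) * ((w + w) * w - (w * w + 1#))
          ≡⟨ cong (λ u → 2# + 2# + (2# + 2#) * u) (x≡y⇒x-y≡0 (sym (trans root (cong (_* w) X≡2w)))) ⟩
      2# + 2# + (2# + 2#) * 0#                   ≡⟨ solve 0 (two :+ two :+ (two :+ two) :* nought := two :+ two) refl ⟩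
      2# + 2#                                    ∎

  double⇒≢1 : 3# ≢ 0# → ∀ {X w} → IsRoot X w → X - w ≡ w → X ≢ 1#
  double⇒≢1 3≢0 {X} {w} root X-w≡w X≡1 = 3≢0 (begin
    3#                             ≡⟨ solve 0 (three := one :+ one :+ one :+ (nought)) refl ⟩
    3# + 0#                        ≡⟨ cong (3# +_) (x≡y⇒x-y≡0 (D-double root X-w≡w)) ⟨
    3# + (D X - X)                 ≡⟨ cong (λ u → 3# + (D u - u)) X≡1 ⟩
    3# + (D 1# - 1#)               ≡⟨ solve 0 (three :+ (one :* one :* one :+ :- (one :+ one :+ one) :+ :- one) := nought) refl ⟩
    0#                             ∎)

  module _ {ω : 𝔽} (ω-root : ω * ω + ω + 1# ≡ 0#) (3≢0 : 3# ≢ 0#) where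

    -- For X = ±1 the element - ω X has inverse - ω² X, and the two add up to X because ω + ω² = -1.
    X²≡1⇒root : ∀ {X} → X * X ≡ 1# → ∃ (IsRoot X)
    X²≡1⇒root {X} X²≡1 = - (ω * X) , x-y≡0 (begin
      - (ω * X) * - (ω * X) + 1# - X * - (ω * X)
          ≡⟨ solve 2 (λ w X → :- (w :* X) :* :- (w :* X) :+ one :+ :- (X :* :- (w :* X)) := (w :* w :+ w) :* (X :* X) :+ one) refl ω X ⟩
      (ω * ω + ω) * (X * X) + 1#                   ≡⟨ cong (λ u → (ω * ω + ω) * u + 1#) X²≡1 ⟩
      (ω * ω + ω) * 1# + 1#                        ≡⟨ cong (_+ 1#) (*-identityʳ _) ⟩
      ω * ω + ω + 1#                               ≡⟨ ω-root ⟩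
      0#                                           ∎)

    -- If w + w⁻¹ = X and w³ = g, then (X² − 1) w = g + X.
    D-root : ∀ {X g} → IsRoot (D X) g → ∃ (IsRoot X)
    D-root {X} {g} g-root with X * X ≟ 1#
    -- The factor X² - 1 vanishes here, so `w` cannot be solved for and `ω` supplies the root.
    ... | yes X²≡1 = X²≡1⇒root X²≡1
    ... | no  X²≢1 = w , *-cancelˡ (*-≢0 d≢0 d≢0) (x-y≡0 (begin
      d * d * (w * w + 1#) - d * d * (X * w)                 ≡⟨ solve 3 (λ d w X → d :* d :* (w :* w :+ one) :+ :- (d :* d :* (X :* w)) :=
                                                                  (d :* w) :* (d :* w) :+ d :* d :+ :- (X :* d :* (d :* w))) refl d w X ⟩
      d * w * (d * w) + d * d - X * d * (d * w)              ≡⟨ cong (λ u → u * u + d * d - X * d * u) dw≡ ⟩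
      -- After the substitution the equation of `w`, multiplied by d², is exactly the given equation
      -- of `g`.
      (g + X) * (g + X) + d * d - X * d * (g + X)            ≡⟨ solve 2 (λ g X → let d = X :* X :+ :- one in
                                                                  (g :+ X) :* (g :+ X) :+ d :* d :+ :- (X :* d :* (g :+ X)) :=
                                                                  g :* g :+ one :+ :- ((X :* X :* X :+ :- (X :+ X :+ X)) :* g)) refl g X ⟩
      g * g + 1# - D X * g                                   ≡⟨ x≡y⇒x-y≡0 g-root ⟩
      0#                                                     ∎))
      where
      d = X * X - 1#
      d≢0 : d ≢ 0#
      d≢0 d≡0 = X²≢1 (x-y≡0 d≡0)
      w = proj₁ (divide (g + X) d≢0)
      dw≡ = proj₂ (divide (g + X) d≢0)

    -- If X = w + w⁻¹, the other roots of D Y = D X are ω w + ω² w⁻¹ and its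
    -- conjugate, which allows to solve for w.
    D-collision : ∀ {X Y} → D X ≡ D Y → X ≢ Y → ∃ (IsRoot X)
    D-collision {X} {Y} DX≡DY X≢Y with x*y≡0 {X - Y} {X * X + X * Y + Y * Y - 3#} (begin
      (X - Y) * (X * X + X * Y + Y * Y - 3#)   ≡⟨ solve 2 (λ X Y → (X :+ :- Y) :* (X :* X :+ X :* Y :+ Y :* Y :+ :- three) :=
                                                    X :* X :* X :+ :- (X :+ X :+ X) :+ :- (Y :* Y :* Y :+ :- (Y :+ Y :+ Y))) refl X Y ⟩
      D X - D Y                                ≡⟨ x≡y⇒x-y≡0 DX≡DY ⟩
      0#                                       ∎)
    ... | inj₁ X-Y≡0 = contradiction (x-y≡0 X-Y≡0) X≢Y
    ... | inj₂ q≡0   = w , *-cancelˡ (*-≢0 d≢0 d≢0) (x-y≡0 (begin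
      d * d * (w * w + 1#) - d * d * (X * w)                 ≡⟨ solve 3 (λ d w X → d :* d :* (w :* w :+ one) :+ :- (d :* d :* (X :* w)) :=
                                                                  (d :* w) :* (d :* w) :+ d :* d :+ :- (X :* d :* (d :* w))) refl d w X ⟩
      d * w * (d * w) + d * d - X * d * (d * w)              ≡⟨ cong (λ u → u * u + d * d - X * d * u) dw≡ ⟩
      -- Modulo ω² + ω + 1 the equation of `w`, multiplied by d², is the cofactor of X - Y in D X -
      -- D Y.
      a * a + d * d - X * d * a                              ≡⟨ mod-ω ω-root _ (solve 3 (λ w X Y →
                                                                  let a = Y :+ :- (w :* w :* X) ; d = w :+ :- (w :* w) in
                                                                  a :* a :+ d :* d :+ :- (X :* d :* a) :=
                                                                  X :* X :+ X :* Y :+ Y :* Y :+ :- three :+ (w :* w :+ w :+ one) :*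
                                                                    (w :* w :+ :- (three :* w) :+ three :+ :- (X :* Y) :+ (w :+ :- one) :* (X :* X))) refl ω X Y) ⟩
      X * X + X * Y + Y * Y - 3#                             ≡⟨ q≡0 ⟩
      0#                                                     ∎))
      where
      d = δ ω-root
      d≢0 = δ≢0 ω-root 3≢0
      a = Y - ω * ω * X
      w = proj₁ (divide a d≢0)
      dw≡ = proj₂ (divide a d≢0)

-- Comparing the plane cubic with the curve v (v - 1) = g (v - t)

module CountingPoints {n} (F : FiniteField n) where
  open FieldProperties F
  open ℕΣ
  open Reindexing ℕ.+-*-commutativeSemiring
  open Dickson F
  open ≡-Reasoning

  nonzero? : ∀ x → Dec (x ≢ 0#)
  nonzero? x = ¬? (x ≟ 0#)

  root⇒≢0 : ∀ {X w} → IsRoot X w → w ≢ 0#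
  root⇒≢0 {X} root refl = 1≢0 (begin
    1#               ≡⟨ solve 0 (one := nought :* nought :+ one) refl ⟩
    0# * 0# + 1#     ≡⟨ root ⟩
    X * 0#           ≡⟨ zeroʳ X ⟩
    0#               ∎)

  ≢-1⇒1+≢0 : ∀ {w} → w ≢ -1# → 1# + w ≢ 0#
  ≢-1⇒1+≢0 {w} w≢-1 eq = w≢-1 (begin
    w               ≡⟨ solve 1 (λ w → w := (one :+ w) :+ :- one) refl w ⟩
    1# + w + -1#    ≡⟨ cong (_+ -1#) eq ⟩
    0# + -1#        ≡⟨ +-identityˡ -1# ⟩
    -1#             ∎)

  root-unique : ∀ {w} → w ≢ 0# → ∃ λ X → IsRoot X w × (∀ Y → IsRoot Y w → Y ≡ X)
  root-unique {w} w≢0 with divide (w * w + 1#) w≢0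
  ... | X , wX≡ = X , trans (sym wX≡) (*-comm w X)
                , λ Y Y-root → *-cancelˡ w≢0 (trans (*-comm w Y) (trans (sym Y-root) (sym wX≡)))

  -- Each w ≠ 0 is a root for exactly one X, namely w + w⁻¹, so weighting X by its number of roots
  -- amounts to summing over w. The exception is w = -1: its X is -2, where `h` vanishes while
  -- `k -1#` need not, whence the extra term on the left.
  sum-roots : (h k : 𝔽 → ℕ) → (∀ {X w} → IsRoot X w → w ≢ -1# → h X ≡ k w) →
              (∀ {X} → X + 2# ≡ 0# → h X ≡ 0) →
              sum (λ X → roots X ℕ.* h X) ℕ.+ k -1# ≡ sum (λ w → ⟦ nonzero? w ⟧ ℕ.* k w)
  sum-roots h k h≡k h≡0 = begin
    sum (λ X → roots X ℕ.* h X) ℕ.+ k -1#            ≡⟨ cong₂ ℕ._+_ (sum-sift root? h) (sym (sum-δ -1# k)) ⟩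
    sum S ℕ.+ sum (λ w → ⟦ w ≟ -1# ⟧ ℕ.* k w)        ≡⟨ sum-+ S _ ⟨
    sum (λ w → S w ℕ.+ ⟦ w ≟ -1# ⟧ ℕ.* k w)          ≡⟨ sum-cong pointwise ⟩
    sum (λ w → ⟦ nonzero? w ⟧ ℕ.* k w)               ∎
    where
    S : 𝔽 → ℕ
    S w = sum λ X → ⟦ root? X w ⟧ ℕ.* h X

    at-1 : ∀ {X} → IsRoot X -1# → X + 2# ≡ 0#
    at-1 {X} root = begin
      X + 2#                               ≡⟨ solve 1 (λ X → X :+ two := (:- one :* :- one :+ one) :+ :- (X :* :- one)) refl X ⟩
      -1# * -1# + 1# - X * -1#             ≡⟨ x≡y⇒x-y≡0 root ⟩
      0#                                   ∎

    pointwise : ∀ w → S w ℕ.+ ⟦ w ≟ -1# ⟧ ℕ.* k w ≡ ⟦ nonzero? w ⟧ ℕ.* k w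
    pointwise w = by-cases (w ≟ 0#) (w ≟ -1#)
      where
      by-cases : (z : Dec (w ≡ 0#)) (d : Dec (w ≡ -1#)) → S w ℕ.+ ⟦ d ⟧ ℕ.* k w ≡ ⟦ ¬? z ⟧ ℕ.* k w
      by-cases (yes refl) (yes 0≡-1) = contradiction (sym 0≡-1) -1≢0
      by-cases (yes refl) (no _)     = trans (ℕ.+-identityʳ (S 0#)) (sum-none (λ X → root? X 0#) h λ X root → root⇒≢0 root refl)
      by-cases (no _)     (yes refl) = cong (ℕ._+ (k -1# ℕ.+ 0)) (sum-zero _ λ X →
        trans (⟦⟧-congˡ (root? X -1#) (λ root → h≡0 (at-1 root))) (ℕ.*-zeroʳ ⟦ root? X -1# ⟧))
      by-cases (no w≢0)   (no w≢-1) with root-unique w≢0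
      ... | X , root , unique = begin
        S w ℕ.+ 0                                ≡⟨ ℕ.+-identityʳ (S w) ⟩
        S w                                      ≡⟨ sum-cong (λ X → ⟦⟧-congˡ (root? X w) λ root → h≡k root w≢-1) ⟩
        sum (λ X → ⟦ root? X w ⟧ ℕ.* k w)        ≡⟨ sum-unique (λ X → root? X w) (λ _ → k w) X root unique ⟩
        k w                                      ≡⟨ ℕ.*-identityˡ (k w) ⟨
        1 ℕ.* k w                                ∎

  module _ (t : 𝔽) where

    -- cubicFibre X counts the points with a = X + 2 on the plane cubic
    -- a + b + c = 3, a b c = t.
    cubicFibre conicPoints curvePoints : 𝔽 → ℕ
    cubicFibre X = sum λ b → ⟦ (X + 2#) * b * (1# - X - b) ≟ t ⟧
    conicPoints   s = sum λ m → ⟦ (s + 2#) * m * (1# - m) ≟ t ⟧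
    -- The equation is v (v - 1) = g (v - t) rearranged: the v over `g`, without division by v - t.
    curvePoints   g = sum λ v → ⟦ v * (1# + g - v) ≟ t * g ⟧

    cubicPoints : ℕ
    cubicPoints = sum cubicFibre

    -- Since X³ - 3 X + 2 = (X + 2) (1 - X)², the substitution b = (1 - X) m carries one equation
    -- into the other. It degenerates at X = 1.
    conic-D : ∀ {X} → X ≢ 1# → conicPoints (D X) ≡ cubicFibre X
    conic-D {X} X≢1 = sym (trans
      (sum-scale (λ 1-X≡0 → X≢1 (sym (x-y≡0 1-X≡0))) (λ b → ⟦ (X + 2#) * b * (1# - X - b) ≟ t ⟧))
      (sum-cong λ m → cong (λ u → ⟦ u ≟ t ⟧) (solve 2 (λ X m →
        (X :+ two) :* ((one :+ :- X) :* m) :* (one :+ :- X :+ :- ((one :+ :- X) :* m)) :=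
        (X :* X :* X :+ :- (X :+ X :+ X) :+ two) :* m :* (one :+ :- m)) refl X m)))

    -- For X = w + w⁻¹ one has X + 2 = (1 + w)² w⁻¹. The substitution is v = k b, where k = - w (1 +
    -- w) is determined by k (1 - X) = 1 + w³; it is invertible because w is neither 0 nor -1.
    cubicFibre-root : ∀ {X w} → IsRoot X w → w ≢ -1# → cubicFibre X ≡ curvePoints (w * w * w)
    cubicFibre-root {X} {w} root w≢-1 = sym (trans
      (sum-scale k≢0 (λ v → ⟦ v * (1# + g - v) ≟ t * g ⟧))
      (sum-cong λ b → ⟦⟧-cong (k * b * (1# + g - k * b) ≟ t * g) ((X + 2#) * b * (1# - X - b) ≟ t)
        (λ eq → *-cancelˡ g≢0 (trans (scaled b) (trans eq (*-comm t g))))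
        (λ eq → trans (sym (scaled b)) (trans (cong (g *_) eq) (*-comm g t)))))
      where
      w≢0 = root⇒≢0 root
      g = w * w * w
      g≢0 = *-≢0 (*-≢0 w≢0 w≢0) w≢0
      k = -1# * w * (1# + w)
      k≢0 : k ≢ 0#
      k≢0 = *-≢0 (*-≢0 -1≢0 w≢0) (≢-1⇒1+≢0 w≢-1)
      scaled : ∀ b → g * ((X + 2#) * b * (1# - X - b)) ≡ k * b * (1# + g - k * b)
      scaled b = begin
        g * ((X + 2#) * b * (1# - X - b))                                        ≡⟨ solve 3 (λ w X b →
          w :* w :* w :* ((X :+ two) :* b :* (one :+ :- X :+ :- b)) :=
          w :* (X :* w :+ two :* w) :* b :* (w :+ :- (X :* w) :+ :- (w :* b))) refl w X b ⟩
        w * (X * w + 2# * w) * b * (w - X * w - w * b)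
            ≡⟨ cong (λ u → w * (u + 2# * w) * b * (w - u - w * b)) root ⟨
        w * (w * w + 1# + 2# * w) * b * (w - (w * w + 1#) - w * b)                ≡⟨ solve 2 (λ w b →
          w :* (w :* w :+ one :+ two :* w) :* b :* (w :+ :- (w :* w :+ one) :+ :- (w :* b)) :=
          (:- one :* w :* (one :+ w)) :* b :* (one :+ w :* w :* w :+ :- ((:- one :* w :* (one :+ w)) :* b))) refl w b ⟩
        k * b * (1# + g - k * b)                                                 ∎

    -- Here s + 2 = (1 + g)² g⁻¹, and the substitution is v = (1 + g) m.
    conic-root : ∀ {s g} → IsRoot s g → g ≢ -1# → conicPoints s ≡ curvePoints g
    conic-root {s} {g} root g≢-1 = sym (trans
      (sum-scale (≢-1⇒1+≢0 g≢-1) (λ v → ⟦ v * (1# + g - v) ≟ t * g ⟧))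
      (sum-cong λ m → ⟦⟧-cong ((1# + g) * m * (1# + g - (1# + g) * m) ≟ t * g) ((s + 2#) * m * (1# - m) ≟ t)
        (λ eq → *-cancelˡ (root⇒≢0 root) (trans (scaled m) (trans eq (*-comm t g))))
        (λ eq → trans (sym (scaled m)) (trans (cong (g *_) eq) (*-comm g t)))))
      where
      scaled : ∀ m → g * ((s + 2#) * m * (1# - m)) ≡ (1# + g) * m * (1# + g - (1# + g) * m)
      scaled m = begin
        g * ((s + 2#) * m * (1# - m))                   ≡⟨ solve 3 (λ g s m → g :* ((s :+ two) :* m :* (one :+ :- m)) :=
            (s :* g :+ two :* g) :* m :* (one :+ :- m)) refl g s m ⟩
        (s * g + 2# * g) * m * (1# - m)                 ≡⟨ cong (λ u → (u + 2# * g) * m * (1# - m)) root ⟨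
        (g * g + 1# + 2# * g) * m * (1# - m)            ≡⟨ solve 2 (λ g m → (g :* g :+ one :+ two :* g) :* m :* (one :+ :- m) :=
                                                             (one :+ g) :* m :* (one :+ g :+ :- ((one :+ g) :* m))) refl g m ⟩
        (1# + g) * m * (1# + g - (1# + g) * m)          ∎

    module _ (t≢0 : t ≢ 0#) where

      private
        no-points : ∀ {a} x y → a ≡ 0# → a * x * y ≢ t
        no-points x y refl eq = t≢0 (trans (sym eq) (solve 2 (λ x y → nought :* x :* y := nought) refl x y))

      cubicFibre-empty : ∀ {X} → X + 2# ≡ 0# → cubicFibre X ≡ 0
      cubicFibre-empty X+2≡0 = sum-zero _ λ b → ⟦⟧-no (_ ≟ t) (no-points b _ X+2≡0)

      conic-empty : ∀ {s} → s + 2# ≡ 0# → conicPoints s ≡ 0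
      conic-empty s+2≡0 = sum-zero _ λ m → ⟦⟧-no (_ ≟ t) (no-points m _ s+2≡0)

      -- For fixed m the equation is linear in s, with one solution or none according as m (1 - m)
      -- is nonzero or zero. The total is therefore the same for all t ≠ 0.
      sum-conic : sum conicPoints ≡ sum (λ m → ⟦ nonzero? (m * (1# - m)) ⟧)
      sum-conic = trans (sum-comm (λ s m → ⟦ (s + 2#) * m * (1# - m) ≟ t ⟧)) (sum-cong λ m → by-cases m (m * (1# - m) ≟ 0#))
        where
        assoc : ∀ s m → (s + 2#) * m * (1# - m) ≡ m * (1# - m) * (s + 2#)
        assoc = solve 2 (λ s m → (s :+ two) :* m :* (one :+ :- m) := m :* (one :+ :- m) :* (s :+ two)) refl

        by-cases : ∀ m (d : Dec (m * (1# - m) ≡ 0#)) → sum (λ s → ⟦ (s + 2#) * m * (1# - m) ≟ t ⟧) ≡ ⟦ ¬? d ⟧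
        by-cases m (yes q≡0) = sum-zero _ λ s → ⟦⟧-no (_ ≟ t) λ eq →
          t≢0 (trans (sym eq) (trans (assoc s m) (trans (cong (_* (s + 2#)) q≡0) (zeroˡ _))))
        by-cases m (no q≢0) with divide t q≢0
        ... | u , qu≡t = trans
          (sum-cong λ s → ⟦⟧-cong ((s + 2#) * m * (1# - m) ≟ t) (s ≟ u - 2#)
            (λ eq → begin
              s              ≡⟨ solve 1 (λ s → s := s :+ two :+ :- two) refl s ⟩
              s + 2# - 2#    ≡⟨ cong (_- 2#) (*-cancelˡ q≢0 (trans (sym (assoc s m)) (trans eq (sym qu≡t)))) ⟩
              u - 2#         ∎)
            λ { refl → begin
              (u - 2# + 2#) * m * (1# - m)    ≡⟨ solve 2 (λ u m → (u :+ :- two :+ two) :* m :* (one :+ :- m) :=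
                  m :* (one :+ :- m) :* u) refl u m ⟩
              m * (1# - m) * u                ≡⟨ qu≡t ⟩
              t                               ∎ })
          (sum-⟦≟⟧ (u - 2#))

  module _ {ω : 𝔽} (ω-root : ω * ω + ω + 1# ≡ 0#) (3≢0 : 3# ≢ 0#) where

    private
      -- This is 2 if X is not of the form w + w⁻¹, 1 at a double root and 0 at two distinct roots.
      -- By `roots≤2` the subtraction is not truncated.
      defect : 𝔽 → ℕ
      defect X = 2 ∸ roots X

      -- D takes the value -2 at both 1 and -2, so it has to be replaced by the identity on the
      -- elements w + w⁻¹. `D-root` keeps the images of the two regions apart and `D-collision`
      -- gives injectivity on the other one.
      D̃-step : ∀ X → Dec (∃ (IsRoot X)) → 𝔽
      D̃-step X (yes _) = X
      D̃-step X (no  _) = D X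

      D̃ : 𝔽 → 𝔽
      D̃ X = D̃-step X (any? (root? X))

      D̃-injective : ∀ {X Y} → D̃ X ≡ D̃ Y → X ≡ Y
      D̃-injective {X} {Y} = by-cases (any? (root? X)) (any? (root? Y))
        where
        by-cases : ∀ d e → D̃-step X d ≡ D̃-step Y e → X ≡ Y
        by-cases (yes _)        (yes _)        X≡Y   = X≡Y
        by-cases (yes (w , root)) (no ∄w)      refl  = contradiction (D-root ω-root 3≢0 root) ∄w
        by-cases (no ∄w)        (yes (w , root)) refl = contradiction (D-root ω-root 3≢0 root) ∄w
        by-cases (no ∄w)        (no _)         DX≡DY =
          decidable-stable (X ≟ Y) λ X≢Y → ∄w (D-collision ω-root 3≢0 DX≡DY X≢Y)

    -- D permutes the X that are not of the form w + w⁻¹, and fixes those with w = w⁻¹.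
    sum-defect : (h k : 𝔽 → ℕ) → (∀ {X} → X ≢ 1# → k (D X) ≡ h X) →
                 sum (λ X → defect X ℕ.* h X) ≡ sum (λ s → defect s ℕ.* k s)
    sum-defect h k k∘D≡h = sym (trans
      (sum-injective D̃ D̃-injective (λ s → defect s ℕ.* k s))
      (sum-cong λ X → by-cases X (any? (root? X)) (rootPattern X)))
      where
      by-cases : ∀ X d → RootPattern X → defect (D̃-step X d) ℕ.* k (D̃-step X d) ≡ defect X ℕ.* h X
      by-cases X (no ∄w) _ = cong₂ ℕ._*_
        (cong (2 ∸_) (trans (roots-none λ w root → ∄w (D-root ω-root 3≢0 root)) (sym (roots-none λ w root → ∄w (w , root)))))
        -- The value 1 is itself of the form w + w⁻¹, hence excluded here.
        (k∘D≡h λ { refl → ∄w (X²≡1⇒root ω-root 3≢0 (*-identityˡ 1#)) })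
      by-cases X (yes (w , root)) (noRoots ∄w) = contradiction root (∄w w)
      by-cases X (yes _) (doubleRoot w root eq) = cong (defect X ℕ.*_)
        (trans (cong k (sym (D-double root eq))) (k∘D≡h (double⇒≢1 3≢0 root eq)))
      -- The defect is 0, so nothing is asked of `h` and `k`; the case X = 1 falls here.
      by-cases X (yes _) (splitRoots w root neq) rewrite roots-split w root neq = refl

    sum-double : (h : 𝔽 → ℕ) → sum h ℕ.+ sum h ≡ sum (λ X → roots X ℕ.* h X) ℕ.+ sum (λ X → defect X ℕ.* h X)
    sum-double h = begin
      sum h ℕ.+ sum h                                        ≡⟨ sum-+ h h ⟨
      sum (λ X → h X ℕ.+ h X)                                ≡⟨ sum-cong (λ X → begin
        h X ℕ.+ h X                                            ≡⟨ cong (h X ℕ.+_) (ℕ.+-identityʳ (h X)) ⟨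
        2 ℕ.* h X                                              ≡⟨ cong (ℕ._* h X) (ℕ.m+[n∸m]≡n (roots≤2 X)) ⟨
        (roots X ℕ.+ defect X) ℕ.* h X                         ≡⟨ ℕ.*-distribʳ-+ (h X) (roots X) (defect X) ⟩
        roots X ℕ.* h X ℕ.+ defect X ℕ.* h X                   ∎) ⟩
      sum (λ X → roots X ℕ.* h X ℕ.+ defect X ℕ.* h X)       ≡⟨ sum-+ _ _ ⟩
      sum (λ X → roots X ℕ.* h X) ℕ.+ sum (λ X → defect X ℕ.* h X)   ∎

    -- Both doubled totals split into a part over the roots and a part over the defects. The defect
    -- parts agree through D; the root parts are sums of `curvePoints` over w³ and over g. Terms are
    -- moved across the equation because `ℕ` has no subtraction.
    cubic-curve-count : ∀ {t} → t ≢ 0# →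
      (cubicPoints t ℕ.+ cubicPoints t) ℕ.+ sum (λ g → ⟦ nonzero? g ⟧ ℕ.* curvePoints t g) ≡
      sum (λ w → ⟦ nonzero? w ⟧ ℕ.* curvePoints t (w * w * w)) ℕ.+
        (sum (λ m → ⟦ nonzero? (m * (1# - m)) ⟧) ℕ.+ sum (λ m → ⟦ nonzero? (m * (1# - m)) ⟧))
    cubic-curve-count {t} t≢0 = begin
      (cubicPoints t ℕ.+ cubicPoints t) ℕ.+ B                ≡⟨ cong₂ ℕ._+_ (sum-double (cubicFibre t)) (sym conic-roots) ⟩
      (Σe ℕ.+ Δe) ℕ.+ (ΣE ℕ.+ c₋)
          ≡⟨ cong (λ u → (Σe ℕ.+ u) ℕ.+ (ΣE ℕ.+ c₋)) (sum-defect (cubicFibre t) (conicPoints t) (conic-D t)) ⟩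
      (Σe ℕ.+ ΔE) ℕ.+ (ΣE ℕ.+ c₋)                            ≡⟨ rearrange Σe ΔE ΣE c₋ ⟩
      (Σe ℕ.+ c₋) ℕ.+ (ΣE ℕ.+ ΔE)                            ≡⟨ cong₂ ℕ._+_ cubicFibre-roots (sym (sum-double (conicPoints t))) ⟩
      A ℕ.+ (sum (conicPoints t) ℕ.+ sum (conicPoints t))    ≡⟨ cong (λ u → A ℕ.+ (u ℕ.+ u)) (sum-conic t t≢0) ⟩
      A ℕ.+ (N ℕ.+ N)                                        ∎
      where
      open import Data.Nat.Solver using (module +-*-Solver)
      A = sum (λ w → ⟦ nonzero? w ⟧ ℕ.* curvePoints t (w * w * w))
      B = sum (λ g → ⟦ nonzero? g ⟧ ℕ.* curvePoints t g)
      N = sum (λ m → ⟦ nonzero? (m * (1# - m)) ⟧)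
      Σe = sum (λ X → roots X ℕ.* cubicFibre t X)
      ΣE = sum (λ X → roots X ℕ.* conicPoints t X)
      Δe = sum (λ X → defect X ℕ.* cubicFibre t X)
      ΔE = sum (λ X → defect X ℕ.* conicPoints t X)
      c₋ = curvePoints t -1#

      rearrange : ∀ a b c d → (a ℕ.+ b) ℕ.+ (c ℕ.+ d) ≡ (a ℕ.+ d) ℕ.+ (c ℕ.+ b)
      rearrange = solve⁺ 4 (λ a b c d → (a ⊕ b) ⊕ (c ⊕ d) ⊜ (a ⊕ d) ⊕ (c ⊕ b)) refl
        where open +-*-Solver renaming (solve to solve⁺; _:+_ to _⊕_; _:=_ to _⊜_)

      conic-roots : ΣE ℕ.+ c₋ ≡ B
      conic-roots = sum-roots (conicPoints t) (curvePoints t) (conic-root t) (conic-empty t t≢0)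

      cubicFibre-roots : Σe ℕ.+ c₋ ≡ A
      -- As (-1)³ = -1, the correction at w = -1 is the same for both root sums and cancels.
      cubicFibre-roots = trans (cong (λ g → Σe ℕ.+ curvePoints t g) (solve 0 (:- one := :- one :* :- one :* :- one) refl))
        (sum-roots (cubicFibre t) (λ w → curvePoints t (w * w * w)) (cubicFibre-root t) (cubicFibre-empty t t≢0))

-- The Hesse pencil

module HessePencil {n} (F : FiniteField n) where
  open FieldProperties F
  open ℕΣ
  open Reindexing ℕ.+-*-commutativeSemiring
  open Dickson F
  open CountingPoints F
  open ≡-Reasoning

  cube : 𝔽 → 𝔽
  cube x = x * x * x

  cubeₚ : ∀ {k} → Polynomial k → Polynomial k
  cubeₚ x = x :* x :* x

  ⟦≟⟧-scale : ∀ {a b c d} k → k ≢ 0# → a - b ≡ k * (c - d) → ⟦ a ≟ b ⟧ ≡ ⟦ c ≟ d ⟧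
  ⟦≟⟧-scale {a} {b} {c} {d} k k≢0 eq = ⟦⟧-cong (a ≟ b) (c ≟ d)
    (λ a≡b → x-y≡0 (*-cancelˡ k≢0 (trans (sym eq) (trans (x≡y⇒x-y≡0 a≡b) (sym (zeroʳ k))))))
    (λ c≡d → x-y≡0 (trans eq (trans (cong (k *_) (x≡y⇒x-y≡0 c≡d)) (zeroʳ k))))

  module _ {ω : 𝔽} (ω-root : ω * ω + ω + 1# ≡ 0#) where

    -- The circulant determinant of x, y, z as the product of its eigenvalues. The last factor in
    -- the solver call is the quotient of the difference by ω² + ω + 1.
    fourier-product : ∀ x y z → (x + y + z) * (x + ω * y + ω * ω * z) * (x + ω * ω * y + ω * z) ≡
                      cube x + cube y + cube z - 3# * (x * y * z)
    fourier-product x y z = mod-ω ω-root _ (solve 4 (λ w x y z →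
      (x :+ y :+ z) :* (x :+ w :* y :+ w :* w :* z) :* (x :+ w :* w :* y :+ w :* z) :=
      cubeₚ x :+ cubeₚ y :+ cubeₚ z :+ :- (three :* (x :* y :* z)) :+ (w :* w :+ w :+ one) :*
        (w :* (w :* (x :* y :* z :+ y :* y :* z :+ y :* z :* z) :+ (x :* y :* y :+ x :* z :* z :+ y :* y :* y :+ z :* z :* z
            :+ :- (x :* y :* z))) :+ (x :* x :* y :+ con (ℤ.+ 3) :* x :* y :* z :+ x :* x :* z :+ :- (y :* y :* y)
            :+ :- (z :* z :* z)))) refl ω x y z)

    -- Summing over the three powers of ω keeps, with factor 3, only the monomials invariant under y
    -- ↦ ω y, z ↦ ω² z: the cubes, and x y z with its multinomial coefficient 6.
    fourier-cubes : ∀ x y z → cube (x + y + z) + cube (x + ω * y + ω * ω * z) + cube (x + ω * ω * y + ω * z) ≡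
                    3# * (cube x + cube y + cube z) + 3# * (3# * 2#) * (x * y * z)
    fourier-cubes x y z = mod-ω ω-root _ (solve 4 (λ w x y z →
      cubeₚ (x :+ y :+ z) :+ cubeₚ (x :+ w :* y :+ w :* w :* z) :+ cubeₚ (x :+ w :* w :* y :+ w :* z) :=
      three :* (cubeₚ x :+ cubeₚ y :+ cubeₚ z) :+ three :* (three :* two) :* (x :* y :* z) :+ (w :* w :+ w :+ one) :*
        (w :* (w :* (w :* (w :* (z :* z :* z :+ y :* y :* y) :+ (con (ℤ.+ 3) :* y :* z :* z :+ con (ℤ.+ 3) :* y :* y :* z
            :+ :- (z :* z :* z) :+ :- (y :* y :* y))) :+ (con (ℤ.+ 3) :* x :* z :* z :+ con (ℤ.+ 3) :* x :* y :* y))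
            :+ (con (ℤ.+ 12) :* x :* y :* z :+ con (ℤ.+ 2) :* y :* y :* y :+ con (ℤ.+ 2) :* z :* z :* z
            :+ :- (con (ℤ.+ 3) :* y :* z :* z) :+ :- (con (ℤ.+ 3) :* y :* y :* z) :+ :- (con (ℤ.+ 3) :* x :* z :* z)
            :+ :- (con (ℤ.+ 3) :* x :* y :* y))) :+ (con (ℤ.+ 3) :* x :* x :* z :+ con (ℤ.+ 3) :* x :* x :* y
            :+ :- (con (ℤ.+ 12) :* x :* y :* z) :+ :- (con (ℤ.+ 2) :* y :* y :* y)
            :+ :- (con (ℤ.+ 2) :* z :* z :* z) :+ con (ℤ.+ 3) :* y :* z :* z
            :+ con (ℤ.+ 3) :* y :* y :* z :+ con (ℤ.+ 3) :* x :* z :* z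
            :+ con (ℤ.+ 3) :* x :* y :* y))) refl ω x y z)

  hesse? : ∀ μ x y z → Dec (μ * (cube x + cube y + cube z) ≡ 3# * (x * y * z))
  hesse? μ x y z = μ * (cube x + cube y + cube z) ≟ 3# * (x * y * z)

  hessePoints hesseConePoints : 𝔽 → ℕ
  hessePoints     μ = sum λ y → sum λ z → ⟦ hesse? μ 1# y z ⟧
  hesseConePoints μ = sum λ x → sum λ y → sum λ z → ⟦ hesse? μ x y z ⟧

  -- The Fourier transform is linear in the triple and does not preserve the chart x = 1, so it has
  -- to act on the cone. The chart is recovered because the slice x = 0 does not depend on μ ≠ 0 and
  -- every other slice is a rescaled copy of x = 1.
  cone-decomposition : ∀ {μ} → μ ≢ 0# → hesseConePoints μ ≡
    sum (λ y → sum λ z → ⟦ cube y + cube z ≟ 0# ⟧) ℕ.+ sum (λ x → ⟦ nonzero? x ⟧) ℕ.* hessePoints μ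
  cone-decomposition {μ} μ≢0 = begin
    hesseConePoints μ                                                          ≡⟨ sum-cong (λ x → slice x (x ≟ 0#)) ⟩
    sum (λ x → ⟦ x ≟ 0# ⟧ ℕ.* I ℕ.+ ⟦ nonzero? x ⟧ ℕ.* A)                        ≡⟨ sum-+ _ _ ⟩
    sum (λ x → ⟦ x ≟ 0# ⟧ ℕ.* I) ℕ.+ sum (λ x → ⟦ nonzero? x ⟧ ℕ.* A)
        ≡⟨ cong₂ ℕ._+_ (sum-δ 0# (λ _ → I)) (sym (*-distribʳ-sum A (λ x → ⟦ nonzero? x ⟧))) ⟩
    I ℕ.+ sum (λ x → ⟦ nonzero? x ⟧) ℕ.* A                                     ∎
    where
    A = hessePoints μ
    I = sum (λ y → sum λ z → ⟦ cube y + cube z ≟ 0# ⟧)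

    slice : ∀ x (d : Dec (x ≡ 0#)) → sum (λ y → sum λ z → ⟦ hesse? μ x y z ⟧) ≡ ⟦ d ⟧ ℕ.* I ℕ.+ ⟦ ¬? d ⟧ ℕ.* A
    slice x (yes refl) = trans
      (sum-cong λ y → sum-cong λ z → ⟦≟⟧-scale {c = cube y + cube z} {d = 0#} μ μ≢0 (solve 3 (λ m y z →
        m :* (cubeₚ nought :+ cubeₚ y :+ cubeₚ z) :+ :- (three :* (nought :* y :* z)) :=
            m :* (cubeₚ y :+ cubeₚ z :+ :- nought)) refl μ y z))
      (trans (sym (ℕ.*-identityˡ I)) (sym (ℕ.+-identityʳ (1 ℕ.* I))))
    slice x (no x≢0) = begin
      sum (λ y → sum λ z → ⟦ hesse? μ x y z ⟧)                 ≡⟨ sum-scale x≢0 _ ⟩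
      sum (λ y → sum λ z → ⟦ hesse? μ x (x * y) z ⟧)           ≡⟨ sum-cong (λ y → sum-scale x≢0 _) ⟩
      sum (λ y → sum λ z → ⟦ hesse? μ x (x * y) (x * z) ⟧)
          ≡⟨ sum-cong (λ y → sum-cong λ z → ⟦≟⟧-scale (cube x) (*-≢0 (*-≢0 x≢0 x≢0) x≢0) (solve 4 (λ m x y z →
        m :* (cubeₚ x :+ cubeₚ (x :* y) :+ cubeₚ (x :* z)) :+ :- (three :* (x :* (x :* y) :* (x :* z))) :=
        cubeₚ x :* (m :* (cubeₚ one :+ cubeₚ y :+ cubeₚ z) :+ :- (three :* (one :* y :* z)))) refl μ x y z)) ⟩
      A                                                        ≡⟨ ℕ.*-identityˡ A ⟨
      1 ℕ.* A                                                  ∎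

  nonzero-count≢0 : ℕ.NonZero (sum λ x → ⟦ nonzero? x ⟧)
  nonzero-count≢0 = ℕ.>-nonZero (ℕ.≤-trans (ℕ.≤-reflexive (sym (sum-⟦≟⟧ 1#))) (sum-mono λ x → below x (x ≟ 1#)))
    where
    below : ∀ x (d : Dec (x ≡ 1#)) → ⟦ d ⟧ ℕ.≤ ⟦ nonzero? x ⟧
    below x (yes refl) = ℕ.≤-reflexive (sym (⟦⟧-yes (nonzero? 1#) 1≢0))
    below x (no _)     = z≤n

  module _ {ω : 𝔽} (ω-root : ω * ω + ω + 1# ≡ 0#) (3≢0 : 3# ≢ 0#) where

    private
      ω≢0 : ω ≢ 0#
      ω≢0 refl = 1≢0 (trans (solve 0 (one := nought :* nought :+ nought :+ one) refl) ω-root)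

    -- The discrete Fourier transform of order 3 acts on the Hesse pencil.
    cone-fourier : ∀ {μ ν} → 1# + 2# * μ ≢ 0# → ν * (1# + 2# * μ) ≡ 1# - μ →
                   hesseConePoints μ ≡ hesseConePoints ν
    cone-fourier {μ} {ν} κ≢0 νκ≡1-μ = begin
      sum (λ X → sum λ Y → sum λ Z → G X Y Z)
          ≡⟨ sum-cong (λ X → sum-cong λ Y → sum-affine (3# * ω) (dZ X Y) (*-≢0 3≢0 ω≢0) (G X Y)) ⟩
      sum (λ X → sum λ Y → sum λ z → G X Y (3# * ω * z + dZ X Y))      ≡⟨ sum-cong (λ X → sum-comm λ Y z → G X Y (3# * ω * z + dZ X Y)) ⟩
      sum (λ X → sum λ z → sum λ Y → G X Y (3# * ω * z + dZ X Y))      ≡⟨ sum-comm (λ X z → sum λ Y → G X Y (3# * ω * z + dZ X Y)) ⟩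
      sum (λ z → sum λ X → sum λ Y → G X Y (3# * ω * z + dZ X Y))
          ≡⟨ sum-cong (λ z → sum-cong λ X → sum-affine (ω - 1#) (dY X z) ω-1≢0 (λ Y → G X Y (3# * ω * z + dZ X Y))) ⟩
      sum (λ z → sum λ X → sum λ y → G′ X y z)                         ≡⟨ sum-cong (λ z → sum-comm λ X y → G′ X y z) ⟩
      sum (λ z → sum λ y → sum λ X → G′ X y z)
          ≡⟨ sum-cong (λ z → sum-cong λ y → sum-affine 1# (y + z) 1≢0 (λ X → G′ X y z)) ⟩
      sum (λ z → sum λ y → sum λ x → G′ (1# * x + (y + z)) y z)        ≡⟨ sum-cong (λ z → sum-cong λ y → sum-cong λ x → pointwise x y z) ⟩
      sum (λ z → sum λ y → sum λ x → ⟦ hesse? ν z y x ⟧)               ∎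
      where
      κ = 1# + 2# * μ

      G : 𝔽 → 𝔽 → 𝔽 → ℕ
      G X Y Z = ⟦ hesse? μ X Y Z ⟧

      -- The transform is performed one variable at a time: Z is affine in z with slope 3 ω once X
      -- and Y are fixed, Y is affine in y with slope ω - 1 once X and z are fixed, and X is a
      -- translate of x. These are the constant terms.
      dZ dY : 𝔽 → 𝔽 → 𝔽
      dZ X Y = X - ω * ω * (Y - X)
      dY X z = X + (ω * ω - 1#) * z

      G′ : 𝔽 → 𝔽 → 𝔽 → ℕ
      G′ X y z = G X ((ω - 1#) * y + dY X z) (3# * ω * z + dZ X ((ω - 1#) * y + dY X z))

      ω-1≢0 : ω - 1# ≢ 0#
      ω-1≢0 eq = δ≢0 ω-root 3≢0 (begin
        ω - ω * ω          ≡⟨ solve 1 (λ w → w :+ :- (w :* w) := :- w :* (w :+ :- one)) refl ω ⟩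
        - ω * (ω - 1#)     ≡⟨ cong (- ω *_) eq ⟩
        - ω * 0#           ≡⟨ zeroʳ (- ω) ⟩
        0#                 ∎)

      pointwise : ∀ x y z → G′ (1# * x + (y + z)) y z ≡ ⟦ hesse? ν z y x ⟧
      pointwise x y z = begin
        G′ (1# * x + (y + z)) y z      ≡⟨ cong (λ u → G′ u y z) (solve 3 (λ x y z → one :* x :+ (y :+ z) := x :+ y :+ z) refl x y z) ⟩
        G′ X y z                       ≡⟨ cong (λ u → G X u (3# * ω * z + dZ X u)) (solve 4 (λ w x y z →
          (w :+ :- one) :* y :+ (x :+ y :+ z :+ (w :* w :+ :- one) :* z) := x :+ w :* y :+ w :* w :* z) refl ω x y z) ⟩
        G X Y (3# * ω * z + dZ X Y)    ≡⟨ cong (G X Y) (mod-ω ω-root _ (solve 4 (λ w x y z →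
          three :* w :* z :+ (x :+ y :+ z :+ :- (w :* w :* (x :+ w :* y :+ w :* w :* z :+ :- (x :+ y :+ z)))) :=
          x :+ w :* w :* y :+ w :* z :+ (w :* w :+ w :+ one) :* (y :+ z :+ w :* z :+ :- (w :* y) :+ :- (w :* w :* z))) refl ω x y z)) ⟩
        G X Y Z                        ≡⟨ ⟦≟⟧-scale (- (3# * κ)) -3κ≢0 transformed ⟩
        ⟦ hesse? ν z y x ⟧             ∎
        where
        X = x + y + z
        Y = x + ω * y + ω * ω * z
        Z = x + ω * ω * y + ω * z
        S = cube x + cube y + cube z
        P = x * y * z

        -3κ≢0 : - (3# * κ) ≢ 0#
        -3κ≢0 eq = *-≢0 3≢0 κ≢0 (begin
          3# * κ             ≡⟨ solve 1 (λ u → u := :- (:- u)) refl (3# * κ) ⟩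
          - (- (3# * κ))     ≡⟨ cong -_ eq ⟩
          - 0#               ≡⟨ solve 0 (:- nought := nought) refl ⟩
          0#                 ∎)

        transformed : μ * (cube X + cube Y + cube Z) - 3# * (X * Y * Z) ≡
                      - (3# * κ) * (ν * (cube z + cube y + cube x) - 3# * (z * y * x))
        transformed = begin
          μ * (cube X + cube Y + cube Z) - 3# * (X * Y * Z)
              ≡⟨ cong₂ (λ u v → μ * u - 3# * v) (fourier-cubes ω-root x y z) (fourier-product ω-root x y z) ⟩
          -- S becomes 3 S + 18 P and P becomes S - 3 P. The transformed equation is again in the
          -- pencil, with (1 - μ) and (1 + 2 μ) as coefficients of S and 3 P, so its parameter is
          -- their quotient ν.
          μ * (3# * S + 3# * (3# * 2#) * P) - 3# * (S - 3# * P)    ≡⟨ solve 3 (λ m S P →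
            m :* (three :* S :+ three :* (three :* two) :* P) :+ :- (three :* (S :+ :- (three :* P))) :=
            :- (three :* ((one :+ :- m) :* S :+ :- (three :* (one :+ two :* m) :* P)))) refl μ S P ⟩
          - (3# * ((1# - μ) * S - 3# * κ * P))                     ≡⟨ cong (λ u → - (3# * (u * S - 3# * κ * P))) νκ≡1-μ ⟨
          - (3# * (ν * κ * S - 3# * κ * P))                        ≡⟨ solve 5 (λ v k x y z →
            :- (three :* (v :* k :* (cubeₚ x :+ cubeₚ y :+ cubeₚ z) :+ :- (three :* k :* (x :* y :* z)))) :=
            :- (three :* k) :* (v :* (cubeₚ z :+ cubeₚ y :+ cubeₚ x) :+ :- (three :* (z :* y :* x)))) refl ν κ x y z ⟩
          - (3# * κ) * (ν * (cube z + cube y + cube x) - 3# * (z * y * x))   ∎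

    hesse-fourier : ∀ {μ ν} → μ ≢ 0# → ν ≢ 0# → 1# + 2# * μ ≢ 0# → ν * (1# + 2# * μ) ≡ 1# - μ →
                    hessePoints μ ≡ hessePoints ν
    hesse-fourier {μ} {ν} μ≢0 ν≢0 κ≢0 νκ≡1-μ = ℕ.*-cancelˡ-≡ (hessePoints μ) (hessePoints ν) (sum λ x → ⟦ nonzero? x ⟧) {{nonzero-count≢0}}
      (ℕ.+-cancelˡ-≡ (sum λ y → sum λ z → ⟦ cube y + cube z ≟ 0# ⟧) _ _
        (trans (sym (cone-decomposition μ≢0)) (trans (cone-fourier κ≢0 νκ≡1-μ) (cone-decomposition ν≢0))))

    -- In the notation of cubicFibre, a, b and c are 1 + μ (ωⁱ y + ω⁻ⁱ z) for i = 0, 1, 2.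
    cubic≡hesse : ∀ {μ} → μ ≢ 0# → cubicPoints (1# - cube μ) ≡ hessePoints μ
    cubic≡hesse {μ} μ≢0 = begin
      sum (λ X → sum λ b → G X b)                                      ≡⟨ sum-affine μ -1# μ≢0 (λ X → sum λ b → G X b) ⟩
      sum (λ z → sum λ b → G (x₁ z) b)
          ≡⟨ sum-cong (λ z → sum-affine (μ * δ ω-root) (d z) (*-≢0 μ≢0 (δ≢0 ω-root 3≢0)) (G (x₁ z))) ⟩
      sum (λ z → sum λ y → G (x₁ z) (b₁ y z))                          ≡⟨ sum-comm (λ z y → G (x₁ z) (b₁ y z)) ⟩
      sum (λ y → sum λ z → G (x₁ z) (b₁ y z))                          ≡⟨ sum-cong (λ y → sum-affine 1# y 1≢0 (λ z → G (x₁ z) (b₁ y z))) ⟩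
      sum (λ y → sum λ z → G (x₁ (1# * z + y)) (b₁ y (1# * z + y)))    ≡⟨ sum-cong (λ y → sum-cong λ z → pointwise y z) ⟩
      hessePoints μ                                                    ∎
      where
      t = 1# - cube μ
      G : 𝔽 → 𝔽 → ℕ
      G X b = ⟦ (X + 2#) * b * (1# - X - b) ≟ t ⟧

      x₁ d : 𝔽 → 𝔽
      x₁ z = μ * z + -1#
      d z = 1# + μ * (ω * ω) * z

      b₁ : 𝔽 → 𝔽 → 𝔽
      b₁ y z = μ * δ ω-root * y + d z

      pointwise : ∀ y z → G (x₁ (1# * z + y)) (b₁ y (1# * z + y)) ≡ ⟦ hesse? μ 1# y z ⟧
      pointwise y z = ⟦≟⟧-scale (μ * μ) (*-≢0 μ≢0 μ≢0) (begin
        (X + 2#) * b * (1# - X - b) - t                      ≡⟨ cong (_- t) (cong₂ _*_ (cong₂ _*_ a≡ b≡) c≡) ⟩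
        (1# + y′ + z′) * (1# + ω * y′ + ω * ω * z′) * (1# + ω * ω * y′ + ω * z′) - t   ≡⟨ cong (_- t) (fourier-product ω-root 1# y′ z′) ⟩
        -- As t = 1 - μ³, the constant 1 cancels and μ² can be taken out.
        cube 1# + cube y′ + cube z′ - 3# * (1# * y′ * z′) - t  ≡⟨ solve 3 (λ m y z →
          cubeₚ one :+ cubeₚ (m :* y) :+ cubeₚ (m :* z) :+ :- (three :* (one :* (m :* y) :* (m :* z))) :+ :- (one :+ :- cubeₚ m) :=
          m :* m :* (m :* (cubeₚ one :+ cubeₚ y :+ cubeₚ z) :+ :- (three :* (one :* y :* z)))) refl μ y z ⟩
        μ * μ * (μ * (cube 1# + cube y + cube z) - 3# * (1# * y * z))   ∎)
        where
        X = x₁ (1# * z + y)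
        b = b₁ y (1# * z + y)
        y′ = μ * y
        z′ = μ * z

        Xₚ : ∀ {k} (m y z : Polynomial k) → Polynomial k
        Xₚ m y z = m :* (one :* z :+ y) :+ :- one
        bₚ : ∀ {k} (w m y z : Polynomial k) → Polynomial k
        bₚ w m y z = m :* (w :+ :- (w :* w)) :* y :+ (one :+ m :* (w :* w) :* (one :* z :+ y))

        a≡ : X + 2# ≡ 1# + y′ + z′
        a≡ = solve 3 (λ m y z → Xₚ m y z :+ two := one :+ m :* y :+ m :* z) refl μ y z
        b≡ : b ≡ 1# + ω * y′ + ω * ω * z′
        b≡ = solve 4 (λ w m y z → bₚ w m y z := one :+ w :* (m :* y) :+ w :* w :* (m :* z)) refl ω μ y z
        c≡ : 1# - X - b ≡ 1# + ω * ω * y′ + ω * z′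
        c≡ = mod-ω ω-root _ (solve 4 (λ w m y z →
          one :+ :- Xₚ m y z :+ :- bₚ w m y z :=
          one :+ w :* w :* (m :* y) :+ w :* (m :* z) :+ (w :* w :+ w :+ one) :* (:- (m :* (y :+ z)))) refl ω μ y z)

    cubicPoints-invariant : ∀ {μ ν} → μ ≢ 0# → ν ≢ 0# → 1# + 2# * μ ≢ 0# → ν * (1# + 2# * μ) ≡ 1# - μ →
                            cubicPoints (1# - cube μ) ≡ cubicPoints (1# - cube ν)
    cubicPoints-invariant μ≢0 ν≢0 κ≢0 νκ≡1-μ =
      trans (cubic≡hesse μ≢0) (trans (hesse-fourier μ≢0 ν≢0 κ≢0 νκ≡1-μ) (sym (cubic≡hesse ν≢0)))

-- Cube roots in a finite field

module CubeRoots {n} (F : FiniteField n) where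
  open FieldProperties F
  open ℕΣ
  open Dickson F
  open CountingPoints F
  open HessePencil F
  open ≡-Reasoning

  cubeRoots : 𝔽 → ℕ
  cubeRoots a = sum λ x → ⟦ cube x ≟ a ⟧

  cube-≢0 : ∀ {x} → x ≢ 0# → cube x ≢ 0#
  cube-≢0 x≢0 = *-≢0 (*-≢0 x≢0 x≢0) x≢0

  cube≢0⇒≢0 : ∀ {x} → cube x ≢ 0# → x ≢ 0#
  cube≢0⇒≢0 x³≢0 refl = x³≢0 (solve 0 (cubeₚ nought := nought) refl)

  cube-collision : ∀ {x y} → cube x ≡ cube y → x ≢ y → x * x + x * y + y * y ≡ 0#
  cube-collision {x} {y} x³≡y³ x≢y = [ (λ x-y≡0′ → contradiction (x-y≡0 x-y≡0′) x≢y) , (λ eq → eq) ]′ (x*y≡0 (begin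
    (x - y) * (x * x + x * y + y * y)   ≡⟨ solve 2 (λ x y → (x :+ :- y) :* (x :* x :+ x :* y :+ y :* y) := cubeₚ x :+ :- cubeₚ y) refl x y ⟩
    cube x - cube y                     ≡⟨ x≡y⇒x-y≡0 x³≡y³ ⟩
    0#                                  ∎))

  -- Given two distinct cube roots x and y, any further one is - (x + y): subtracting the quadratic
  -- relations of z and of y with x leaves (z - y) (z + x + y) = 0. A single cube root is listed
  -- three times.
  cubeRoots≤3 : ∀ a → cubeRoots a ℕ.≤ 3
  cubeRoots≤3 a with any? (λ x → cube x ≟ a)
  ... | no none = ℕ.≤-trans (ℕ.≤-reflexive (sum-zero _ λ x → ⟦⟧-no (cube x ≟ a) λ eq → none (x , eq))) z≤n
  ... | yes (x , x³≡a) with any? (λ y → (cube y ≟ a) ×-dec ¬? (y ≟ x))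
  ...   | no none = count≤3 (λ z → cube z ≟ a) x x x λ z z³≡a → inj₁ (decidable-stable (z ≟ x) λ z≢x → none (z , z³≡a , z≢x))
  ...   | yes (y , y³≡a , y≢x) = count≤3 (λ z → cube z ≟ a) x y (- (x + y)) third
    where
    third : ∀ z → cube z ≡ a → z ≡ x ⊎ z ≡ y ⊎ z ≡ - (x + y)
    third z z³≡a with z ≟ x
    ... | yes z≡x = inj₁ z≡x
    ... | no  z≢x = inj₂ ([ inj₁ ∘ x-y≡0 , inj₂ ∘ x-y≡0 ]′ (x*y≡0 (begin
      (z - y) * (z - - (x + y))                               ≡⟨ solve 3 (λ x y z → (z :+ :- y) :* (z :+ :- (:- (x :+ y))) :=
                                                                   (z :* z :+ z :* x :+ x :* x) :+ :- (y :* y :+ y :* x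
                                                                       :+ x :* x)) refl x y z ⟩
      z * z + z * x + x * x - (y * y + y * x + x * x)
          ≡⟨ cong₂ _-_ (cube-collision (trans z³≡a (sym x³≡a)) z≢x) (cube-collision (trans y³≡a (sym x³≡a)) y≢x) ⟩
      0# - 0#                                                 ≡⟨ -‿inverseʳ 0# ⟩
      0#                                                      ∎)))

  sum-cubeRoots : (f : 𝔽 → ℕ) → sum (λ a → cubeRoots a ℕ.* f a) ≡ sum (λ x → f (cube x))
  sum-cubeRoots f = trans (sum-sift (λ a x → cube x ≟ a) f)
    (sum-cong λ x → sum-unique (λ a → cube x ≟ a) f (cube x) refl λ a eq → sym eq)

  cubeRoots1≡3⇒ω : cubeRoots 1# ≡ 3 → ∃ λ ω → ω ≢ 1# × ω * ω + ω + 1# ≡ 0#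
  cubeRoots1≡3⇒ω three-roots with any? (λ x → (cube x ≟ 1#) ×-dec ¬? (x ≟ 1#))
  ... | yes (ω , ω³≡1 , ω≢1) = ω , ω≢1 , trans
    (solve 1 (λ w → w :* w :+ w :+ one := w :* w :+ w :* one :+ one :* one) refl ω)
    (cube-collision (trans ω³≡1 1≡1³) ω≢1)
    where
    1≡1³ : 1# ≡ cube 1#
    1≡1³ = solve 0 (one := cubeₚ one) refl
  ... | no none = contradiction (trans (sym three-roots) one-root) λ ()
    where
    one-root : cubeRoots 1# ≡ 1
    one-root = trans (sum-cong λ x → ⟦⟧-cong (cube x ≟ 1#) (x ≟ 1#)
      (λ x³≡1 → decidable-stable (x ≟ 1#) λ x≢1 → none (x , x³≡1 , x≢1))
      λ { refl → solve 0 (cubeₚ one := one) refl }) (sum-⟦≟⟧ 1#)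

  -- In characteristic 3 the polynomial ω² + ω + 1 is (ω - 1)², whose only root is 1.
  ω⇒3≢0 : ∀ {ω} → ω ≢ 1# → ω * ω + ω + 1# ≡ 0# → 3# ≢ 0#
  ω⇒3≢0 {ω} ω≢1 ω-root 3≡0 = *-≢0 ω-1≢0 ω-1≢0 (begin
    (ω - 1#) * (ω - 1#)                ≡⟨ solve 1 (λ w → (w :+ :- one) :* (w :+ :- one) := (w :* w :+ w :+ one) :+ :- (three :* w)) refl ω ⟩
    ω * ω + ω + 1# - 3# * ω            ≡⟨ cong₂ (λ u v → u - v * ω) ω-root 3≡0 ⟩
    0# - 0# * ω                        ≡⟨ solve 1 (λ w → nought :+ :- (nought :* w) := nought) refl ω ⟩
    0#                                 ∎)
    where
    ω-1≢0 : ω - 1# ≢ 0#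
    ω-1≢0 eq = ω≢1 (x-y≡0 eq)

-- Cubic characters

-- A constructive stand-in for a field of characteristic other than 2: equality is not decidable but
-- double-negation stable, and a factor may be cancelled once its vanishing is refuted.
record StableDomain (K : CommutativeRing 0ℓ 0ℓ) : Set where
  open CommutativeRing K
  field
    stable          : ∀ {x y} → ¬ ¬ (x ≈ y) → x ≈ y
    no-zero-divisor : ∀ {x y} → x * y ≈ 0# → ¬ (x ≈ 0#) → y ≈ 0#
    2≉0             : ¬ (1# + 1# ≈ 0#)

record CubicCharacter {n} (F : FiniteField n) (K : CommutativeRing 0ℓ 0ℓ) : Set where
  private
    module F = FiniteField F
    module K = CommutativeRing K
  field
    χ           : Fin n → K.Carrier
    χ-0         : χ F.0# K.≈ K.0#
    χ-1         : χ F.1# K.≈ K.1#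
    χ-*         : ∀ x y → χ (x F.* y) K.≈ χ x K.* χ y
    χ-cubed     : ∀ {x} → x ≢ F.0# → χ x K.* χ x K.* χ x K.≈ K.1#
    nontrivial  : ¬ (∀ x → x ≢ F.0# → χ x K.≈ K.1#)

-- Since a cubic character is trivial on cubes, the cosets ker, c ker and c² ker
-- are disjoint when χ c ≠ 1, and x ↦ x³ is at most 3 to 1, the kernel consists of
-- cubes and each of its elements has exactly 3 cube roots.
module KernelOfCubicCharacter {n} {F : FiniteField n} {K : CommutativeRing 0ℓ 0ℓ} (C : CubicCharacter F K)
  (trivial? : ∀ x → Dec (CommutativeRing._≈_ K (CubicCharacter.χ C x) (CommutativeRing.1# K))) where

  open CubicCharacter C
  open FieldProperties F
  open ℕΣ
  open Reindexing ℕ.+-*-commutativeSemiring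
  open Dickson F
  open CountingPoints F
  open HessePencil F
  open CubeRoots F
  private module K = CommutativeRing K

  χ-≡ : ∀ {x y} → x ≡ y → χ x K.≈ χ y
  χ-≡ refl = K.refl

  InKernel : 𝔽 → Set
  InKernel x = x ≢ 0# × χ x K.≈ K.1#

  inKernel? : ∀ x → Dec (InKernel x)
  inKernel? x = nonzero? x ×-dec trivial? x

  χ-cube : ∀ {x} → x ≢ 0# → χ (cube x) K.≈ K.1#
  χ-cube {x} x≢0 = K.trans (χ-* (x * x) x) (K.trans (K.*-congʳ (χ-* x x)) (χ-cubed x≢0))

  nontrivial-witness : ∃ λ c → c ≢ 0# × ¬ (χ c K.≈ K.1#)
  nontrivial-witness with any? (λ x → nonzero? x ×-dec ¬? (trivial? x))
  ... | yes witness = witness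
  ... | no  none    = contradiction (λ x x≢0 → decidable-stable (trivial? x) λ χx≉1 → none (x , x≢0 , χx≉1)) nontrivial

  cubeRoots-nonkernel : ∀ {a} → a ≢ 0# → ¬ (χ a K.≈ K.1#) → cubeRoots a ≡ 0
  cubeRoots-nonkernel a≢0 χa≉1 = sum-zero _ λ x → ⟦⟧-no (cube x ≟ _)
    λ { refl → χa≉1 (χ-cube (cube≢0⇒≢0 a≢0)) }

  private
    c = proj₁ nontrivial-witness
    c≢0 = proj₁ (proj₂ nontrivial-witness)
    χc≉1 = proj₂ (proj₂ nontrivial-witness)

    translate : ∀ {x} → InKernel x → ¬ InKernel (c * x)
    translate {x} (_ , χx≈1) (_ , χcx≈1) = χc≉1 (begin
      χ c               ≈⟨ K.*-identityʳ _ ⟨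
      χ c K.* K.1#      ≈⟨ K.*-congˡ χx≈1 ⟨
      χ c K.* χ x       ≈⟨ χ-* c x ⟨
      χ (c * x)         ≈⟨ χcx≈1 ⟩
      K.1#              ∎)
      where open import Relation.Binary.Reasoning.Setoid K.setoid

    -- Otherwise χ(c)² = 1, which together with χ(c)³ = 1 gives χ(c) = 1.
    translate² : ∀ {x} → InKernel x → ¬ InKernel (c * (c * x))
    translate² {x} (_ , χx≈1) (_ , χccx≈1) = χc≉1 (begin
      χ c                                   ≈⟨ K.*-identityˡ _ ⟨
      K.1# K.* χ c                          ≈⟨ K.*-congʳ χccx≈1 ⟨
      χ (c * (c * x)) K.* χ c
          ≈⟨ K.*-congʳ (K.trans (χ-* c (c * x)) (K.*-congˡ (K.trans (χ-* c x) (K.trans (K.*-congˡ χx≈1) (K.*-identityʳ _))))) ⟩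
      χ c K.* χ c K.* χ c                   ≈⟨ χ-cubed c≢0 ⟩
      K.1#                                  ∎)
      where open import Relation.Binary.Reasoning.Setoid K.setoid

    kernel-bound : sum (λ a → 3 ℕ.* ⟦ inKernel? a ⟧) ℕ.≤ sum (λ a → ⟦ nonzero? a ⟧)
    kernel-bound = ℕ.≤-trans (ℕ.≤-reflexive cosets) (sum-mono λ a → disjoint a (a ≟ 0#))
      where
      open ≡-Reasoning
      k : 𝔽 → ℕ
      k a = ⟦ inKernel? a ⟧

      cosets : sum (λ a → 3 ℕ.* k a) ≡ sum (λ a → k a ℕ.+ k (c * a) ℕ.+ k (c * (c * a)))
      cosets = sym (begin
        sum (λ a → k a ℕ.+ k (c * a) ℕ.+ k (c * (c * a)))                         ≡⟨ sum-+ (λ a → k a ℕ.+ k (c * a)) _ ⟩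
        sum (λ a → k a ℕ.+ k (c * a)) ℕ.+ sum (λ a → k (c * (c * a)))
            ≡⟨ cong₂ ℕ._+_ (sum-+ k _) (sym (trans (sum-scale c≢0 k) (sum-scale c≢0 (λ a → k (c * a))))) ⟩
        sum k ℕ.+ sum (λ a → k (c * a)) ℕ.+ sum k
            ≡⟨ cong (λ u → sum k ℕ.+ u ℕ.+ sum k) (sym (sum-scale c≢0 k)) ⟩
        sum k ℕ.+ sum k ℕ.+ sum k
            ≡⟨ trans (ℕ.+-assoc (sum k) _ _) (cong (λ u → sum k ℕ.+ (sum k ℕ.+ u)) (sym (ℕ.+-identityʳ (sum k)))) ⟩
        3 ℕ.* sum k                                                               ≡⟨ *-distribˡ-sum 3 k ⟩
        sum (λ a → 3 ℕ.* k a)                                                     ∎)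

      disjoint : ∀ a (d : Dec (a ≡ 0#)) → k a ℕ.+ k (c * a) ℕ.+ k (c * (c * a)) ℕ.≤ ⟦ ¬? d ⟧
      disjoint a (no _) = atMostOne (inKernel? a) (inKernel? (c * a)) (inKernel? (c * (c * a)))
        (λ (p , q) → translate p q) (λ (p , q) → translate p q) (λ (p , q) → translate² p q)
      disjoint _ (yes refl) = ℕ.≤-reflexive (cong₂ ℕ._+_ (cong₂ ℕ._+_ (k-zero refl) (k-zero (zeroʳ c))) (k-zero (trans (cong
          (c *_) (zeroʳ c)) (zeroʳ c))))
        where
        k-zero : ∀ {x} → x ≡ 0# → k x ≡ 0
        k-zero {x} x≡0 = ⟦⟧-no (inKernel? x) λ (x≢0 , _) → x≢0 x≡0

    cubeRoots-bound : ∀ a → ⟦ nonzero? a ⟧ ℕ.* cubeRoots a ℕ.≤ 3 ℕ.* ⟦ inKernel? a ⟧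
    cubeRoots-bound a = by-cases (a ≟ 0#) (trivial? a)
      where
      by-cases : (d : Dec (a ≡ 0#)) (e : Dec (χ a K.≈ K.1#)) → ⟦ ¬? d ⟧ ℕ.* cubeRoots a ℕ.≤ 3 ℕ.* ⟦ ¬? d ×-dec e ⟧
      by-cases (yes _)  _        = z≤n
      by-cases (no a≢0) (yes _)  = ℕ.≤-trans (ℕ.≤-reflexive (ℕ.*-identityˡ (cubeRoots a))) (cubeRoots≤3 a)
      by-cases (no a≢0) (no χa≉1) = ℕ.≤-reflexive (trans (ℕ.*-identityˡ (cubeRoots a)) (cubeRoots-nonkernel a≢0 χa≉1))

    -- Each x ≠ 0 is a cube root of exactly one a ≠ 0, so the left sides add up to the number of
    -- nonzero elements. By `kernel-bound` this is at least the total of the right sides, and the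
    -- pointwise bound becomes an equality.
    cubeRoots-exact : ∀ a → ⟦ nonzero? a ⟧ ℕ.* cubeRoots a ≡ 3 ℕ.* ⟦ inKernel? a ⟧
    cubeRoots-exact = sum-squeeze cubeRoots-bound (ℕ.≤-trans kernel-bound (ℕ.≤-reflexive (sym (begin
      sum (λ a → ⟦ nonzero? a ⟧ ℕ.* cubeRoots a)     ≡⟨ sum-cong (λ a → ℕ.*-comm ⟦ nonzero? a ⟧ (cubeRoots a)) ⟩
      sum (λ a → cubeRoots a ℕ.* ⟦ nonzero? a ⟧)     ≡⟨ sum-cubeRoots (λ a → ⟦ nonzero? a ⟧) ⟩
      sum (λ x → ⟦ nonzero? (cube x) ⟧)              ≡⟨ sum-cong (λ x → ⟦⟧-cong (nonzero? (cube x)) (nonzero? x) cube≢0⇒≢0 cube-≢0) ⟩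
      sum (λ x → ⟦ nonzero? x ⟧)                     ∎))))
      where open ≡-Reasoning

  cubeRoots-kernel : ∀ {a} → a ≢ 0# → χ a K.≈ K.1# → cubeRoots a ≡ 3
  cubeRoots-kernel {a} a≢0 χa≈1 = begin
    cubeRoots a                           ≡⟨ ℕ.*-identityˡ _ ⟨
    1 ℕ.* cubeRoots a                     ≡⟨ cong (ℕ._* cubeRoots a) (⟦⟧-yes (nonzero? a) a≢0) ⟨
    ⟦ nonzero? a ⟧ ℕ.* cubeRoots a        ≡⟨ cubeRoots-exact a ⟩
    3 ℕ.* ⟦ inKernel? a ⟧                 ≡⟨ cong (3 ℕ.*_) (⟦⟧-yes (inKernel? a) (a≢0 , χa≈1)) ⟩
    3                                     ∎
    where open ≡-Reasoning

  cube-root-of-unity : ∃ λ ω → ω ≢ 1# × ω * ω + ω + 1# ≡ 0#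
  cube-root-of-unity = cubeRoots1≡3⇒ω (cubeRoots-kernel 1≢0 χ-1)

-- Counts as elements of a commutative ring

module _ (K : CommutativeRing 0ℓ 0ℓ) where
  open CommutativeRing K renaming (refl to ≈-refl; sym to ≈-sym; trans to ≈-trans; zero to *-zero)
  open Mult semiring using (×-homo-+; ×1-homo-*) renaming (_×_ to _·_)
  private
    module KΣ = Sums commutativeSemiring
  open import Relation.Binary.Reasoning.Setoid setoid

  fromℕ : ℕ → Carrier
  fromℕ m = m · 1#

  fromℕ-1 : fromℕ 1 ≈ 1#
  fromℕ-1 = +-identityʳ 1#

  fromℕ-+ : ∀ i j → fromℕ (i ℕ.+ j) ≈ fromℕ i + fromℕ j
  fromℕ-+ = ×-homo-+ 1#

  fromℕ-* : ∀ i j → fromℕ (i ℕ.* j) ≈ fromℕ i * fromℕ j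
  fromℕ-* = ×1-homo-*

  fromℕ-⟦⟧ : ∀ {P : Set} (d : Dec P) → fromℕ ℕΣ.⟦ d ⟧ ≈ KΣ.⟦ d ⟧
  fromℕ-⟦⟧ (yes _) = fromℕ-1
  fromℕ-⟦⟧ (no  _) = ≈-refl

  fromℕ-sum : ∀ {n} (f : Fin n → ℕ) → fromℕ (ℕΣ.sum f) ≈ KΣ.sum (λ x → fromℕ (f x))
  fromℕ-sum {zero}  f = begin
    fromℕ (ℕΣ.sum f)                       ≡⟨ cong fromℕ (ℕΣ.sum-nil f) ⟩
    0#                                     ≡⟨ KΣ.sum-nil _ ⟨
    KΣ.sum (λ x → fromℕ (f x))             ∎
  fromℕ-sum {suc n} f = begin
    fromℕ (ℕΣ.sum f)                                      ≡⟨ cong fromℕ (ℕΣ.sum-cons f) ⟩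
    fromℕ (f zero ℕ.+ ℕΣ.sum (f ∘ suc))                   ≈⟨ fromℕ-+ (f zero) _ ⟩
    fromℕ (f zero) + fromℕ (ℕΣ.sum (f ∘ suc))             ≈⟨ +-congˡ (fromℕ-sum (f ∘ suc)) ⟩
    fromℕ (f zero) + KΣ.sum (λ x → fromℕ (f (suc x)))     ≡⟨ KΣ.sum-cons _ ⟨
    KΣ.sum (λ x → fromℕ (f x))                            ∎

-- The character sum P(t) and the plane cubic

module CubicCharacterSums {n} {F : FiniteField n} {K : CommutativeRing 0ℓ 0ℓ} (K-domain : StableDomain K) (C : CubicCharacter F K)
  (trivial? : ∀ x → Dec (CommutativeRing._≈_ K (CubicCharacter.χ C x) (CommutativeRing.1# K))) where

  open StableDomain K-domain
  open CubicCharacter C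
  open FieldProperties F
  private module K = CommutativeRing K
  open Reindexing K.commutativeSemiring
  open Dickson F using (2#; 3#; two; three)
  open CountingPoints F
  open HessePencil F using (cube; cubeₚ; cubicPoints-invariant)
  open CubeRoots F
  open KernelOfCubicCharacter C trivial?
  private
    module KS = IntegerSolver K
    open import Algebra.Properties.Ring K.ring using (+-cancelʳ)
  open Sums K.commutativeSemiring
  open import Relation.Binary.Reasoning.Setoid K.setoid

  oneₖ : ∀ {k} → KS.Polynomial k
  oneₖ = KS.con (ℤ.+ 1)

  1+χ+χ² : 𝔽 → K.Carrier
  1+χ+χ² a = K.1# K.+ χ a K.+ χ a K.* χ a

  -- On the kernel both sides are 3. Off it there are no cube roots, and 1 + χ + χ² vanishes because
  -- its product with χ - 1 ≠ 0 is χ³ - 1 = 0.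
  fromℕ-cubeRoots : ∀ {a} → a ≢ 0# → fromℕ K (cubeRoots a) K.≈ 1+χ+χ² a
  fromℕ-cubeRoots {a} a≢0 with trivial? a
  ... | yes χa≈1 = begin
    fromℕ K (cubeRoots a)               ≡⟨ cong (fromℕ K) (cubeRoots-kernel a≢0 χa≈1) ⟩
    fromℕ K 3
        ≈⟨ KS.solve 0 (oneₖ KS.:+ (oneₖ KS.:+ (oneₖ KS.:+ KS.con (ℤ.+ 0))) KS.:= oneₖ KS.:+ oneₖ KS.:+ oneₖ KS.:* oneₖ) K.refl ⟩
    K.1# K.+ K.1# K.+ K.1# K.* K.1#     ≈⟨ K.+-cong (K.+-congˡ χa≈1) (K.*-cong χa≈1 χa≈1) ⟨
    1+χ+χ² a                            ∎
  ... | no χa≉1 = begin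
    fromℕ K (cubeRoots a)               ≡⟨ cong (fromℕ K) (cubeRoots-nonkernel a≢0 χa≉1) ⟩
    K.0#                                ≈⟨ no-zero-divisor [χ-1][1+χ+χ²]≈0 χ-1≉0 ⟨
    1+χ+χ² a                            ∎
    where
    χ-1≉0 : ¬ (χ a K.- K.1# K.≈ K.0#)
    χ-1≉0 eq = χa≉1 (begin
      χ a                               ≈⟨ KS.solve 1 (λ x → x KS.:= (x KS.:+ KS.:- oneₖ) KS.:+ oneₖ) K.refl (χ a) ⟩
      χ a K.- K.1# K.+ K.1#             ≈⟨ K.+-congʳ eq ⟩
      K.0# K.+ K.1#                     ≈⟨ K.+-identityˡ _ ⟩
      K.1#                              ∎)

    [χ-1][1+χ+χ²]≈0 : (χ a K.- K.1#) K.* 1+χ+χ² a K.≈ K.0#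
    [χ-1][1+χ+χ²]≈0 = begin
      (χ a K.- K.1#) K.* 1+χ+χ² a
          ≈⟨ KS.solve 1 (λ x →
          (x KS.:+ KS.:- oneₖ) KS.:* (oneₖ KS.:+ x KS.:+ x KS.:* x) KS.:= x KS.:* x KS.:* x KS.:+ KS.:- oneₖ) K.refl (χ a) ⟩
      χ a K.* χ a K.* χ a K.- K.1#      ≈⟨ K.+-congʳ (χ-cubed a≢0) ⟩
      K.1# K.- K.1#                     ≈⟨ K.-‿inverseʳ K.1# ⟩
      K.0#                              ∎

  -- The conjugate character: χ³ = 1 makes the square the inverse, and at 0 it is 0 as well.
  χ² : 𝔽 → K.Carrier
  χ² x = χ x K.* χ x

  χ²-0 : χ² 0# K.≈ K.0#
  χ²-0 = K.trans (K.*-congʳ χ-0) (K.zeroˡ _)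

  χ-inverse : ∀ {x y} → x * y ≡ 1# → χ y K.≈ χ² x
  χ-inverse {x} {y} xy≡1 = begin
    χ y                                        ≈⟨ K.*-identityˡ _ ⟨
    K.1# K.* χ y                               ≈⟨ K.*-congʳ (χ-cubed (unit-≢0 xy≡1)) ⟨
    χ x K.* χ x K.* χ x K.* χ y                ≈⟨ K.*-assoc _ _ _ ⟩
    χ x K.* χ x K.* (χ x K.* χ y)              ≈⟨ K.*-congˡ (K.trans (K.sym (χ-* x y)) (K.trans (χ-≡ xy≡1) χ-1)) ⟩
    χ x K.* χ x K.* K.1#                       ≈⟨ K.*-identityʳ _ ⟩
    χ² x                                       ∎

  χ-⁻¹ : ∀ x → χ (x ⁻¹) K.≈ χ² x
  χ-⁻¹ x with x ≟ 0#
  ... | yes refl = K.trans χ-0 (K.sym χ²-0)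
  ... | no  x≢0 = χ-inverse (inv-inverse x x≢0)

  χ-[-1] : χ -1# K.≈ K.1#
  χ-[-1] = K.trans (χ-≡ (solve 0 (:- one := cubeₚ (:- one)) refl)) (χ-cube -1≢0)

  χ-neg : ∀ x → χ (- x) K.≈ χ x
  χ-neg x = begin
    χ (- x)                ≡⟨ cong χ (solve 1 (λ x → :- x := :- one :* x) refl x) ⟩
    χ (-1# * x)            ≈⟨ χ-* -1# x ⟩
    χ -1# K.* χ x          ≈⟨ K.*-congʳ χ-[-1] ⟩
    K.1# K.* χ x           ≈⟨ K.*-identityˡ _ ⟩
    χ x                    ∎

  sum-χ : sum χ K.≈ K.0#
  sum-χ with nontrivial-witness
  ... | c , c≢0 , χc≉1 = no-zero-divisor (begin
    (χ c K.- K.1#) K.* sum χ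
        ≈⟨ KS.solve 2 (λ c s → (c KS.:+ KS.:- oneₖ) KS.:* s KS.:= c KS.:* s KS.:+ KS.:- s) K.refl (χ c) (sum χ) ⟩
    χ c K.* sum χ K.- sum χ                 ≈⟨ K.+-congʳ (*-distribˡ-sum (χ c) χ) ⟩
    sum (λ x → χ c K.* χ x) K.- sum χ       ≈⟨ K.+-congʳ (sum-cong λ x → χ-* c x) ⟨
    sum (λ x → χ (c * x)) K.- sum χ         ≈⟨ K.+-congʳ (sum-scale c≢0 χ) ⟨
    sum χ K.- sum χ                         ≈⟨ K.-‿inverseʳ _ ⟩
    K.0#                                    ∎) χc-1≉0
    where
    χc-1≉0 : ¬ (χ c K.- K.1# K.≈ K.0#)
    χc-1≉0 eq = χc≉1 (begin
      χ c                               ≈⟨ KS.solve 1 (λ x → x KS.:= (x KS.:+ KS.:- oneₖ) KS.:+ oneₖ) K.refl (χ c) ⟩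
      χ c K.- K.1# K.+ K.1#             ≈⟨ K.+-congʳ eq ⟩
      K.0# K.+ K.1#                     ≈⟨ K.+-identityˡ _ ⟩
      K.1#                              ∎)

  -- With y = v⁻¹ the summand becomes χ(v - 1) for v ≠ 0. The full sum of χ is 0 and the missing
  -- term at v = 0 is χ(-1) = 1, which leaves -1.
  jacobi : sum (λ y → χ² y K.* χ (1# - y)) K.≈ K.- K.1#
  jacobi = begin
    sum (λ y → χ² y K.* χ (1# - y))                    ≈⟨ sum-⁻¹ _ ⟩
    sum (λ v → χ² (v ⁻¹) K.* χ (1# - v ⁻¹))            ≈⟨ KS.solve 1 (λ s → s KS.:= s KS.:+ oneₖ KS.:+ KS.:- oneₖ) K.refl _ ⟩
    sum T K.+ K.1# K.- K.1#                            ≈⟨ K.+-congʳ (K.+-congˡ (K.trans (sum-δ 0# (λ v → χ (v - 1#))) at0)) ⟨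
    sum T K.+ sum (λ v → ⟦ v ≟ 0# ⟧ K.* χ (v - 1#)) K.- K.1#       ≈⟨ K.+-congʳ (sum-+ T _) ⟨
    sum (λ v → T v K.+ ⟦ v ≟ 0# ⟧ K.* χ (v - 1#)) K.- K.1#         ≈⟨ K.+-congʳ (sum-cong λ v → pointwise v (v ≟ 0#)) ⟩
    sum (λ v → χ (1# * v + -1#)) K.- K.1#              ≈⟨ K.+-congʳ (sum-affine 1# -1# 1≢0 χ) ⟨
    sum χ K.- K.1#                                     ≈⟨ K.+-congʳ sum-χ ⟩
    K.0# K.- K.1#                                      ≈⟨ K.+-identityˡ _ ⟩
    K.- K.1#                                           ∎
    where
    T : 𝔽 → K.Carrier
    T v = χ² (v ⁻¹) K.* χ (1# - v ⁻¹)

    at0 : χ (0# - 1#) K.≈ K.1#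
    at0 = K.trans (χ-≡ (+-identityˡ -1#)) χ-[-1]

    pointwise : ∀ v (d : Dec (v ≡ 0#)) → T v K.+ ⟦ d ⟧ K.* χ (v - 1#) K.≈ χ (1# * v + -1#)
    pointwise v (yes refl) = begin
      χ² (0# ⁻¹) K.* χ (1# - 0# ⁻¹) K.+ K.1# K.* χ (0# - 1#)
          ≈⟨ K.+-cong (K.trans (K.*-congʳ (K.trans (K.*-cong (χ-≡ 0⁻¹) (χ-≡ 0⁻¹)) χ²-0)) (K.zeroˡ _)) (K.*-identityˡ _) ⟩
      K.0# K.+ χ (0# - 1#)                                     ≈⟨ K.+-identityˡ _ ⟩
      χ (0# - 1#)                                              ≡⟨ cong χ (solve 0 (nought :+ :- one := one :* nought :+ :- one) refl) ⟩
      χ (1# * 0# + -1#)                                        ∎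
    pointwise v (no v≢0) = begin
      χ² (v ⁻¹) K.* χ (1# - v ⁻¹) K.+ K.0# K.* χ (v - 1#)      ≈⟨ K.trans (K.+-congˡ (K.zeroˡ _)) (K.+-identityʳ _) ⟩
      χ² (v ⁻¹) K.* χ (1# - v ⁻¹)                              ≈⟨ K.*-congʳ (χ-inverse (trans (*-comm (v ⁻¹) v) (⁻¹-inverse v≢0))) ⟨
      χ v K.* χ (1# - v ⁻¹)                                    ≈⟨ χ-* v _ ⟨
      χ (v * (1# - v ⁻¹))                                      ≡⟨ cong χ (trans (solve 2 (λ v i → v :* (one :+ :- i) :=
          one :* v :+ :- (v :* i)) refl v (v ⁻¹)) (cong (λ u → 1# * v - u) (⁻¹-inverse v≢0))) ⟩
      χ (1# * v + -1#)                                         ∎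

  -- The hypergeometric sum, rewritten by y = 1/v.
  P : 𝔽 → K.Carrier
  P t = sum λ v → χ v K.* χ (v - 1#) K.* χ² (v - t)

  hypergeometric : ∀ t → sum (λ y → χ² y K.* χ (1# - y) K.* χ² (1# - t * y)) K.≈ P t
  hypergeometric t = K.trans (sum-⁻¹ _) (sum-cong λ v → pointwise v (v ≟ 0#))
    where
    pointwise : ∀ v → Dec (v ≡ 0#) → χ² (v ⁻¹) K.* χ (1# - v ⁻¹) K.* χ² (1# - t * v ⁻¹) K.≈ χ v K.* χ (v - 1#) K.* χ² (v - t)
    pointwise v (yes refl) = K.trans
      (K.trans (K.*-congʳ (K.trans (K.*-congʳ (K.trans (K.*-cong (χ-≡ 0⁻¹) (χ-≡ 0⁻¹)) χ²-0)) (K.zeroˡ _))) (K.zeroˡ _))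
      (K.sym (K.trans (K.*-congʳ (K.trans (K.*-congʳ χ-0) (K.zeroˡ _))) (K.zeroˡ _)))
    pointwise v (no v≢0) = begin
      χ² i K.* χ (1# - i) K.* χ² (1# - t * i)
          ≈⟨ K.*-congʳ (K.*-congʳ (χ-inverse (trans (*-comm i v) vi≡1))) ⟨
      χ v K.* χ (1# - i) K.* χ² (1# - t * i)                                       ≈⟨ K.*-identityˡ _ ⟨
      -- The inserted χ(v)³ supplies one factor χ(v) for 1 - v⁻¹ and two for the squared value at 1
      -- - t v⁻¹.
      K.1# K.* (χ v K.* χ (1# - i) K.* χ² (1# - t * i))                            ≈⟨ K.*-congʳ (χ-cubed v≢0) ⟨
      χ v K.* χ v K.* χ v K.* (χ v K.* χ (1# - i) K.* χ² (1# - t * i))             ≈⟨ KS.solve 3 (λ v x y →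
        v KS.:* v KS.:* v KS.:* (v KS.:* x KS.:* (y KS.:* y)) KS.:= v KS.:* (v KS.:* x) KS.:* ((v KS.:* y) KS.:*
            (v KS.:* y))) K.refl _ _ _ ⟩
      χ v K.* (χ v K.* χ (1# - i)) K.* ((χ v K.* χ (1# - t * i)) K.* (χ v K.* χ (1# - t * i)))
          ≈⟨ K.*-cong (K.*-congˡ (merge (1# - i))) (K.*-cong (merge (1# - t * i)) (merge (1# - t * i))) ⟩
      χ v K.* χ (v * (1# - i)) K.* χ² (v * (1# - t * i))                           ≡⟨ cong₂ (λ x y → χ v K.* χ x K.* χ² y) v[1-i] v[1-ti] ⟩
      χ v K.* χ (v - 1#) K.* χ² (v - t)                                            ∎
      where
      i = v ⁻¹
      vi≡1 = ⁻¹-inverse v≢0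
      merge : ∀ x → χ v K.* χ x K.≈ χ (v * x)
      merge x = K.sym (χ-* v x)
      v[1-i] : v * (1# - i) ≡ v - 1#
      v[1-i] = trans (solve 2 (λ v i → v :* (one :+ :- i) := v :+ :- (v :* i)) refl v i) (cong (λ u → v - u) vi≡1)
      v[1-ti] : v * (1# - t * i) ≡ v - t
      v[1-ti] = trans (solve 3 (λ v i t → v :* (one :+ :- (t :* i)) := v :+ :- (t :* (v :* i))) refl v i t)
        (cong (λ u → v - u) (trans (cong (t *_) vi≡1) (*-identityʳ t)))

  -- The substitution v ↦ 1 - v exchanges v and v - 1 and sends v - t to its counterpart, all up to
  -- signs, which χ ignores.
  P-reflect : ∀ t → P (1# - t) K.≈ P t
  P-reflect t = K.trans (sum-affine -1# 1# -1≢0 _) (sum-cong λ v → begin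
    χ (-1# * v + 1#) K.* χ (-1# * v + 1# - 1#) K.* χ² (-1# * v + 1# - (1# - t))
      ≡⟨ cong₂ (λ x y → x K.* (y K.* y)) (cong₂ (λ x y → χ x K.* χ y)
           (solve 1 (λ v → :- one :* v :+ one := :- (v :+ :- one)) refl v) (solve 1 (λ v → :- one :* v :+ one :+ :- one := :- v) refl v))
           (cong χ (solve 2 (λ v t → :- one :* v :+ one :+ :- (one :+ :- t) := :- (v :+ :- t)) refl v t)) ⟩
    χ (- (v - 1#)) K.* χ (- v) K.* χ² (- (v - t))
        ≈⟨ K.*-cong (K.trans (K.*-cong (χ-neg (v - 1#)) (χ-neg v)) (K.*-comm _ _)) (K.*-cong (χ-neg (v - t)) (χ-neg (v - t))) ⟩
    χ v K.* χ (v - 1#) K.* χ² (v - t)                 ∎)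

  module _ {ω : 𝔽} (ω≢1 : ω ≢ 1#) (ω-root : ω * ω + ω + 1# ≡ 0#) {t : 𝔽} (t≢0 : t ≢ 0#) (t≢1 : t ≢ 1#) where

    private
      OnCurve : 𝔽 → 𝔽 → Set
      OnCurve g v = v * (1# + g - v) ≡ t * g

      onCurve? : ∀ g v → Dec (OnCurve g v)
      onCurve? g v = v * (1# + g - v) ≟ t * g

      count : 𝔽 → K.Carrier
      count g = fromℕ K (curvePoints t g)

      count-sum : ∀ g → count g K.≈ sum (λ v → ⟦ onCurve? g v ⟧)
      count-sum g = K.trans (fromℕ-sum K _) (sum-cong λ v → fromℕ-⟦⟧ K (onCurve? g v))

      -- For v ≠ t, the only g with v on the curve is v (v − 1) / (v − t).
      solve-g : ∀ v g → (v * (1# + g - v) - t * g) ≡ (v - t) * g - v * (v - 1#)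
      solve-g v g = solve 3 (λ t v g → v :* (one :+ g :+ :- v) :+ :- (t :* g) := (v :+ :- t) :* g :+ :- (v :* (v :+ :- one))) refl t v g

      -- For v ≠ t there is exactly one g, and dividing by v - t turns χ into χ². For v = t an
      -- equation for g would force t (t - 1) = 0, so the left side is empty, and the right side
      -- contains χ²(0) = 0.
      fibre : ∀ v → sum (λ g → ⟦ onCurve? g v ⟧ K.* χ g) K.≈ χ v K.* χ (v - 1#) K.* χ² (v - t)
      fibre v with v ≟ t
      ... | yes refl = K.trans
        (sum-none (λ g → onCurve? g t) χ λ g eq → [ t≢0 , (λ t-1≡0 → t≢1 (x-y≡0 t-1≡0)) ]′ (x*y≡0 (trans
          (solve 2 (λ t g → t :* (t :+ :- one) := :- (t :* (one :+ g :+ :- t) :+ :- (t :* g))) refl t g)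
          (trans (cong -_ (x≡y⇒x-y≡0 eq)) (solve 0 (:- nought := nought) refl)))))
        (K.sym (K.trans (K.*-congˡ (K.trans (K.*-cong (χ-≡ (-‿inverseʳ t)) (χ-≡ (-‿inverseʳ t))) χ²-0)) (K.zeroʳ _)))
      ... | no v≢t = begin
        sum (λ g → ⟦ onCurve? g v ⟧ K.* χ g)           ≈⟨ sum-unique (λ g → onCurve? g v) χ g₀
                                                             (x-y≡0 (trans (solve-g v g₀) (x≡y⇒x-y≡0 d*g₀)))
                                                             (λ g eq → *-cancelˡ d≢0 (trans (x-y≡0 (trans (sym
                                                                 (solve-g v g)) (x≡y⇒x-y≡0 eq))) (sym d*g₀))) ⟩
        χ (v * (v - 1#) * i)                           ≈⟨ K.trans (χ-* _ i) (K.*-congʳ (χ-* v _)) ⟩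
        χ v K.* χ (v - 1#) K.* χ i                     ≈⟨ K.*-congˡ (χ-inverse (inv-inverse (v - t) d≢0)) ⟩
        χ v K.* χ (v - 1#) K.* χ² (v - t)              ∎
        where
        d≢0 : v - t ≢ 0#
        d≢0 v-t≡0 = v≢t (x-y≡0 v-t≡0)
        i = inv (v - t) d≢0
        g₀ = v * (v - 1#) * i
        d*g₀ : (v - t) * g₀ ≡ v * (v - 1#)
        d*g₀ = trans (solve 3 (λ d a i → d :* (a :* i) := d :* i :* a) refl (v - t) (v * (v - 1#)) i)
          (trans (cong (_* (v * (v - 1#))) (inv-inverse (v - t) d≢0)) (*-identityˡ _))

      -- Multiplying v by g carries the equation over g⁻¹ to the one over g. Through this symmetry χ
      -- and its conjugate contribute the same sum.
      curvePoints-⁻¹ : ∀ {g} → g ≢ 0# → curvePoints t (g ⁻¹) ≡ curvePoints t g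
      curvePoints-⁻¹ {g} g≢0 = sym (trans
        (Reindexing.sum-scale ℕ.+-*-commutativeSemiring g≢0 (λ v → ℕΣ.⟦ onCurve? g v ⟧))
        (ℕΣ.sum-cong λ v → ℕΣ.⟦⟧-cong (onCurve? g (g * v)) (onCurve? (g ⁻¹) v)
          (λ eq → *-cancelˡ (*-≢0 g≢0 g≢0) (trans (left v) (trans eq (sym right))))
          (λ eq → trans (sym (left v)) (trans (cong (g * g *_) eq) right))))
        where
        left : ∀ v → g * g * (v * (1# + g ⁻¹ - v)) ≡ g * v * (1# + g - g * v)
        left v = trans (solve 3 (λ g i v → g :* g :* (v :* (one :+ i :+ :- v)) := g :* v :* (g :* i :+ g :+ :- (g :* v))) refl g (g ⁻¹) v)
          (cong (λ u → g * v * (u + g - g * v)) (⁻¹-inverse g≢0))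
        right : g * g * (t * g ⁻¹) ≡ t * g
        right = trans (solve 3 (λ g i t → g :* g :* (t :* i) := t :* g :* (g :* i)) refl g (g ⁻¹) t)
          (trans (cong (t * g *_) (⁻¹-inverse g≢0)) (*-identityʳ _))

    P-count : P t K.≈ sum (λ g → count g K.* χ g)
    P-count = begin
      sum (λ v → χ v K.* χ (v - 1#) K.* χ² (v - t))               ≈⟨ sum-cong fibre ⟨
      sum (λ v → sum (λ g → ⟦ onCurve? g v ⟧ K.* χ g))            ≈⟨ sum-sift onCurve? χ ⟨
      sum (λ g → sum (λ v → ⟦ onCurve? g v ⟧) K.* χ g)            ≈⟨ sum-cong (λ g → K.*-congʳ (count-sum g)) ⟨
      sum (λ g → count g K.* χ g)                                 ∎

    P-count² : P t K.≈ sum (λ g → count g K.* χ² g)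
    P-count² = K.trans P-count (K.trans (sum-⁻¹ _) (sum-cong λ g → pointwise g (g ≟ 0#)))
      where
      pointwise : ∀ g → Dec (g ≡ 0#) → count (g ⁻¹) K.* χ (g ⁻¹) K.≈ count g K.* χ² g
      pointwise g (no g≢0)   = K.*-cong (K.reflexive (cong (fromℕ K) (curvePoints-⁻¹ g≢0))) (χ-⁻¹ g)
      pointwise g (yes refl) = K.*-cong (K.reflexive (cong count 0⁻¹)) (χ-⁻¹ 0#)

    private
      f : 𝔽 → ℕ
      f g = ℕΣ.⟦ nonzero? g ⟧ ℕ.* curvePoints t g

      weighted : ∀ a → fromℕ K (cubeRoots a ℕ.* f a) K.≈ fromℕ K (f a) K.+ (count a K.* χ a K.+ count a K.* χ² a)
      weighted a = by-cases (a ≟ 0#)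
        where
        by-cases : (d : Dec (a ≡ 0#)) → let fa = ℕΣ.⟦ ¬? d ⟧ ℕ.* curvePoints t a in
                   fromℕ K (cubeRoots a ℕ.* fa) K.≈ fromℕ K fa K.+ (count a K.* χ a K.+ count a K.* χ² a)
        by-cases (yes refl) = begin
          fromℕ K (cubeRoots 0# ℕ.* 0)                             ≡⟨ cong (fromℕ K) (ℕ.*-zeroʳ (cubeRoots 0#)) ⟩
          K.0#
              ≈⟨ KS.solve 1 (λ c →
              KS.con (ℤ.+ 0) KS.:= KS.con (ℤ.+ 0) KS.:+ (c KS.:* KS.con (ℤ.+ 0) KS.:+ c KS.:* KS.con (ℤ.+ 0))) K.refl (count 0#) ⟩
          K.0# K.+ (count 0# K.* K.0# K.+ count 0# K.* K.0#)       ≈⟨ K.+-congˡ (K.+-cong (K.*-congˡ χ-0) (K.*-congˡ χ²-0)) ⟨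
          K.0# K.+ (count 0# K.* χ 0# K.+ count 0# K.* χ² 0#)      ∎
        by-cases (no a≢0) = begin
          fromℕ K (cubeRoots a ℕ.* (curvePoints t a ℕ.+ 0))
              ≡⟨ cong (λ u → fromℕ K (cubeRoots a ℕ.* u)) (ℕ.+-identityʳ (curvePoints t a)) ⟩
          fromℕ K (cubeRoots a ℕ.* curvePoints t a)                ≈⟨ fromℕ-* K (cubeRoots a) (curvePoints t a) ⟩
          fromℕ K (cubeRoots a) K.* count a                        ≈⟨ K.*-congʳ (fromℕ-cubeRoots a≢0) ⟩
          1+χ+χ² a K.* count a
              ≈⟨ KS.solve 2 (λ c x →
              (oneₖ KS.:+ x KS.:+ x KS.:* x) KS.:* c KS.:= c KS.:+ (c KS.:* x KS.:+ c KS.:* (x KS.:* x))) K.refl (count a) (χ a) ⟩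
          count a K.+ (count a K.* χ a K.+ count a K.* χ² a)
              ≡⟨ cong (λ u → fromℕ K u K.+ (count a K.* χ a K.+ count a K.* χ² a)) (ℕ.+-identityʳ (curvePoints t a)) ⟨
          fromℕ K (curvePoints t a ℕ.+ 0) K.+ (count a K.* χ a K.+ count a K.* χ² a)   ∎

      cubed-curve : ℕΣ.sum (λ w → ℕΣ.⟦ nonzero? w ⟧ ℕ.* curvePoints t (cube w)) ≡ ℕΣ.sum (λ a → cubeRoots a ℕ.* f a)
      cubed-curve = trans
        (ℕΣ.sum-cong λ w → cong (ℕ._* curvePoints t (cube w)) (ℕΣ.⟦⟧-cong (nonzero? w) (nonzero? (cube w)) cube-≢0 cube≢0⇒≢0))
        (sym (sum-cubeRoots f))

      -- Replacing g by w³ weights every g ≠ 0 by 1 + χ(g) + χ²(g); the last two terms each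
      -- contribute P(t).
      cubed-curve-P : fromℕ K (ℕΣ.sum (λ a → cubeRoots a ℕ.* f a)) K.≈ fromℕ K (ℕΣ.sum f) K.+ (P t K.+ P t)
      cubed-curve-P = begin
        fromℕ K (ℕΣ.sum (λ a → cubeRoots a ℕ.* f a))                                     ≈⟨ fromℕ-sum K _ ⟩
        sum (λ a → fromℕ K (cubeRoots a ℕ.* f a))                                        ≈⟨ sum-cong weighted ⟩
        sum (λ a → fromℕ K (f a) K.+ (count a K.* χ a K.+ count a K.* χ² a))             ≈⟨ K.trans (sum-+ _ _) (K.+-congˡ (sum-+ _ _)) ⟩
        sum (λ a → fromℕ K (f a)) K.+ (sum (λ a → count a K.* χ a) K.+ sum (λ a → count a K.* χ² a))
            ≈⟨ K.+-cong (fromℕ-sum K f) (K.+-cong P-count P-count²) ⟨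
        fromℕ K (ℕΣ.sum f) K.+ (P t K.+ P t)                                             ∎

    -- The image of the counting identity in `K`, with the sum over all g ≠ 0 cancelled. The
    -- constant depends only on the field, so equal cubic counts give equal doubles of P.
    cubicPoints-P : fromℕ K (cubicPoints t ℕ.+ cubicPoints t) K.≈
      P t K.+ P t K.+ fromℕ K (ℕΣ.sum (λ m → ℕΣ.⟦ nonzero? (m * (1# - m)) ⟧) ℕ.+ ℕΣ.sum (λ m → ℕΣ.⟦ nonzero? (m * (1# - m)) ⟧))
    cubicPoints-P = +-cancelʳ (fromℕ K B) _ _ (begin
      fromℕ K 2h K.+ fromℕ K B                   ≈⟨ fromℕ-+ K 2h B ⟨
      fromℕ K (2h ℕ.+ B)                         ≡⟨ cong (fromℕ K) curve-count ⟩
      fromℕ K (A ℕ.+ 2N)                         ≈⟨ fromℕ-+ K A 2N ⟩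
      fromℕ K A K.+ fromℕ K 2N                   ≈⟨ K.+-congʳ cubed-curve-P ⟩
      fromℕ K B K.+ (P t K.+ P t) K.+ fromℕ K 2N
          ≈⟨ KS.solve 3 (λ b p n → b KS.:+ (p KS.:+ p) KS.:+ n KS.:= p KS.:+ p KS.:+ n KS.:+ b) K.refl (fromℕ K B) (P t) (fromℕ K 2N) ⟩
      P t K.+ P t K.+ fromℕ K 2N K.+ fromℕ K B   ∎)
      where
      2h = cubicPoints t ℕ.+ cubicPoints t
      A  = ℕΣ.sum (λ a → cubeRoots a ℕ.* f a)
      B  = ℕΣ.sum f
      2N = ℕΣ.sum (λ m → ℕΣ.⟦ nonzero? (m * (1# - m)) ⟧) ℕ.+ ℕΣ.sum (λ m → ℕΣ.⟦ nonzero? (m * (1# - m)) ⟧)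
      curve-count : 2h ℕ.+ B ≡ A ℕ.+ 2N
      curve-count = trans (cubic-curve-count ω-root (ω⇒3≢0 ω≢1 ω-root) t≢0) (cong (ℕ._+ 2N) cubed-curve)

  double-injective : ∀ {x y} → x K.+ x K.≈ y K.+ y → x K.≈ y
  double-injective {x} {y} 2x≈2y = begin
    x                   ≈⟨ KS.solve 2 (λ x y → x KS.:= (x KS.:+ KS.:- y) KS.:+ y) K.refl x y ⟩
    x K.- y K.+ y       ≈⟨ K.+-congʳ (no-zero-divisor (begin
      (K.1# K.+ K.1#) K.* (x K.- y)
          ≈⟨ KS.solve 2 (λ x y → (oneₖ KS.:+ oneₖ) KS.:* (x KS.:+ KS.:- y) KS.:= x KS.:+ x KS.:+ KS.:- (y KS.:+ y)) K.refl x y ⟩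
      x K.+ x K.- (y K.+ y)             ≈⟨ K.+-congʳ 2x≈2y ⟩
      y K.+ y K.- (y K.+ y)             ≈⟨ K.-‿inverseʳ _ ⟩
      K.0#                              ∎) 2≉0) ⟩
    K.0# K.+ y          ≈⟨ K.+-identityˡ y ⟩
    y                   ∎

  module _ {ω : 𝔽} (ω≢1 : ω ≢ 1#) (ω-root : ω * ω + ω + 1# ≡ 0#) where

    P-cubicPoints : ∀ {s t} → s ≢ 0# → s ≢ 1# → t ≢ 0# → t ≢ 1# → cubicPoints s ≡ cubicPoints t → P s K.≈ P t
    P-cubicPoints s≢0 s≢1 t≢0 t≢1 eq = double-injective (+-cancelʳ _ _ _
      (K.trans (K.sym (cubicPoints-P ω≢1 ω-root s≢0 s≢1))
        (K.trans (K.reflexive (cong (λ h → fromℕ K (h ℕ.+ h)) eq)) (cubicPoints-P ω≢1 ω-root t≢0 t≢1))))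

    -- 1 − ν³ vanishes exactly when μ = 0 or 1 + μ + μ² = 0, and 1 − μ³ vanishes
    -- when ν = 0 or 1 + μ + μ² = 0; in these cases both arguments are 0 or 1.
    P-cubic : ∀ {μ ν} → 1# + 2# * μ ≢ 0# → ν * (1# + 2# * μ) ≡ 1# - μ → P (1# - cube μ) K.≈ P (cube ν)
    P-cubic {μ} {ν} κ≢0 νκ≡1-μ = by-cases (μ ≟ 0#) (ν ≟ 0#) (q ≟ 0#)
      where
      κ = 1# + 2# * μ
      q = 1# + μ + μ * μ

      factor-μ : 1# - cube μ ≡ (1# - μ) * q
      factor-μ = solve 1 (λ m → one :+ :- cubeₚ m := (one :+ :- m) :* (one :+ m :+ m :* m)) refl μ

      -- This is (1 + 2 μ)³ - (1 - μ)³: the difference of the two bases is 3 μ, and the quadratic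
      -- cofactor is 3 (1 + μ + μ²).
      factor-ν : cube κ * (1# - cube ν) ≡ 3# * 3# * μ * q
      factor-ν = trans (solve 2 (λ k v → cubeₚ k :* (one :+ :- cubeₚ v) := cubeₚ k :+ :- cubeₚ (v :* k)) refl κ ν)
        (trans (cong (λ u → cube κ - cube u) νκ≡1-μ)
          (solve 1 (λ m → cubeₚ (one :+ two :* m) :+ :- cubeₚ (one :+ :- m) := three :* three :* m :* (one :+ m :+ m :* m)) refl μ))

      factor-ν≡0 : 3# * 3# * μ * q ≡ 0# → cube ν ≡ 1#
      factor-ν≡0 eq = sym (x-y≡0 (*-cancelˡ (cube-≢0 κ≢0) (trans factor-ν (trans eq (sym (zeroʳ (cube κ)))))))

      ν≡0⇒1-μ≡0 : ν ≡ 0# → 1# - μ ≡ 0#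
      ν≡0⇒1-μ≡0 ν≡0 = trans (sym νκ≡1-μ) (trans (cong (_* κ) ν≡0) (zeroˡ κ))

      reflected : ∀ {x y} → x ≡ 1# - y → P x K.≈ P y
      reflected {y = y} refl = P-reflect y

      by-cases : Dec (μ ≡ 0#) → Dec (ν ≡ 0#) → Dec (q ≡ 0#) → P (1# - cube μ) K.≈ P (cube ν)
      by-cases (yes μ≡0) _ _ = K.reflexive (cong P (trans
        (trans (cong (λ u → 1# - cube u) μ≡0) (solve 0 (one :+ :- cubeₚ nought := one) refl))
        (sym (factor-ν≡0 (trans (cong (λ u → 3# * 3# * u * q) μ≡0) (solve 1 (λ q → three :* three :* nought :* q := nought) refl q))))))
      by-cases _ (yes ν≡0) _ = K.reflexive (cong P (trans
        (trans factor-μ (trans (cong (_* q) (ν≡0⇒1-μ≡0 ν≡0)) (zeroˡ q)))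
        (sym (trans (cong cube ν≡0) (solve 0 (cubeₚ nought := nought) refl)))))
      -- The arguments are 0 and 1 here, which the reflection exchanges.
      by-cases _ _ (yes q≡0) = reflected (trans
        (trans factor-μ (trans (cong ((1# - μ) *_) q≡0) (zeroʳ _)))
        (sym (x≡y⇒x-y≡0 (sym (factor-ν≡0 (trans (cong (3# * 3# * μ *_) q≡0) (zeroʳ _)))))))
      by-cases (no μ≢0) (no ν≢0) (no q≢0) = K.trans
        -- The Hesse pencil relates 1 - μ³ to 1 - ν³; the reflection then passes to ν³.
        (P-cubicPoints 1-μ³≢0 (λ eq → cube-≢0 μ≢0 (1-x≡1 eq)) 1-ν³≢0 (λ eq → cube-≢0 ν≢0 (1-x≡1 eq))
          (cubicPoints-invariant ω-root 3≢0 μ≢0 ν≢0 κ≢0 νκ≡1-μ))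
        (P-reflect (cube ν))
        where
        3≢0 = ω⇒3≢0 ω≢1 ω-root

        1-x≡1 : ∀ {x} → 1# - x ≡ 1# → x ≡ 0#
        1-x≡1 {x} eq = trans (solve 1 (λ x → x := one :+ :- (one :+ :- x)) refl x) (trans (cong (λ u → 1# - u) eq) (-‿inverseʳ 1#))

        1-μ≢0 : 1# - μ ≢ 0#
        1-μ≢0 eq = *-≢0 ν≢0 κ≢0 (trans νκ≡1-μ eq)

        1-μ³≢0 : 1# - cube μ ≢ 0#
        1-μ³≢0 eq = *-≢0 1-μ≢0 q≢0 (trans (sym factor-μ) eq)

        1-ν³≢0 : 1# - cube ν ≢ 0#
        1-ν³≢0 eq = *-≢0 (*-≢0 (*-≢0 3≢0 3≢0) μ≢0) q≢0 (trans (sym factor-ν) (trans (cong (cube κ *_) eq) (zeroʳ _)))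

  P-cubic-transformation : ∀ {μ ν} → 1# + 2# * μ ≢ 0# → ν * (1# + 2# * μ) ≡ 1# - μ → P (1# - cube μ) K.≈ P (cube ν)
  P-cubic-transformation = P-cubic (proj₁ (proj₂ cube-root-of-unity)) (proj₂ (proj₂ cube-root-of-unity))

-- Real and complex numbers

module RealNumbers where
  open Sequences using (_~_)
  open import Data.Rational.Base using (_<_; _≤_)

  private
    Small : (ℕ → ℚ) → ℚ → Set
    Small s ε = ∃ λ N → ∀ n → N ℕ.≤ n → ∣ s n ∣ < ε

    Large : (ℕ → ℚ) → ℚ → Set
    Large s ε = ∃ λ N → ∀ n → N ℕ.≤ n → ε < ∣ s n ∣

    0~ : ℕ → ℚ
    0~ _ = 0ℚ

    ⅓ : ℚ
    ⅓ = ℤ.+ 1 ℚ./ 3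

    0<ε⅓ : ∀ {ε} → 0ℚ < ε → 0ℚ < ε ℚ.* ⅓
    0<ε⅓ {ε} 0<ε = subst (_< ε ℚ.* ⅓) (ℚ.*-zeroˡ ⅓) (ℚ.*-monoˡ-<-pos ⅓ 0<ε)

    thirds : ∀ ε → ε ℚ.* ⅓ ℚ.+ (ε ℚ.* ⅓ ℚ.+ ε ℚ.* ⅓) ≡ ε
    thirds ε = trans (cong (ε ℚ.* ⅓ ℚ.+_) (sym (ℚ.*-distribˡ-+ ε ⅓ ⅓)))
      (trans (sym (ℚ.*-distribˡ-+ ε ⅓ (⅓ ℚ.+ ⅓))) (ℚ.*-identityʳ ε))

    ~0⇒small : ∀ {s} → s ~ 0~ → ∀ ε → 0ℚ < ε → Small s ε
    ~0⇒small {s} s~0 ε 0<ε with s~0 ε 0<ε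
    ... | N , h = N , λ n N≤n → subst (λ q → ∣ q ∣ < ε) (ℚ.+-identityʳ (s n)) (h n n N≤n N≤n)

    small⇒~0 : ∀ {s} → (∀ ε → 0ℚ < ε → Small s ε) → s ~ 0~
    small⇒~0 {s} small ε 0<ε with small ε 0<ε
    ... | N , h = N , λ m _ N≤m _ → subst (λ q → ∣ q ∣ < ε) (sym (ℚ.+-identityʳ (s m))) (h m N≤m)

    -- A dichotomy that is decidable: compare one late term with 2 ε / 3. All later terms lie within
    -- ε / 3 of it, hence stay below ε in one case and above ε / 3 in the other.
    small-or-large : ∀ {s} → s ~ s → ∀ ε → 0ℚ < ε → Small s ε ⊎ Large s (ε ℚ.* ⅓)
    small-or-large {s} s~s ε 0<ε with s~s (ε ℚ.* ⅓) (0<ε⅓ 0<ε)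
    ... | N , h with ∣ s N ∣ ℚ.<? ε ℚ.* ⅓ ℚ.+ ε ℚ.* ⅓
    ...   | yes below = inj₁ (N , λ n N≤n → begin-strict
      ∣ s n ∣                                    ≡⟨ cong ∣_∣ (RingIdentities.split ℚ.+-*-commutativeRing (s n) (s N)) ⟩
      ∣ (s n ℚ.- s N) ℚ.+ s N ∣                  ≤⟨ ℚ.∣p+q∣≤∣p∣+∣q∣ (s n ℚ.- s N) (s N) ⟩
      ∣ s n ℚ.- s N ∣ ℚ.+ ∣ s N ∣                <⟨ ℚ.+-mono-< (h n N N≤n ℕ.≤-refl) below ⟩
      ε ℚ.* ⅓ ℚ.+ (ε ℚ.* ⅓ ℚ.+ ε ℚ.* ⅓)          ≡⟨ thirds ε ⟩
      ε                                          ∎)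
      where open ℚ.≤-Reasoning
    ...   | no ¬below = inj₂ (N , λ n N≤n → ℚ.≰⇒> λ sn≤ → ¬below (begin-strict
      ∣ s N ∣                                    ≡⟨ cong ∣_∣ (RingIdentities.split ℚ.+-*-commutativeRing (s N) (s n)) ⟩
      ∣ (s N ℚ.- s n) ℚ.+ s n ∣                  ≤⟨ ℚ.∣p+q∣≤∣p∣+∣q∣ (s N ℚ.- s n) (s n) ⟩
      ∣ s N ℚ.- s n ∣ ℚ.+ ∣ s n ∣                <⟨ ℚ.+-mono-<-≤ (h N n ℕ.≤-refl N≤n) sn≤ ⟩
      ε ℚ.* ⅓ ℚ.+ ε ℚ.* ⅓                        ∎))
      where open ℚ.≤-Reasoning

    -- Convergence to 0 is thereby reduced to refutations, which is the source of double-negation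
    -- stability.
    not-large⇒~0 : ∀ {s} → s ~ s → (∀ ε → 0ℚ < ε → ¬ Large s ε) → s ~ 0~
    not-large⇒~0 {s} s~s ¬large = small⇒~0 {s} λ ε 0<ε →
      [ (λ small → small) , (λ large → contradiction large (¬large (ε ℚ.* ⅓) (0<ε⅓ 0<ε))) ]′ (small-or-large {s} s~s ε 0<ε)

    ¬small∧large : ∀ s {ε} → Small s ε → ¬ Large s ε
    ¬small∧large s (N , h) (M , k) =
      ℚ.<-asym (h (N ℕ.⊔ M) (ℕ.m≤m⊔n N M)) (k (N ℕ.⊔ M) (ℕ.m≤n⊔m N M))

    ~0-stable : ∀ s → s ~ s → ¬ ¬ (s ~ 0~) → s ~ 0~
    ~0-stable s s~s ¬¬s~0 = not-large⇒~0 {s} s~s λ ε 0<ε large →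
      ¬¬s~0 λ s~0 → ¬small∧large s (~0⇒small {s} s~0 ε 0<ε) large

    0<*-pos : ∀ {p q} → 0ℚ < p → 0ℚ < q → 0ℚ < p ℚ.* q
    0<*-pos {p} {q} 0<p 0<q = ℚ.positive⁻¹ _ {{ℚ.pos*pos⇒pos p {{ℚ.positive 0<p}} q {{ℚ.positive 0<q}}}}

    -- If u were eventually above some η > 0, the bound ε η on the product would give the bound ε on
    -- s, so s would tend to 0.
    ~0-domain : ∀ (s u : ℕ → ℚ) → u ~ u → (λ n → s n ℚ.* u n) ~ 0~ → ¬ (s ~ 0~) → u ~ 0~
    ~0-domain s u u~u su~0 ¬s~0 = not-large⇒~0 {u} u~u λ η 0<η large → ¬s~0 (small⇒~0 {s} λ ε 0<ε →
      quotient-small {{ℚ.pos⇒nonNeg η {{ℚ.positive 0<η}}}} large (~0⇒small {λ n → s n ℚ.* u n} su~0 (ε ℚ.* η) (0<*-pos 0<ε 0<η)))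
      where
      open ℚ.≤-Reasoning
      quotient-small : ∀ {ε η} {{_ : ℚ.NonNegative η}} → Large u η → Small (λ n → s n ℚ.* u n) (ε ℚ.* η) → Small s ε
      quotient-small {ε} {η} (M , large) (N , small) = N ℕ.⊔ M , λ n NM≤n → ℚ.*-cancelʳ-<-nonNeg η (begin-strict
        ∣ s n ∣ ℚ.* η          ≤⟨ ℚ.*-monoˡ-≤-nonNeg ∣ s n ∣ {{ℚ.∣-∣-nonNeg (s n)}} (ℚ.<⇒≤ (large n (ℕ.m⊔n≤o⇒n≤o N M NM≤n))) ⟩
        ∣ s n ∣ ℚ.* ∣ u n ∣    ≡⟨ ℚ.∣p*q∣≡∣p∣*∣q∣ (s n) (u n) ⟨
        ∣ s n ℚ.* u n ∣        <⟨ small n (ℕ.m⊔n≤o⇒m≤o N M NM≤n) ⟩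
        ε ℚ.* η                ∎)

    square≡∣∣² : ∀ q → q ℚ.* q ≡ ∣ q ∣ ℚ.* ∣ q ∣
    square≡∣∣² q with ℚ.∣p∣≡p∨∣p∣≡-p q
    ... | inj₁ eq = cong (λ r → r ℚ.* r) (sym eq)
    ... | inj₂ eq = trans (sym (trans (sym (ℚ.neg-distribˡ-* q (ℚ.- q))) (trans (cong ℚ.-_ (sym (ℚ.neg-distribʳ-* q q)))
        (neg-involutive (q ℚ.* q))))) (cong (λ r → r ℚ.* r) (sym eq))
      where neg-involutive = Group.⁻¹-involutive ℚ.+-0-group

    0≤square : ∀ q → 0ℚ ≤ q ℚ.* q
    0≤square q = subst (0ℚ ≤_) (sym (square≡∣∣² q))
      (ℚ.nonNegative⁻¹ _ {{ℚ.nonNeg*nonNeg⇒nonNeg (∣ q ∣) (∣ q ∣)}})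
      where instance _ = ℚ.∣-∣-nonNeg q

    sum-of-squares~0 : ∀ (s u : ℕ → ℚ) → (λ n → s n ℚ.* s n ℚ.+ u n ℚ.* u n) ~ 0~ → s ~ 0~
    sum-of-squares~0 s u s²+u²~0 = small⇒~0 {s} λ ε 0<ε →
      root-small {{ℚ.pos⇒nonNeg ε {{ℚ.positive 0<ε}}}} (~0⇒small {λ n → s n ℚ.* s n ℚ.+ u n ℚ.* u n} s²+u²~0 (ε ℚ.* ε) (0<*-pos 0<ε 0<ε))
      where
      open ℚ.≤-Reasoning
      root-small : ∀ {ε} {{_ : ℚ.NonNegative ε}} → Small (λ n → s n ℚ.* s n ℚ.+ u n ℚ.* u n) (ε ℚ.* ε) → Small s ε
      root-small {ε} (N , small) = N , λ n N≤n → ℚ.≰⇒> λ ε≤∣sn∣ → ℚ.<-irrefl refl (begin-strict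
        ε ℚ.* ε                                   ≤⟨ ℚ.*-monoˡ-≤-nonNeg ε ε≤∣sn∣ ⟩
        ε ℚ.* ∣ s n ∣                             ≤⟨ ℚ.*-monoʳ-≤-nonNeg ∣ s n ∣ {{ℚ.∣-∣-nonNeg (s n)}} ε≤∣sn∣ ⟩
        ∣ s n ∣ ℚ.* ∣ s n ∣                       ≡⟨ square≡∣∣² (s n) ⟨
        s n ℚ.* s n                               ≡⟨ ℚ.+-identityʳ (s n ℚ.* s n) ⟨
        s n ℚ.* s n ℚ.+ 0ℚ                        ≤⟨ ℚ.+-mono-≤ (ℚ.≤-refl {s n ℚ.* s n}) (0≤square (u n)) ⟩
        s n ℚ.* s n ℚ.+ u n ℚ.* u n               ≡⟨ ℚ.0≤p⇒∣p∣≡p (ℚ.+-mono-≤ (0≤square (s n)) (0≤square (u n))) ⟨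
        ∣ s n ℚ.* s n ℚ.+ u n ℚ.* u n ∣           <⟨ small n N≤n ⟩
        ε ℚ.* ε                                   ∎)

  open CommutativeRing ℝ-commutativeRing

  ℝ-stableDomain : StableDomain ℝ-commutativeRing
  ℝ-stableDomain = record
    { stable = λ {x} {y} ¬¬x≈y → x∙y⁻¹≈ε⇒x≈y x y
        (~0-stable (ℝ.seq (x - y)) (ℝ.cauchy (x - y)) λ ¬x-y≈0 → ¬¬x≈y λ x≈y → ¬x-y≈0 (x≈y⇒x∙y⁻¹≈ε {x} {y} x≈y))
    ; no-zero-divisor = λ {x} {y} → ~0-domain (ℝ.seq x) (ℝ.seq y) (ℝ.cauchy y)
    ; 2≉0 = λ 2≈0 → let N , h = 2≈0 1ℚ (ℚ.positive⁻¹ 1ℚ) in from-no (1ℚ ℚ.+ 1ℚ ℚ.- 0ℚ ℚ.<? 1ℚ) (h N N ℕ.≤-refl ℕ.≤-refl)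
    }
    where open Group +-group

  sum-of-squares≈0 : ∀ x y → x * x + y * y ≈ 0# → x ≈ 0#
  sum-of-squares≈0 x y = sum-of-squares~0 (ℝ.seq x) (ℝ.seq y)

module _ (R : CommutativeRing 0ℓ 0ℓ) where
  open CommutativeRing R renaming (refl to ≈-refl; sym to ≈-sym; trans to ≈-trans)
  open IntegerSolver R using (solve; _:=_; _:+_; _:*_; :-_)
  open import Relation.Binary.Reasoning.Setoid setoid

  adjoin-i-stableDomain : StableDomain R → (∀ x y → x * x + y * y ≈ 0# → x ≈ 0#) → StableDomain (adjoin-i R)
  adjoin-i-stableDomain R-domain sum-of-squares = record
    { stable          = λ ¬¬eq → stable (λ ¬eq → ¬¬eq (¬eq ∘ proj₁)) , stable (λ ¬eq → ¬¬eq (¬eq ∘ proj₂))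
    ; no-zero-divisor = λ {z} {w} → domain z w
    ; 2≉0             = 2≉0 ∘ proj₁
    }
    where
    open StableDomain R-domain

    norm≈0 : ∀ a b → a * a + b * b ≈ 0# → a ≈ 0# × b ≈ 0#
    norm≈0 a b eq = sum-of-squares a b eq , sum-of-squares b a (≈-trans (+-comm _ _) eq)

    -- The norm a² + b² is multiplicative and vanishes only at 0, so the claim for R[i] follows from
    -- cancelling the norm of z in R.
    domain : ∀ (z w : Carrier × Carrier) → let (a , b) = z ; (c , d) = w in
             a * c + - (b * d) ≈ 0# × a * d + b * c ≈ 0# → ¬ (a ≈ 0# × b ≈ 0#) → c ≈ 0# × d ≈ 0#
    domain (a , b) (c , d) (re≈0 , im≈0) z≉0 = norm≈0 c d (no-zero-divisor (begin
      (a * a + b * b) * (c * c + d * d)                        ≈⟨ solve 4 (λ a b c d → (a :* a :+ b :* b) :* (c :* c :+ d :* d) :=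
                                                                    (a :* c :+ :- (b :* d)) :* (a :* c :+ :- (b :* d))
                                                                        :+ (a :* d :+ b :* c) :* (a :* d :+ b :* c)) ≈-refl a b c d ⟩
      re * re + im * im                                        ≈⟨ +-cong (*-congˡ re≈0) (*-congˡ im≈0) ⟩
      re * 0# + im * 0#                                        ≈⟨ +-cong (zeroʳ re) (zeroʳ im) ⟩
      0# + 0#                                                  ≈⟨ +-identityˡ 0# ⟩
      0#                                                       ∎) (z≉0 ∘ norm≈0 a b))
      where
      re = a * c + - (b * d)
      im = a * d + b * c

opaque
  unfolding ℂ-commutativeRing

  ℂ-stableDomain : StableDomain ℂ-commutativeRing
  ℂ-stableDomain = adjoin-i-stableDomain ℝ-commutativeRing RealNumbers.ℝ-stableDomain RealNumbers.sum-of-squares≈0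

-- Each instance of excluded middle is irrefutable, and double negation commutes with finite
-- products.
¬¬-decidable : ∀ {n} (P : Fin n → Set) → ¬ ¬ (∀ x → Dec (P x))
¬¬-decidable P = sequence (RawMonad.rawApplicative ¬¬-Monad) λ x → ¬¬-excluded-middle

-- The prime field and the hypergeometric sums

module Specialisation (p : ℕ) (p-prime : Prime p) where
  open PrimeField p p-prime using (𝔽ₚ; inv; *-inverseʳ)
    renaming (_+_ to _⊕_; _*_ to _⊛_; _-_ to _⊝_; 0# to 𝟘; 1# to 𝟙; _^_ to _↑_; inverse to inverseₚ; 1≢0 to 𝟙≢𝟘)
  open ComplexCharacters p p-prime

  primeField : FiniteField p
  primeField = record
    { isCommutativeRing = CommutativeRing.isCommutativeRing 𝔽ₚ
    ; inverse           = inverseₚ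
    ; 1≢0               = 𝟙≢𝟘
    }

  open import Relation.Binary.Reasoning.Setoid ℂ.setoid

  ε-≢0 : ∀ {x} → x ≢ 𝟘 → fun ε x ℂ.≈ ℂ.1#
  ε-≢0 {x} x≢0 with x ≟ 𝟘
  ... | yes x≡0 = contradiction x≡0 x≢0
  ... | no  _   = ℂ.refl

  fun-≡0 : ∀ χ {x} → x ≡ 𝟘 → fun χ x ℂ.≈ ℂ.0#
  fun-≡0 χ refl = fun-0 χ

  ⁻¹-≢0 : ∀ χ {x} → x ≢ 𝟘 → ∃ λ y → x ⊛ y ≡ 𝟙 × fun (χ ⁻¹) x ℂ.≈ fun χ y
  ⁻¹-≢0 χ {x} x≢0 with x ≟ 𝟘
  ... | yes x≡0 = contradiction x≡0 x≢0
  ... | no  x≢0 = inv x x≢0 , *-inverseʳ x x≢0 , ℂ.refl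

  module _ (η : Character) (order3 : HasOrder η 3) where

    -- Powers formed by `_^χ_` end in a factor `ε`, which is 1 away from 0.
    ε-identityʳ : ∀ {x} → x ≢ 𝟘 → ∀ z → z ℂ.* fun ε x ℂ.≈ z
    ε-identityʳ x≢0 z = ℂ.trans (ℂ.*-congˡ (ε-≢0 x≢0)) (ℂ.*-identityʳ z)

    cubicCharacter : CubicCharacter primeField ℂ-commutativeRing
    cubicCharacter = record
      { χ          = fun η
      ; χ-0        = fun-0 η
      ; χ-1        = fun-1 η
      ; χ-*        = fun-* η
      ; χ-cubed    = λ {x} x≢0 → begin
          fun η x ℂ.* fun η x ℂ.* fun η x                    ≈⟨ ℂ.*-assoc _ _ _ ⟩
          fun η x ℂ.* (fun η x ℂ.* fun η x)                  ≈⟨ ℂ.*-congˡ (ℂ.*-congˡ (ε-identityʳ x≢0 _)) ⟨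
          fun (η ^χ 3) x                                     ≈⟨ proj₁ order3 x ⟩
          fun ε x                                            ≈⟨ ε-≢0 x≢0 ⟩
          ℂ.1#                                               ∎
      ; nontrivial = λ trivial → proj₂ order3 1 (ℕ.s≤s z≤n) (ℕ.s≤s (ℕ.s≤s z≤n)) λ x → η≈ε trivial x (x ≟ 𝟘)
      }
      where
      η≈ε : (∀ x → x ≢ 𝟘 → fun η x ℂ.≈ ℂ.1#) → ∀ x → Dec (x ≡ 𝟘) → fun (η ^χ 1) x ℂ.≈ fun ε x
      η≈ε trivial x (yes x≡0) = ℂ.trans (fun-≡0 (η ^χ 1) x≡0) (ℂ.sym (fun-≡0 ε x≡0))
      η≈ε trivial x (no x≢0)  = ℂ.trans (ℂ.*-congʳ (trivial x x≢0)) (ℂ.*-identityˡ _)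

    open StableDomain ℂ-stableDomain using (stable)
    open Sums ℂ.commutativeSemiring using (sum; sum-def; sum-cong)

    module Classical (trivial? : ∀ x → Dec (fun η x ℂ.≈ ℂ.1#)) where
      open FieldProperties primeField hiding (inv; _⁻¹; ⁻¹-≢0)
      open HessePencil primeField using (cube)
      open Dickson primeField using (2#)
      open CubicCharacterSums ℂ-stableDomain cubicCharacter trivial?

      η^2≈χ² : ∀ y → fun (η ^χ 2) y ℂ.≈ χ² y
      η^2≈χ² y = by-cases (y ≟ 0#)
        where
        by-cases : Dec (y ≡ 0#) → fun (η ^χ 2) y ℂ.≈ χ² y
        by-cases (yes refl) = ℂ.trans (fun-0 (η ^χ 2)) (ℂ.sym χ²-0)
        by-cases (no y≢0)   = ℂ.*-congˡ (ε-identityʳ y≢0 _)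

      ε·η^-2≈χ : ∀ y → fun (ε · (η ^χ 2) ⁻¹) y ℂ.≈ fun η y
      ε·η^-2≈χ y = by-cases (y ≟ 0#)
        where
        by-cases : Dec (y ≡ 0#) → fun (ε · (η ^χ 2) ⁻¹) y ℂ.≈ fun η y
        by-cases (yes refl) = ℂ.trans (fun-0 (ε · (η ^χ 2) ⁻¹)) (ℂ.sym (fun-0 η))
        by-cases (no y≢0) = let i , yi≡1 , inverse≈ = ⁻¹-≢0 (η ^χ 2) y≢0 in begin
          fun ε y ℂ.* fun ((η ^χ 2) ⁻¹) y      ≈⟨ ℂ.trans (ℂ.*-congʳ (ε-≢0 y≢0)) (ℂ.*-identityˡ _) ⟩
          fun ((η ^χ 2) ⁻¹) y                  ≈⟨ inverse≈ ⟩
          fun (η ^χ 2) i                       ≈⟨ η^2≈χ² i ⟩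
          χ² i                                 ≈⟨ χ-inverse (trans (*-comm i y) yi≡1) ⟨
          fun η y                              ∎

      η^-1≈χ² : ∀ y → fun (η ⁻¹) y ℂ.≈ χ² y
      η^-1≈χ² y = by-cases (y ≟ 0#)
        where
        by-cases : Dec (y ≡ 0#) → fun (η ⁻¹) y ℂ.≈ χ² y
        by-cases (yes refl) = ℂ.trans (fun-0 (η ⁻¹)) (ℂ.sym χ²-0)
        by-cases (no y≢0) = let i , yi≡1 , inverse≈ = ⁻¹-≢0 η y≢0 in ℂ.trans inverse≈ (χ-inverse yi≡1)

      J≈-1 : J (η ^χ 2) (ε · (η ^χ 2) ⁻¹) ℂ.≈ ℂ.- ℂ.1#
      J≈-1 = begin
        J (η ^χ 2) (ε · (η ^χ 2) ⁻¹)                        ≡⟨ sum-def _ ⟨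
        sum _                                               ≈⟨ sum-cong (λ y → ℂ.*-cong (η^2≈χ² y) (ε·η^-2≈χ (1# - y))) ⟩
        sum (λ y → χ² y ℂ.* fun η (1# - y))                 ≈⟨ jacobi ⟩
        ℂ.- ℂ.1#                                            ∎

      ₂ℙ₁≈P : ∀ t → ₂ℙ₁ η (η ^χ 2) ε t ℂ.≈ P t
      ₂ℙ₁≈P t = begin
        ₂ℙ₁ η (η ^χ 2) ε t                                                   ≡⟨ sum-def _ ⟨
        sum _
            ≈⟨ sum-cong (λ y → ℂ.*-cong (ℂ.*-cong (η^2≈χ² y) (ε·η^-2≈χ (1# - y))) (η^-1≈χ² (1# - t * y))) ⟩
        sum (λ y → χ² y ℂ.* fun η (1# - y) ℂ.* χ² (1# - t * y))              ≈⟨ hypergeometric t ⟩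
        P t                                                                  ∎

      transformation : ∀ {l m} → 1# + 2# * l ≢ 0# → m * (1# + 2# * l) ≡ 1# - l →
                           ₂ℙ₁ η (η ^χ 2) ε (1# - cube l) ℂ.≈ ₂ℙ₁ η (η ^χ 2) ε (cube m)
      transformation {l} {m} κ≢0 eq =
        ℂ.trans (₂ℙ₁≈P (1# - cube l)) (ℂ.trans (P-cubic-transformation κ≢0 eq) (ℂ.sym (₂ℙ₁≈P (cube m))))

    private
      -- Equality in ℂ is undecidable but ¬¬-stable.
      classically : ∀ {x y} → ((∀ x → Dec (fun η x ℂ.≈ ℂ.1#)) → x ℂ.≈ y) → x ℂ.≈ y
      classically f = stable λ x≉y → ¬¬-decidable (λ x → fun η x ℂ.≈ ℂ.1#) (x≉y ∘ f)

    J≈-1 : J (η ^χ 2) (ε · (η ^χ 2) ⁻¹) ℂ.≈ ℂ.- ℂ.1#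
    J≈-1 = classically Classical.J≈-1

    -- The Jacobi sum -1 is its own inverse. The same witness normalises both hypergeometric values,
    -- so comparing the unnormalised sums is enough.
    J-unit : IsUnit (J (η ^χ 2) (ε · (η ^χ 2) ⁻¹))
    J-unit = ℂ.- ℂ.1# , ℂ.trans (ℂ.*-congˡ J≈-1) [-1]²≈1 , ℂ.trans (ℂ.*-congʳ J≈-1) [-1]²≈1
      where
      open IntegerSolver ℂ-commutativeRing using (solve; con; _:=_; _:*_; :-_)
      [-1]²≈1 : ℂ.- ℂ.1# ℂ.* ℂ.- ℂ.1# ℂ.≈ ℂ.1#
      [-1]²≈1 = solve 0 (:- con (ℤ.+ 1) :* :- con (ℤ.+ 1) := con (ℤ.+ 1)) ℂ.refl

    ₂ℙ₁-transformation : ∀ {l} (κ≢0 : 𝟙 ⊕ (𝟙 ⊕ 𝟙) ⊛ l ≢ 𝟘) →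
      ₂ℙ₁ η (η ^χ 2) ε (𝟙 ⊝ l ↑ 3) ℂ.≈ ₂ℙ₁ η (η ^χ 2) ε (((𝟙 ⊝ l) ⊛ inv (𝟙 ⊕ (𝟙 ⊕ 𝟙) ⊛ l) κ≢0) ↑ 3)
    ₂ℙ₁-transformation {l} κ≢0 = classically λ trivial? → begin
      ₂ℙ₁ η (η ^χ 2) ε (𝟙 ⊝ l ↑ 3)         ≡⟨ cong (λ u → ₂ℙ₁ η (η ^χ 2) ε (𝟙 ⊝ u)) (↑3≡cube l) ⟩
      ₂ℙ₁ η (η ^χ 2) ε (𝟙 ⊝ cube l)        ≈⟨ Classical.transformation trivial? κ≢0 mκ≡1-l ⟩
      ₂ℙ₁ η (η ^χ 2) ε (cube m)            ≡⟨ cong (₂ℙ₁ η (η ^χ 2) ε) (↑3≡cube m) ⟨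
      ₂ℙ₁ η (η ^χ 2) ε (m ↑ 3)             ∎
      where
      open FieldProperties primeField using (solve; one; _:=_; _:*_; *-assoc; *-comm; *-identityʳ)
      open HessePencil primeField using (cube; cubeₚ)
      κ = 𝟙 ⊕ (𝟙 ⊕ 𝟙) ⊛ l
      m = (𝟙 ⊝ l) ⊛ inv κ κ≢0

      ↑3≡cube : ∀ x → x ↑ 3 ≡ cube x
      ↑3≡cube = solve 1 (λ x → x :* (x :* (x :* one)) := cubeₚ x) refl

      mκ≡1-l : m ⊛ κ ≡ 𝟙 ⊝ l
      mκ≡1-l = trans (*-assoc (𝟙 ⊝ l) (inv κ κ≢0) κ)
        (trans (cong ((𝟙 ⊝ l) ⊛_) (trans (*-comm (inv κ κ≢0) κ) (*-inverseʳ κ κ≢0))) (*-identityʳ (𝟙 ⊝ l)))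

corollary1p2 : (p : ℕ) (p-prime : Prime p) → p % 3 ≡ 1 →
    let open PrimeField p p-prime
        open ComplexCharacters p p-prime in
    (η₃ : Character) → HasOrder η₃ 3 →
    (l : 𝔽) (1+2l≢0 : 1# + (1# + 1#) * l ≢ 0#) →
    Σ[ J-unit ∈ IsUnit (J (η₃ ^χ 2) (ε · (η₃ ^χ 2) ⁻¹)) ]
      ₂𝔽₁ η₃ (η₃ ^χ 2) ε J-unit (1# - l ^ 3)
        ℂ.≈
      ₂𝔽₁ η₃ (η₃ ^χ 2) ε J-unit (((1# - l) * inv (1# + (1# + 1#) * l) 1+2l≢0) ^ 3)
corollary1p2 p p-prime _ η₃ order3 l 1+2l≢0 =
  J-unit η₃ order3 , ℂ.*-congˡ (₂ℙ₁-transformation η₃ order3 1+2l≢0)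
  where open Specialisation p p-prime
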